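{- Let $F$ be a field of characteristic $2$, let $\phi$ be an anisotropic quasilinear quadratic form of dimension $\ge2$ over $F$, and let $s$ be the smallest nonnegative integer with $2^s\ge i_1(\phi)$. Then the first higher anisotropic kernel $\phi_1$ (a form over $F_1=F(\phi)$) is divisible by an $s$-fold quasi-Pfister form over $F_1$.
   Context: Let $F$ be a field of characteristic $2$. A quasilinear quadratic form over a field $K$ of characteristic 2 is a map $\phi\colon V\to K$ on a nonzero finite-dimensional $K$-vector space, homogeneous of degree 2 and additive; equivalently $\phi\simeq\langle a_1,\dots,a_n\rangle\colon(\lambda_i)\mapsto\sum a_i\lambda_i^2$ (these are the totally singular quadratic forms). Tensor product: $(\phi\otimes\psi)(v\otimes w)=\phi(v)\psi(w)$; $\phi$ is divisible by $\psi$ if $\phi\simeq\psi\otimes\tau$ for some form $\tau$. The isotropy index $i_0(\phi)$ is the dimension of the subspace of vectors with $\phi(v)=0$; $\phi$ is anisotropic if $i_0(\phi)=0$; $\phi_{an}$ is the unique anisotropic form with the same value set $D(\phi)$. For non-split $\phi$ (i.e. $\dim\phi_{an}\ge 2$), $K(\phi)$ is the function field of the integral quadric $\{\phi=0\}$. For anisotropic $\phi$ of dimension $\ge 2$: $F_1=F(\phi)$, $\phi_1=(\phi_{F_1})_{an}$ and $i_1(\phi)=i_0(\phi_{F_1})$. An $s$-fold quasi-Pfister form is $\langle\langle a_1,\dots,a_s\rangle\rangle=\bigotimes_{i=1}^s\langle1,a_i\rangle$ ($0$-fold: $\langle1\rangle$). -}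

module Defs where

open import Algebra.Bundles using (CommutativeRing)
open import Algebra.Module.Bundles.Raw using (RawLeftModule)
open import Algebra.Module.Morphism.Structures using (module LeftModuleMorphisms)
import Algebra.Definitions.RawMonoid as RawMonoidDefinitions
import Algebra.Properties.Ring as RingProperties
import Algebra.Solver.Ring.NaturalCoefficients.Default as SemiringSolver
open import Data.Fin.Base using (Fin; zero; suc; remQuot)
open import Data.Nat.Base as ℕ using (ℕ; zero; suc)
open import Data.Product.Base using (_×_; _,_; proj₁; proj₂; ∃; ∃₂; Σ-syntax)
open import Data.Vec.Functional using (Vector; []; _∷_; head; tail)
open import Function.Bundles using (_⇔_)
open import Level using (Level; _⊔_)
open import Relation.Nullary.Negation using (¬_)
import Relation.Binary.Reasoning.Setoid as SetoidReasoning

IsLeast : ∀ {p} → (ℕ → Set p) → ℕ → Set p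
IsLeast P s = P s × (∀ t → P t → s ℕ.≤ t)

record IsField {c ℓ} (K : CommutativeRing c ℓ) : Set (c ⊔ ℓ) where
  open CommutativeRing K
  field
    1≉0     : ¬ (1# ≈ 0#)
    inverse : ∀ x → ¬ (x ≈ 0#) → ∃ λ y → x * y ≈ 1#

-- For a field, 1 + 1 = 0 is equivalent to being of characteristic 2.

HasCharacteristic2 : ∀ {c ℓ} → CommutativeRing c ℓ → Set ℓ
HasCharacteristic2 K = 1# + 1# ≈ 0#
  where open CommutativeRing K

module LinearAlgebra {c ℓ} (K : CommutativeRing c ℓ) where
  open CommutativeRing K
  open RawMonoidDefinitions +-rawMonoid public using (sum)

  infix 8 K^_

  K^_ : ℕ → RawLeftModule Carrier c ℓ
  K^ n = record
    { Carrierᴹ = Vector Carrier n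
    ; _≈ᴹ_     = λ v w → ∀ i → v i ≈ w i
    ; _+ᴹ_     = λ v w i → v i + w i
    ; _*ₗ_     = λ a v i → a * v i
    ; 0ᴹ       = λ _ → 0#
    ; -ᴹ_      = λ v i → - v i
    }

  _≈ᵛ_ : ∀ {n} → Vector Carrier n → Vector Carrier n → Set ℓ
  _≈ᵛ_ {n} = RawLeftModule._≈ᴹ_ (K^ n)

  linearCombination : ∀ {n d} → Vector Carrier d → Vector (Vector Carrier n) d →
                      Vector Carrier n
  linearCombination coeffs b i = sum (λ j → coeffs j * b j i)

  LinearlyIndependent : ∀ {n d} → Vector (Vector Carrier n) d → Set (c ⊔ ℓ)
  LinearlyIndependent b = ∀ coeffs → linearCombination coeffs b ≈ᵛ (λ _ → 0#) →
                          ∀ j → coeffs j ≈ 0#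

  -- Only meaningful when P is a linear subspace of Kⁿ.
  HasDimension : ∀ {n p} → (Vector Carrier n → Set p) → ℕ → Set (c ⊔ ℓ ⊔ p)
  HasDimension {n} P d =
    Σ[ b ∈ Vector (Vector Carrier n) d ]
      (∀ j → P (b j)) ×
      LinearlyIndependent b ×
      (∀ v → P v → ∃ λ coeffs → v ≈ᵛ linearCombination coeffs b)

-- ⟨ a ⟩ is the form a₁x₁² + … + aₙxₙ² on Kⁿ.  The type is inhabited for
-- n = 0 as well; where a (necessarily nonzero-dimensional) form is
-- quantified over, the dimension is written as a successor.

record Form {c ℓ} (K : CommutativeRing c ℓ) (n : ℕ) : Set c where
  constructor ⟨_⟩
  field
    coeff : Vector (CommutativeRing.Carrier K) n

open Form public

module _ {c ℓ} {K : CommutativeRing c ℓ} where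
  open CommutativeRing K
  open LinearAlgebra K

  infixl 7 _⊗_
  infix  4 _≃_

  value : ∀ {n} → Form K n → Vector Carrier n → Carrier
  value φ v = sum (λ i → coeff φ i * (v i * v i))

  Represents : ∀ {n} → Form K n → Carrier → Set (c ⊔ ℓ)
  Represents φ x = ∃ λ v → value φ v ≈ x

  -- In terms of the bases (eᵢ) and (fⱼ) diagonalising φ and ψ, this is the
  -- form on the tensor product with value (φ eᵢ)(ψ fⱼ) at eᵢ ⊗ fⱼ.
  _⊗_ : ∀ {m n} → Form K m → Form K n → Form K (m ℕ.* n)
  _⊗_ {m} {n} φ ψ = ⟨ (λ k → coeff φ (proj₁ (remQuot {m} n k)) *
                             coeff ψ (proj₂ (remQuot {m} n k))) ⟩

  _≃_ : ∀ {m n} → Form K m → Form K n → Set (c ⊔ ℓ)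
  _≃_ {m} {n} φ ψ =
    Σ[ f ∈ (Vector Carrier m → Vector Carrier n) ]
      LeftModuleMorphisms.IsLeftModuleIsomorphism (K^ m) (K^ n) f ×
      (∀ v → value ψ (f v) ≈ value φ v)

  _DivisibleBy_ : ∀ {m n} → Form K m → Form K n → Set (c ⊔ ℓ)
  φ DivisibleBy ψ = ∃₂ λ k (τ : Form K (suc k)) → φ ≃ ψ ⊗ τ

  HasIsotropyIndex : ∀ {n} → Form K n → ℕ → Set (c ⊔ ℓ)
  HasIsotropyIndex φ i = HasDimension (λ v → value φ v ≈ 0#) i

  Anisotropic : ∀ {n} → Form K n → Set (c ⊔ ℓ)
  Anisotropic φ = HasIsotropyIndex φ 0

  _IsAnisotropicPartOf_ : ∀ {m n} → Form K m → Form K n → Set (c ⊔ ℓ)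
  ψ IsAnisotropicPartOf φ =
    Anisotropic ψ × (∀ x → Represents ψ x ⇔ Represents φ x)

  quasiPfister : ∀ {s} → Vector Carrier s → Form K (2 ℕ.^ s)
  quasiPfister {zero}  a = ⟨ 1# ∷ [] ⟩
  quasiPfister {suc s} a = ⟨ 1# ∷ head a ∷ [] ⟩ ⊗ quasiPfister (tail a)

-- R[x₁,…,xₘ] is presented as the free commutative
-- R-algebra on m generators, that is, as the terms of the language of
-- commutative R-algebras modulo provable equality.

module Polynomials {c ℓ} (R : CommutativeRing c ℓ) (m : ℕ) where
  private module R = CommutativeRing R

  infixl 6 _+_
  infixl 7 _*_
  infix  8 -_
  infix  4 _≈_

  data Polynomial : Set c where
    const   : R.Carrier → Polynomial
    var     : Fin m → Polynomial
    _+_ _*_ : Polynomial → Polynomial → Polynomial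
    -_      : Polynomial → Polynomial

  data _≈_ : Polynomial → Polynomial → Set (c ⊔ ℓ) where
    refl  : ∀ {p} → p ≈ p
    sym   : ∀ {p q} → p ≈ q → q ≈ p
    trans : ∀ {p q r} → p ≈ q → q ≈ r → p ≈ r

    +-cong : ∀ {p p′ q q′} → p ≈ p′ → q ≈ q′ → p + q ≈ p′ + q′
    *-cong : ∀ {p p′ q q′} → p ≈ p′ → q ≈ q′ → p * q ≈ p′ * q′
    neg-cong : ∀ {p p′} → p ≈ p′ → - p ≈ - p′

    +-assoc     : ∀ p q r → (p + q) + r ≈ p + (q + r)
    +-comm      : ∀ p q → p + q ≈ q + p
    +-identityˡ : ∀ p → const R.0# + p ≈ p
    +-inverseˡ  : ∀ p → - p + p ≈ const R.0#
    *-assoc     : ∀ p q r → (p * q) * r ≈ p * (q * r)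
    *-comm      : ∀ p q → p * q ≈ q * p
    *-identityˡ : ∀ p → const R.1# * p ≈ p
    distribˡ    : ∀ p q r → p * (q + r) ≈ p * q + p * r

    const-cong : ∀ {a b} → a R.≈ b → const a ≈ const b
    const-+    : ∀ a b → const (a R.+ b) ≈ const a + const b
    const-*    : ∀ a b → const (a R.* b) ≈ const a * const b

  polynomialRing : CommutativeRing c (c ⊔ ℓ)
  polynomialRing = record
    { Carrier = Polynomial
    ; _≈_ = _≈_
    ; _+_ = _+_
    ; _*_ = _*_
    ; -_  = -_
    ; 0#  = const R.0#
    ; 1#  = const R.1#
    ; isCommutativeRing = record
      { isRing = record
        { +-isAbelianGroup = record
          { isGroup = record
            { isMonoid = record
              { isSemigroup = record
                { isMagma = record
                  { isEquivalence = record { refl = refl ; sym = sym ; trans = trans }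
                  ; ∙-cong = +-cong
                  }
                ; assoc = +-assoc
                }
              ; identity = +-identityˡ , λ p → trans (+-comm _ _) (+-identityˡ p)
              }
            ; inverse = +-inverseˡ , λ p → trans (+-comm _ _) (+-inverseˡ p)
            ; ⁻¹-cong = neg-cong
            }
          ; comm = +-comm
          }
        ; *-cong = *-cong
        ; *-assoc = *-assoc
        ; *-identity = *-identityˡ , λ p → trans (*-comm _ _) (*-identityˡ p)
        ; distrib = distribˡ , λ p q r →
            trans (*-comm _ _) (trans (distribˡ p q r) (+-cong (*-comm _ _) (*-comm _ _)))
        }
      ; *-comm = *-comm
      }
    }

module PrincipalQuotient {c ℓ} (R : CommutativeRing c ℓ) (h : CommutativeRing.Carrier R) where
  open CommutativeRing R
  open RingProperties ring
  open SemiringSolver commutativeSemiring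
  open SetoidReasoning setoid

  infix 4 _≡ₕ_
  _≡ₕ_ : Carrier → Carrier → Set (c ⊔ ℓ)
  x ≡ₕ y = ∃ λ q → x ≈ y + q * h

  private
    reflexiveₕ : ∀ {x y} → x ≈ y → x ≡ₕ y
    reflexiveₕ {x} {y} x≈y = 0# , (begin
      x            ≈⟨ x≈y ⟩
      y            ≈⟨ +-identityʳ y ⟨
      y + 0#       ≈⟨ +-congˡ (zeroˡ h) ⟨
      y + 0# * h   ∎)

    symₕ : ∀ {x y} → x ≡ₕ y → y ≡ₕ x
    symₕ {x} {y} (q , e) = - q , (begin
      y                         ≈⟨ +-identityʳ y ⟨
      y + 0#                    ≈⟨ +-congˡ (-‿inverseʳ (q * h)) ⟨
      y + (q * h + - (q * h))   ≈⟨ +-assoc _ _ _ ⟨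
      (y + q * h) + - (q * h)   ≈⟨ +-cong (sym e) (-‿distribˡ-* q h) ⟩
      x + - q * h               ∎)

    transₕ : ∀ {x y z} → x ≡ₕ y → y ≡ₕ z → x ≡ₕ z
    transₕ {x} {y} {z} (q , e) (r , f) = r + q , (begin
      x                     ≈⟨ e ⟩
      y + q * h             ≈⟨ +-congʳ f ⟩
      z + r * h + q * h     ≈⟨ solve 4 (λ z r h q → z :+ r :* h :+ q :* h := z :+ (r :+ q) :* h) refl z r h q ⟩
      z + (r + q) * h       ∎)

    +-congₕ : ∀ {x x′ y y′} → x ≡ₕ x′ → y ≡ₕ y′ → x + y ≡ₕ x′ + y′
    +-congₕ {x} {x′} {y} {y′} (q , e) (r , f) = q + r , (begin
      x + y                          ≈⟨ +-cong e f ⟩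
      (x′ + q * h) + (y′ + r * h)
        ≈⟨ solve 5 (λ x y q r h → (x :+ q :* h) :+ (y :+ r :* h) := (x :+ y) :+ (q :+ r) :* h)
                 refl x′ y′ q r h ⟩
      (x′ + y′) + (q + r) * h        ∎)

    *-congₕ : ∀ {x x′ y y′} → x ≡ₕ x′ → y ≡ₕ y′ → x * y ≡ₕ x′ * y′
    *-congₕ {x} {x′} {y} {y′} (q , e) (r , f) = x′ * r + q * y′ + q * h * r , (begin
      x * y                          ≈⟨ *-cong e f ⟩
      (x′ + q * h) * (y′ + r * h)
        ≈⟨ solve 5 (λ x y q r h → (x :+ q :* h) :* (y :+ r :* h) :=
                                  (x :* y) :+ (x :* r :+ q :* y :+ q :* h :* r) :* h)
                 refl x′ y′ q r h ⟩
      x′ * y′ + (x′ * r + q * y′ + q * h * r) * h ∎)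

    -‿congₕ : ∀ {x x′} → x ≡ₕ x′ → - x ≡ₕ - x′
    -‿congₕ {x} {x′} (q , e) = - q , (begin
      - x                   ≈⟨ -‿cong e ⟩
      - (x′ + q * h)        ≈⟨ -‿+-comm x′ (q * h) ⟨
      - x′ + - (q * h)      ≈⟨ +-congˡ (-‿distribˡ-* q h) ⟩
      - x′ + - q * h        ∎)

  quotientRing : CommutativeRing c (c ⊔ ℓ)
  quotientRing = record
    { Carrier = Carrier
    ; _≈_ = _≡ₕ_
    ; _+_ = _+_
    ; _*_ = _*_
    ; -_  = -_
    ; 0#  = 0#
    ; 1#  = 1#
    ; isCommutativeRing = record
      { isRing = record
        { +-isAbelianGroup = record
          { isGroup = record
            { isMonoid = record
              { isSemigroup = record
                { isMagma = record
                  { isEquivalence = record { refl = reflexiveₕ refl ; sym = symₕ ; trans = transₕ }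
                  ; ∙-cong = +-congₕ
                  }
                ; assoc = λ x y z → reflexiveₕ (+-assoc x y z)
                }
              ; identity = (λ x → reflexiveₕ (+-identityˡ x)) , (λ x → reflexiveₕ (+-identityʳ x))
              }
            ; inverse = (λ x → reflexiveₕ (-‿inverseˡ x)) , (λ x → reflexiveₕ (-‿inverseʳ x))
            ; ⁻¹-cong = -‿congₕ
            }
          ; comm = λ x y → reflexiveₕ (+-comm x y)
          }
        ; *-cong = *-congₕ
        ; *-assoc = λ x y z → reflexiveₕ (*-assoc x y z)
        ; *-identity = (λ x → reflexiveₕ (*-identityˡ x)) , (λ x → reflexiveₕ (*-identityʳ x))
        ; distrib = (λ x y z → reflexiveₕ (distribˡ x y z)) , (λ x y z → reflexiveₕ (distribʳ x y z))
        }
      ; *-comm = λ x y → reflexiveₕ (*-comm x y)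
      }
    }

-- The ring of fractions of a commutative ring whose denominators are the
-- elements that are not zero divisors.  Over an integral domain this is
-- the field of fractions; formulating it for arbitrary rings lets it be
-- formed before integrality is known.

module Fractions {c ℓ} (R : CommutativeRing c ℓ) where
  open CommutativeRing R
  open RingProperties ring
  open SemiringSolver commutativeSemiring
  open SetoidReasoning setoid

  Regular : Carrier → Set (c ⊔ ℓ)
  Regular d = ∀ x → d * x ≈ 0# → x ≈ 0#

  record Fraction : Set (c ⊔ ℓ) where
    constructor _/_∣_
    field
      num     : Carrier
      den     : Carrier
      regular : Regular den

  open Fraction public

  infix 4 _≈ᶠ_
  record _≈ᶠ_ (x y : Fraction) : Set ℓ where
    constructor cross
    field
      equation : num x * den y ≈ num y * den x

  private
    cancel : ∀ {d x y} → Regular d → d * x ≈ d * y → x ≈ y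
    cancel {d} {x} {y} reg e = x∙y⁻¹≈ε⇒x≈y x y (reg (x - y) (begin
      d * (x + - y)       ≈⟨ distribˡ d x (- y) ⟩
      d * x + d * - y     ≈⟨ +-cong e (sym (-‿distribʳ-* d y)) ⟩
      d * y + - (d * y)   ≈⟨ -‿inverseʳ (d * y) ⟩
      0#                  ∎))

    *-regular : ∀ {d e} → Regular d → Regular e → Regular (d * e)
    *-regular {d} {e} rd re x p = re x (rd (e * x) (trans (sym (*-assoc d e x)) p))

    1-regular : Regular 1#
    1-regular x p = trans (sym (*-identityˡ x)) p

    transᶠ : ∀ {x y z} → x ≈ᶠ y → y ≈ᶠ z → x ≈ᶠ z
    transᶠ {a / s ∣ _} {b / t ∣ rt} {c / u ∣ _} (cross p) (cross q) = cross (cancel rt (begin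
      t * (a * u)   ≈⟨ solve 3 (λ t a u → t :* (a :* u) := (a :* t) :* u) refl t a u ⟩
      a * t * u     ≈⟨ *-congʳ p ⟩
      b * s * u     ≈⟨ solve 3 (λ b s u → b :* s :* u := (b :* u) :* s) refl b s u ⟩
      b * u * s     ≈⟨ *-congʳ q ⟩
      c * t * s     ≈⟨ solve 3 (λ c t s → c :* t :* s := t :* (c :* s)) refl c t s ⟩
      t * (c * s)   ∎))

  infixl 6 _+ᶠ_
  infixl 7 _*ᶠ_
  infix  8 -ᶠ_

  _+ᶠ_ _*ᶠ_ : Fraction → Fraction → Fraction
  (a / s ∣ rs) +ᶠ (b / t ∣ rt) = (a * t + b * s) / (s * t) ∣ *-regular rs rt
  (a / s ∣ rs) *ᶠ (b / t ∣ rt) = (a * b) / (s * t) ∣ *-regular rs rt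

  -ᶠ_ : Fraction → Fraction
  -ᶠ (a / s ∣ rs) = (- a) / s ∣ rs

  fromBase : Carrier → Fraction
  fromBase a = a / 1# ∣ 1-regular

  0ᶠ 1ᶠ : Fraction
  0ᶠ = fromBase 0#
  1ᶠ = fromBase 1#

  private
    +-congᶠ : ∀ {x x′ y y′} → x ≈ᶠ x′ → y ≈ᶠ y′ → x +ᶠ y ≈ᶠ x′ +ᶠ y′
    +-congᶠ {a / s ∣ _} {a′ / s′ ∣ _} {b / t ∣ _} {b′ / t′ ∣ _} (cross p) (cross q) = cross (begin
      (a * t + b * s) * (s′ * t′)
        ≈⟨ solve 6 (λ a t b s s′ t′ → (a :* t :+ b :* s) :* (s′ :* t′) :=
                                      (a :* s′) :* (t :* t′) :+ (b :* t′) :* (s :* s′))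
                 refl a t b s s′ t′ ⟩
      (a * s′) * (t * t′) + (b * t′) * (s * s′)
        ≈⟨ +-cong (*-congʳ p) (*-congʳ q) ⟩
      (a′ * s) * (t * t′) + (b′ * t) * (s * s′)
        ≈⟨ solve 6 (λ a′ t b′ s s′ t′ → (a′ :* s) :* (t :* t′) :+ (b′ :* t) :* (s :* s′) :=
                                        (a′ :* t′ :+ b′ :* s′) :* (s :* t))
                 refl a′ t b′ s s′ t′ ⟩
      (a′ * t′ + b′ * s′) * (s * t) ∎)

    *-congᶠ : ∀ {x x′ y y′} → x ≈ᶠ x′ → y ≈ᶠ y′ → x *ᶠ y ≈ᶠ x′ *ᶠ y′
    *-congᶠ {a / s ∣ _} {a′ / s′ ∣ _} {b / t ∣ _} {b′ / t′ ∣ _} (cross p) (cross q) = cross (begin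
      (a * b) * (s′ * t′)
        ≈⟨ solve 4 (λ a b s′ t′ → (a :* b) :* (s′ :* t′) := (a :* s′) :* (b :* t′)) refl a b s′ t′ ⟩
      (a * s′) * (b * t′)     ≈⟨ *-cong p q ⟩
      (a′ * s) * (b′ * t)
        ≈⟨ solve 4 (λ a′ s b′ t → (a′ :* s) :* (b′ :* t) := (a′ :* b′) :* (s :* t)) refl a′ s b′ t ⟩
      (a′ * b′) * (s * t)     ∎)

    -‿congᶠ : ∀ {x x′} → x ≈ᶠ x′ → -ᶠ x ≈ᶠ -ᶠ x′
    -‿congᶠ {a / s ∣ _} {a′ / s′ ∣ _} (cross p) = cross (begin
      - a * s′      ≈⟨ -‿distribˡ-* a s′ ⟨
      - (a * s′)    ≈⟨ -‿cong p ⟩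
      - (a′ * s)    ≈⟨ -‿distribˡ-* a′ s ⟩
      - a′ * s      ∎)

    +-commᶠ : ∀ x y → x +ᶠ y ≈ᶠ y +ᶠ x
    +-commᶠ (a / s ∣ _) (b / t ∣ _) = cross
      (solve 4 (λ a s b t → (a :* t :+ b :* s) :* (t :* s) := (b :* s :+ a :* t) :* (s :* t)) refl a s b t)

    *-commᶠ : ∀ x y → x *ᶠ y ≈ᶠ y *ᶠ x
    *-commᶠ (a / s ∣ _) (b / t ∣ _) = cross
      (solve 4 (λ a s b t → (a :* b) :* (t :* s) := (b :* a) :* (s :* t)) refl a s b t)

    +-identityˡᶠ : ∀ x → 0ᶠ +ᶠ x ≈ᶠ x
    +-identityˡᶠ (a / s ∣ _) = cross
      (solve 2 (λ a s → (con 0 :* s :+ a :* con 1) :* s := a :* (con 1 :* s)) refl a s)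

    *-identityˡᶠ : ∀ x → 1ᶠ *ᶠ x ≈ᶠ x
    *-identityˡᶠ (a / s ∣ _) = cross (begin
      (1# * a) * s   ≈⟨ *-congʳ (*-identityˡ a) ⟩
      a * s          ≈⟨ *-congˡ (*-identityˡ s) ⟨
      a * (1# * s)   ∎)

    -‿inverseˡᶠ : ∀ x → (-ᶠ x) +ᶠ x ≈ᶠ 0ᶠ
    -‿inverseˡᶠ (a / s ∣ _) = cross (begin
      (- a * s + a * s) * 1#   ≈⟨ *-congʳ (distribʳ s (- a) a) ⟨
      ((- a + a) * s) * 1#     ≈⟨ *-congʳ (*-congʳ (-‿inverseˡ a)) ⟩
      (0# * s) * 1#            ≈⟨ *-congʳ (zeroˡ s) ⟩
      0# * 1#                  ≈⟨ zeroˡ 1# ⟩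
      0#                       ≈⟨ zeroˡ (s * s) ⟨
      0# * (s * s)             ∎)

    +-assocᶠ : ∀ x y z → (x +ᶠ y) +ᶠ z ≈ᶠ x +ᶠ (y +ᶠ z)
    +-assocᶠ (a / s ∣ _) (b / t ∣ _) (c / u ∣ _) = cross
      (solve 6 (λ a s b t c u →
          ((a :* t :+ b :* s) :* u :+ c :* (s :* t)) :* (s :* (t :* u)) :=
          (a :* (t :* u) :+ (b :* u :+ c :* t) :* s) :* ((s :* t) :* u))
        refl a s b t c u)

    *-assocᶠ : ∀ x y z → (x *ᶠ y) *ᶠ z ≈ᶠ x *ᶠ (y *ᶠ z)
    *-assocᶠ (a / s ∣ _) (b / t ∣ _) (c / u ∣ _) = cross
      (solve 6 (λ a s b t c u →
          ((a :* b) :* c) :* (s :* (t :* u)) := (a :* (b :* c)) :* ((s :* t) :* u))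
        refl a s b t c u)

    distribˡᶠ : ∀ x y z → x *ᶠ (y +ᶠ z) ≈ᶠ (x *ᶠ y) +ᶠ (x *ᶠ z)
    distribˡᶠ (a / s ∣ _) (b / t ∣ _) (c / u ∣ _) = cross
      (solve 6 (λ a s b t c u →
          (a :* (b :* u :+ c :* t)) :* ((s :* t) :* (s :* u)) :=
          ((a :* b) :* (s :* u) :+ (a :* c) :* (s :* t)) :* (s :* (t :* u)))
        refl a s b t c u)

  fractionRing : CommutativeRing (c ⊔ ℓ) ℓ
  fractionRing = record
    { Carrier = Fraction
    ; _≈_ = _≈ᶠ_
    ; _+_ = _+ᶠ_
    ; _*_ = _*ᶠ_
    ; -_  = -ᶠ_
    ; 0#  = 0ᶠ
    ; 1#  = 1ᶠ
    ; isCommutativeRing = record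
      { isRing = record
        { +-isAbelianGroup = record
          { isGroup = record
            { isMonoid = record
              { isSemigroup = record
                { isMagma = record
                  { isEquivalence = record
                    { refl  = cross refl
                    ; sym   = λ (cross p) → cross (sym p)
                    ; trans = transᶠ
                    }
                  ; ∙-cong = +-congᶠ
                  }
                ; assoc = +-assocᶠ
                }
              ; identity = +-identityˡᶠ , λ x → transᶠ (+-commᶠ x 0ᶠ) (+-identityˡᶠ x)
              }
            ; inverse = -‿inverseˡᶠ , λ x → transᶠ (+-commᶠ x (-ᶠ x)) (-‿inverseˡᶠ x)
            ; ⁻¹-cong = -‿congᶠ
            }
          ; comm = +-commᶠ
          }
        ; *-cong = *-congᶠ
        ; *-assoc = *-assocᶠ
        ; *-identity = *-identityˡᶠ , λ x → transᶠ (*-commᶠ x 1ᶠ) (*-identityˡᶠ x)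
        ; distrib = distribˡᶠ , λ x y z →
            transᶠ (*-commᶠ (y +ᶠ z) x) (transᶠ (distribˡᶠ x y z)
              (+-congᶠ {x *ᶠ y} {y *ᶠ x} {x *ᶠ z} {z *ᶠ x} (*-commᶠ x y) (*-commᶠ x z)))
        }
      ; *-comm = *-commᶠ
      }
    }

-- For φ = ⟨a₀,…,aₘ⟩, the chart x₀ = 1 of the projective quadric φ = 0 is the affine scheme
-- with coordinate ring F[x₁,…,xₘ] / (a₀ + a₁x₁² + … + aₘxₘ²).  If φ is
-- anisotropic of dimension at least 2 over a field F, then this ring is
-- an integral domain, and its field of fractions is the function field of the quadric.

module FunctionField {c ℓ} {F : CommutativeRing c ℓ} {m} (φ : Form F (suc m)) where
  private module P = CommutativeRing (Polynomials.polynomialRing F m)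
  open Polynomials F m using (Polynomial; const; var)
  open LinearAlgebra (Polynomials.polynomialRing F m) using (sum)

  chartEquation : Polynomial
  chartEquation =
    const (head (coeff φ)) P.+ sum (λ i → const (tail (coeff φ) i) P.* (var i P.* var i))

  coordinateRing : CommutativeRing c (c ⊔ ℓ)
  coordinateRing = PrincipalQuotient.quotientRing (Polynomials.polynomialRing F m) chartEquation

  functionField : CommutativeRing (c ⊔ ℓ) (c ⊔ ℓ)
  functionField = Fractions.fractionRing coordinateRing

  scalar : CommutativeRing.Carrier F → CommutativeRing.Carrier functionField
  scalar a = Fractions.fromBase coordinateRing (const a)

  extendScalars : ∀ {n} → Form F n → Form functionField n
  extendScalars ψ = ⟨ (λ i → scalar (coeff ψ i)) ⟩

open FunctionField public using (functionField)

overFunctionField : ∀ {c ℓ} {F : CommutativeRing c ℓ} {m} (φ : Form F (suc m)) →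
                    Form (functionField φ) (suc m)
overFunctionField φ = FunctionField.extendScalars φ φ

-- Write V for the space of isotropic vectors of φ over F₁, the field of fractions of the
-- coordinate ring A = R ⊕ R t, where R = F[x] is a polynomial ring and t² = q is the solution
-- of a₀ + a₁ t² + Σ aⱼ₊₂ xⱼ² = 0, and let ∂ be the R-linear derivation of A with ∂ t = 1.
-- A vector v + t w over A, with v and w over R, is isotropic iff φ(v) = q φ(w), and since φ
-- stays anisotropic over R, this together with φ(w) = φ(∂(v + t w)) = 0 forces v = w = 0.
-- The Hasse derivative of order 2 with respect to xⱼ maps the square of f to the square of
-- ∂ⱼ f and a₁ q to aⱼ₊₂, so it turns the relation φ(v) = q φ(w) into
-- φ(∂ⱼ v) = q φ(∂ⱼ w) + aⱼ₊₂ c, where c = φ(w) / a₁.  Hence aⱼ₊₂ c = φ(∂ⱼ v + t ∂ⱼ w) is a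
-- value of φ, as is a₁ c = φ(w), and therefore also a₀ c.  So c multiplies the set D of values
-- of φ over F₁ into itself, and because v + t w ↦ c is semilinear with respect to squaring
-- and injective on V, the i₁ scalars c obtained from a basis of V are linearly independent over
-- F₁².  As long as 2^r < i₁ they cannot all be values of an r-fold quasi-Pfister form, whence an
-- anisotropic s-fold quasi-Pfister form whose values multiply D into itself can be built.  These
-- values form a field, and a basis of D over it gives the other factor of φ₁.

module Submission where

open import Algebra.Bundles using (AbelianGroup; CommutativeRing)
import Algebra.Construct.DirectProduct as DirectProduct
import Algebra.Morphism.Construct.Composition as Composition
import Algebra.Morphism.Construct.Identity as Identity
open import Algebra.Morphism.Structures using (IsRingHomomorphism)
import Algebra.Properties.CommutativeMonoid.Sum as CommutativeMonoidSum
import Algebra.Properties.Ring as RingProperties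
import Algebra.Properties.Semiring.Sum as SemiringSum
import Algebra.Solver.Ring.NaturalCoefficients.Default as SemiringSolver
open import Axiom.ExcludedMiddle using (ExcludedMiddle)
open import Data.Empty using (⊥-elim)
open import Data.Fin.Base using (Fin; zero; suc; combine; remQuot; punchIn; punchOut; _↑ˡ_; _↑ʳ_)
import Data.Fin.Properties as Finₚ
open import Data.Nat.Base as ℕ using (ℕ; zero; suc; _≤_; z≤n; s≤s)
import Data.Nat.Properties as ℕₚ
open import Data.Product.Base using (_×_; _,_; proj₁; proj₂; ∃; ∃₂; uncurry)
open import Data.Sum.Base as Sum using (_⊎_; inj₁; inj₂)
open import Data.Vec.Functional using (Vector; []; _∷_; head; tail)
open import Function.Base using (_∘_; id)
open import Function.Bundles using (Equivalence)
open import Level using (Level; _⊔_; Lift; lift)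
open import Relation.Binary.PropositionalEquality.Core as ≡ using (_≡_)
import Relation.Binary.Reasoning.Setoid as SetoidReasoning
open import Relation.Nullary.Decidable.Core using (yes; no)
open import Relation.Nullary.Negation using (¬_)
open import Defs

-- The map `v + t w ↦ c` is semilinear although `∂` is not linear over A: in
-- `∂ (g u) = g ∂ u + u ∂ g` the second summand is isotropic whenever u is, so additivity of φ
-- leaves `φ (∂ (g u)) = g² φ (∂ u)`. The derivation is never extended to fractions; isotropic
-- vectors over F₁ are multiplied by a common denominator and differentiated over A.
--
-- That A is a domain rests on the anisotropy of φ over R: `a₁ (a² + q b²)` is the value of φ at
-- `(b , a , b x)`, so a nonzero `a + b t` has nonzero norm. Anisotropy passes from F to R by a
-- descent that divides a vector by one variable at a time.
--
-- Whether c multiplies D into itself need only be tested on the coefficients of φ, because these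
-- span D over the squares. The test then applies to φ₁ as well, which has the same D.
--
-- The values of an r-fold quasi-Pfister form lie in the span of 2^r elements over the squares,
-- which bounds the number of independent scalars c among them. Hence, while 2^r < i₁, some c is not
-- a value and can be adjoined as a new slot; anisotropy survives because the values form a field.

private variable
  c ℓ c₁ ℓ₁ c₂ ℓ₂ : Level

-- Integrality, isotropic vectors and ring homomorphisms

IsIntegral : CommutativeRing c ℓ → Set (c ⊔ ℓ)
IsIntegral R = ∀ x y → x * y ≈ 0# → x ≈ 0# ⊎ y ≈ 0#
  where open CommutativeRing R

-- `Anisotropic` asks for an empty basis of the space of isotropic vectors. The pointwise condition
-- is the one that can be carried from `F` to polynomial rings and tested on single vectors.
HasNoIsotropicVector : {R : CommutativeRing c ℓ} → ∀ {n} → Form R n → Set (c ⊔ ℓ)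
HasNoIsotropicVector {R = R} φ = ∀ v → value φ v ≈ 0# → ∀ i → v i ≈ 0#
  where open CommutativeRing R

anisotropic⇒noIsotropicVector : {R : CommutativeRing c ℓ} → ∀ {n} (φ : Form R n) →
                                Anisotropic φ → HasNoIsotropicVector φ
anisotropic⇒noIsotropicVector φ (_ , _ , _ , spans) v e = proj₂ (spans v e)

IsHomomorphism : (R : CommutativeRing c₁ ℓ₁) (S : CommutativeRing c₂ ℓ₂) →
                 (CommutativeRing.Carrier R → CommutativeRing.Carrier S) → Set (c₁ ⊔ ℓ₁ ⊔ ℓ₂)
IsHomomorphism R S = IsRingHomomorphism (CommutativeRing.rawRing R) (CommutativeRing.rawRing S)

module _ (R : CommutativeRing c₁ ℓ₁) (S : CommutativeRing c₂ ℓ₂) where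
  private
    module R = CommutativeRing R
    module S = CommutativeRing S
  open RingProperties S.ring

  isHomomorphism : (f : R.Carrier → S.Carrier) →
                   (∀ {x y} → x R.≈ y → f x S.≈ f y) →
                   (∀ x y → f (x R.+ y) S.≈ f x S.+ f y) →
                   (∀ x y → f (x R.* y) S.≈ f x S.* f y) →
                   f R.1# S.≈ S.1# →
                   IsHomomorphism R S f
  isHomomorphism f f-cong f-+ f-* f-1 = record
    { isSemiringHomomorphism = record
      { isNearSemiringHomomorphism = record
        { +-isMonoidHomomorphism = record
          { isMagmaHomomorphism = record
            { isRelHomomorphism = record { cong = f-cong } ; homo = f-+ }
          ; ε-homo = f-0 }
        ; *-homo = f-* }
      ; 1#-homo = f-1 }
    ; -‿homo = λ x → +-inverseˡ-unique (f (R.- x)) (f x)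
        (S.trans (S.sym (f-+ (R.- x) x)) (S.trans (f-cong (R.-‿inverseˡ x)) f-0)) }
    where
    f-0 : f R.0# S.≈ S.0#
    f-0 = x+x≈x⇒x≈0 (f R.0#)
      (S.trans (S.sym (f-+ R.0# R.0#)) (f-cong (R.+-identityˡ R.0#)))

  module Homomorphism {f : R.Carrier → S.Carrier} (f-homo : IsHomomorphism R S f) where
    open IsRingHomomorphism f-homo
    open LinearAlgebra R using () renaming (sum to sumᴿ)
    open LinearAlgebra S using () renaming (sum to sumˢ)

    sum-homo : ∀ {n} (v : Vector R.Carrier n) → f (sumᴿ v) S.≈ sumˢ (f ∘ v)
    sum-homo {zero}  v = 0#-homo
    sum-homo {suc n} v = S.trans (+-homo _ _) (S.+-congˡ (sum-homo (tail v)))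

    value-homo : ∀ {n} (φ : Form R n) v →
                 f (value φ v) S.≈ value {K = S} ⟨ f ∘ coeff φ ⟩ (f ∘ v)
    value-homo φ v = begin
      f (sumᴿ (λ i → coeff φ i R.* (v i R.* v i)))           ≈⟨ sum-homo (λ i → coeff φ i R.* (v i R.* v i)) ⟩
      sumˢ (λ i → f (coeff φ i R.* (v i R.* v i)))
        ≈⟨ CommutativeMonoidSum.sum-cong-≋ S.+-commutativeMonoid
             (λ i → S.trans (*-homo (coeff φ i) (v i R.* v i)) (S.*-congˡ (*-homo (v i) (v i)))) ⟩
      sumˢ (λ i → f (coeff φ i) S.* (f (v i) S.* f (v i)))   ∎
      where open SetoidReasoning S.setoid

    characteristic2-homo : HasCharacteristic2 R → HasCharacteristic2 S
    characteristic2-homo 1+1≈0 = S.trans (S.sym (S.trans (+-homo _ _) (S.+-cong 1#-homo 1#-homo)))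
      (S.trans (⟦⟧-cong 1+1≈0) 0#-homo)

module _ (G : AbelianGroup c ℓ) where
  open AbelianGroup G renaming (_∙_ to _+_)

  commutativeRing : (_*_ : Carrier → Carrier → Carrier) (1# : Carrier) →
    (∀ {x x′ y y′} → x ≈ x′ → y ≈ y′ → (x * y) ≈ (x′ * y′)) →
    (∀ x y z → ((x * y) * z) ≈ (x * (y * z))) →
    (∀ x y → (x * y) ≈ (y * x)) →
    (∀ x → (1# * x) ≈ x) →
    (∀ x y z → (x * (y + z)) ≈ ((x * y) + (x * z))) →
    CommutativeRing c ℓ
  commutativeRing _*_ 1# *-cong *-assoc *-comm *-identityˡ distribˡ = record
    { Carrier = Carrier ; _≈_ = _≈_ ; _+_ = _+_ ; _*_ = _*_ ; -_ = _⁻¹ ; 0# = ε ; 1# = 1#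
    ; isCommutativeRing = record
      { isRing = record
        { +-isAbelianGroup = isAbelianGroup
        ; *-cong = *-cong
        ; *-assoc = *-assoc
        ; *-identity = *-identityˡ , λ x → trans (*-comm x 1#) (*-identityˡ x)
        ; distrib = distribˡ , λ x y z →
            trans (*-comm _ x) (trans (distribˡ x y z) (∙-cong (*-comm x y) (*-comm x z)))
        }
      ; *-comm = *-comm
      }
    }

-- Values of diagonal forms, and their additivity in characteristic 2

module CommutativeRingProperties (R : CommutativeRing c ℓ) where
  open CommutativeRing R hiding (zero)
  open LinearAlgebra R
  open SemiringSum semiring public using (*-distribˡ-sum; *-distribʳ-sum)
  open CommutativeMonoidSum +-commutativeMonoid public
    using (sum-cong-≋; ∑-distrib-+; ∑-comm; sum-replicate-zero)
  open SemiringSolver commutativeSemiring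
  open SetoidReasoning setoid

  value-cong : ∀ {n} (φ : Form R n) {v w} → v ≈ᵛ w → value φ v ≈ value φ w
  value-cong φ v≈w = sum-cong-≋ (λ i → *-congˡ (*-cong (v≈w i) (v≈w i)))

  value-* : ∀ {n} (φ : Form R n) x v → value φ (λ i → x * v i) ≈ (x * x) * value φ v
  value-* φ x v = trans
    (sum-cong-≋ (λ i → solve 3 (λ a x v → a :* ((x :* v) :* (x :* v)) := (x :* x) :* (a :* (v :* v)))
                         refl (coeff φ i) x (v i)))
    (sym (*-distribˡ-sum (x * x) (λ i → coeff φ i * (v i * v i))))

  value-0 : ∀ {n} (φ : Form R n) → value φ (λ _ → 0#) ≈ 0#
  value-0 {n} φ = trans (sum-cong-≋ (λ i → trans (*-congˡ (zeroˡ 0#)) (zeroʳ (coeff φ i))))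
                        (sum-replicate-zero n)

  unitVector : ∀ {n} → Fin n → Vector Carrier n
  unitVector zero    zero    = 1#
  unitVector zero    (suc _) = 0#
  unitVector (suc i) zero    = 0#
  unitVector (suc i) (suc j) = unitVector i j

  value-unitVector : ∀ {n} (φ : Form R n) i → value φ (unitVector i) ≈ coeff φ i
  value-unitVector φ zero = begin
    coeff φ zero * (1# * 1#) + value {K = R} ⟨ tail (coeff φ) ⟩ (λ _ → 0#)
      ≈⟨ +-congˡ (value-0 ⟨ tail (coeff φ) ⟩) ⟩
    coeff φ zero * (1# * 1#) + 0#   ≈⟨ +-identityʳ _ ⟩
    coeff φ zero * (1# * 1#)        ≈⟨ *-congˡ (*-identityˡ 1#) ⟩
    coeff φ zero * 1#               ≈⟨ *-identityʳ _ ⟩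
    coeff φ zero                    ∎
  value-unitVector φ (suc i) = begin
    coeff φ zero * (0# * 0#) + value {K = R} ⟨ tail (coeff φ) ⟩ (unitVector i)
      ≈⟨ +-cong (trans (*-congˡ (zeroˡ 0#)) (zeroʳ _)) (value-unitVector ⟨ tail (coeff φ) ⟩ i) ⟩
    0# + coeff φ (suc i)            ≈⟨ +-identityˡ _ ⟩
    coeff φ (suc i)                 ∎

  represents-coeff : ∀ {n} (φ : Form R n) i → Represents φ (coeff φ i)
  represents-coeff φ i = unitVector i , value-unitVector φ i

  represents-≈ : ∀ {n} (φ : Form R n) {x y} → x ≈ y → Represents φ x → Represents φ y
  represents-≈ φ x≈y (v , e) = v , trans e x≈y

  represents-* : ∀ {n} (φ : Form R n) {x} y → Represents φ x → Represents φ ((y * y) * x)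
  represents-* φ y (v , e) = (λ i → y * v i) , trans (value-* φ y v) (*-congˡ e)

module Characteristic2 (R : CommutativeRing c ℓ) (1+1≈0 : HasCharacteristic2 R) where
  open CommutativeRing R hiding (zero)
  open LinearAlgebra R
  open CommutativeRingProperties R
  open SemiringSolver commutativeSemiring
  open SetoidReasoning setoid

  x+x≈0 : ∀ x → x + x ≈ 0#
  x+x≈0 x = begin
    x + x              ≈⟨ +-cong (*-identityˡ x) (*-identityˡ x) ⟨
    1# * x + 1# * x    ≈⟨ distribʳ x 1# 1# ⟨
    (1# + 1#) * x      ≈⟨ *-congʳ 1+1≈0 ⟩
    0# * x             ≈⟨ zeroˡ x ⟩
    0#                 ∎

  x+[y+y]≈x : ∀ x y → x + (y + y) ≈ x
  x+[y+y]≈x x y = trans (+-congˡ (x+x≈0 y)) (+-identityʳ x)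

  x+y≈0⇒x≈y : ∀ {x y} → x + y ≈ 0# → x ≈ y
  x+y≈0⇒x≈y {x} {y} e = begin
    x             ≈⟨ x+[y+y]≈x x y ⟨
    x + (y + y)   ≈⟨ +-assoc x y y ⟨
    (x + y) + y   ≈⟨ +-congʳ e ⟩
    0# + y        ≈⟨ +-identityˡ y ⟩
    y             ∎

  x≈y⇒x+y≈0 : ∀ {x y} → x ≈ y → x + y ≈ 0#
  x≈y⇒x+y≈0 {x} {y} e = trans (+-congʳ e) (x+x≈0 y)

  x≈y+z⇒z≈y+x : ∀ {x y z} → x ≈ y + z → z ≈ y + x
  x≈y+z⇒z≈y+x {x} {y} {z} e = x+y≈0⇒x≈y (begin
    z + (y + x)   ≈⟨ solve 3 (λ x y z → z :+ (y :+ x) := x :+ (y :+ z)) refl x y z ⟩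
    x + (y + z)   ≈⟨ x≈y⇒x+y≈0 e ⟩
    0#            ∎)

  -- Expanding the squares produces each cross term `a (v w)` twice.
  value-+ : ∀ {n} (φ : Form R n) v w → value φ (λ i → v i + w i) ≈ value φ v + value φ w
  value-+ φ v w = trans
    (sum-cong-≋ (λ i → trans
      (solve 3 (λ a v w → a :* ((v :+ w) :* (v :+ w)) :=
                          (a :* (v :* v) :+ a :* (w :* w)) :+ (a :* (v :* w) :+ a :* (v :* w)))
               refl (coeff φ i) (v i) (w i))
      (x+[y+y]≈x _ _)))
    (∑-distrib-+ (λ i → coeff φ i * (v i * v i)) (λ i → coeff φ i * (w i * w i)))

  -- `value φ` is semilinear with respect to squaring. This is how relations between vectors become
  -- relations between values, with squared coefficients.
  value-linearCombination : ∀ {n d} (φ : Form R n) (f : Vector Carrier d) b →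
    value φ (linearCombination f b) ≈ sum (λ j → (f j * f j) * value φ (b j))
  value-linearCombination {d = zero}  φ f b = value-0 φ
  value-linearCombination {d = suc d} φ f b = begin
    value φ (λ i → head f * head b i + linearCombination (tail f) (tail b) i)
      ≈⟨ value-+ φ (λ i → head f * head b i) (linearCombination (tail f) (tail b)) ⟩
    value φ (λ i → head f * head b i) + value φ (linearCombination (tail f) (tail b))
      ≈⟨ +-cong (value-* φ (head f) (head b)) (value-linearCombination φ (tail f) (tail b)) ⟩
    (head f * head f) * value φ (head b) + sum (λ j → (tail f j * tail f j) * value φ (tail b j)) ∎

  represents-+ : ∀ {n} (φ : Form R n) {x y} → Represents φ x → Represents φ y → Represents φ (x + y)
  represents-+ φ (v , e) (w , e′) = (λ i → v i + w i) , trans (value-+ φ v w) (+-cong e e′)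

  represents-sum : ∀ {n} (φ : Form R n) {d} (x : Vector Carrier d) →
                   (∀ j → Represents φ (x j)) → Represents φ (sum x)
  represents-sum φ {zero}  x r = (λ _ → 0#) , value-0 φ
  represents-sum φ {suc d} x r =
    represents-+ φ (r zero) (represents-sum φ (tail x) (λ j → r (suc j)))

  -- A value of `φ` is a sum of squares times coefficients, and the values of `ψ` are closed under
  -- sums and under multiplication by squares; so the coefficients decide.
  represents-value : ∀ {m n} (φ : Form R m) (ψ : Form R n) (c : Carrier) →
                     (∀ i → Represents ψ (coeff φ i * c)) → ∀ v → Represents ψ (value φ v * c)
  represents-value φ ψ c r v = represents-≈ ψ
    (trans (sum-cong-≋ (λ i → solve 3 (λ a v c → (v :* v) :* (a :* c) := a :* (v :* v) :* c)
                                refl (coeff φ i) (v i) c))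
           (sym (*-distribʳ-sum c (λ i → coeff φ i * (v i * v i)))))
    (represents-sum ψ (λ i → (v i * v i) * (coeff φ i * c)) (λ i → represents-* ψ (v i) (r i)))

-- Free quadratic extensions

record IsQuadraticExtension (R : CommutativeRing c₁ ℓ₁) (q : CommutativeRing.Carrier R)
                            (B : CommutativeRing c₂ ℓ₂) : Set (c₁ ⊔ ℓ₁ ⊔ c₂ ⊔ ℓ₂) where
  private
    module R = CommutativeRing R
    module B = CommutativeRing B
  field
    embed         : R.Carrier → B.Carrier
    embed-homo    : IsHomomorphism R B embed
    √q            : B.Carrier
    √q-square     : √q B.* √q B.≈ embed q
    re im         : B.Carrier → R.Carrier
    re-cong       : ∀ {y z} → y B.≈ z → re y R.≈ re z
    im-cong       : ∀ {y z} → y B.≈ z → im y R.≈ im z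
    -- Together with the two laws that follow: `1` and `√q` form a basis of `B` over `R`, with
    -- coordinates `re` and `im`.
    decomposition : ∀ y → y B.≈ embed (re y) B.+ √q B.* embed (im y)
    re-join       : ∀ a b → re (embed a B.+ √q B.* embed b) R.≈ a
    im-join       : ∀ a b → im (embed a B.+ √q B.* embed b) R.≈ b

  private
    module embed = IsRingHomomorphism embed-homo
    open SemiringSolver B.commutativeSemiring
    open SetoidReasoning B.setoid

  embed≈join : ∀ a → embed a B.≈ embed a B.+ √q B.* embed R.0#
  embed≈join a = B.sym (B.trans (B.+-congˡ (B.trans (B.*-congˡ embed.0#-homo) (B.zeroʳ √q))) (B.+-identityʳ _))

  re-embed : ∀ a → re (embed a) R.≈ a
  re-embed a = R.trans (re-cong (embed≈join a)) (re-join a R.0#)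

  embed-≈0 : ∀ {a} → embed a B.≈ B.0# → a R.≈ R.0#
  embed-≈0 {a} e = R.trans (R.sym (re-embed a))
    (R.trans (re-cong (B.trans e (B.sym embed.0#-homo))) (re-embed R.0#))

  ≈0 : ∀ y → re y R.≈ R.0# → im y R.≈ R.0# → y B.≈ B.0#
  ≈0 y e e′ = B.trans (decomposition y)
    (B.trans (B.+-cong (B.trans (embed.⟦⟧-cong e) embed.0#-homo)
                       (B.trans (B.*-congˡ (B.trans (embed.⟦⟧-cong e′) embed.0#-homo)) (B.zeroʳ √q)))
             (B.+-identityˡ B.0#))

  join-≈0 : ∀ a b → embed a B.+ √q B.* embed b B.≈ B.0# → a R.≈ R.0# × b R.≈ R.0#
  join-≈0 a b e =
    R.trans (R.sym (re-join a b)) (R.trans (re-cong e≈) (re-join R.0# R.0#)) ,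
    R.trans (R.sym (im-join a b)) (R.trans (im-cong e≈) (im-join R.0# R.0#))
    where
    e≈ : embed a B.+ √q B.* embed b B.≈ embed R.0# B.+ √q B.* embed R.0#
    e≈ = B.trans e (B.trans (B.sym embed.0#-homo) (embed≈join R.0#))

  im-+ : ∀ y z → im (y B.+ z) R.≈ im y R.+ im z
  im-+ y z = R.trans (im-cong (begin
    y B.+ z
      ≈⟨ B.+-cong (decomposition y) (decomposition z) ⟩
    (embed (re y) B.+ √q B.* embed (im y)) B.+ (embed (re z) B.+ √q B.* embed (im z))
      ≈⟨ solve 5 (λ t a b a′ b′ → (a :+ t :* b) :+ (a′ :+ t :* b′) := (a :+ a′) :+ t :* (b :+ b′)) B.refl
           √q (embed (re y)) (embed (im y)) (embed (re z)) (embed (im z)) ⟩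
    (embed (re y) B.+ embed (re z)) B.+ √q B.* (embed (im y) B.+ embed (im z))
      ≈⟨ B.+-cong (embed.+-homo _ _) (B.*-congˡ (embed.+-homo _ _)) ⟨
    embed (re y R.+ re z) B.+ √q B.* embed (im y R.+ im z) ∎)) (im-join _ _)

  *-join : ∀ y z → y B.* z B.≈
    embed (re y R.* re z R.+ q R.* (im y R.* im z)) B.+ √q B.* embed (re y R.* im z R.+ im y R.* re z)
  *-join y z = begin
    y B.* z
      ≈⟨ B.*-cong (decomposition y) (decomposition z) ⟩
    (embed (re y) B.+ √q B.* embed (im y)) B.* (embed (re z) B.+ √q B.* embed (im z))
      ≈⟨ solve 5 (λ t a b a′ b′ → (a :+ t :* b) :* (a′ :+ t :* b′) :=
                                  (a :* a′ :+ (t :* t) :* (b :* b′)) :+ t :* (a :* b′ :+ b :* a′)) B.refl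
           √q (embed (re y)) (embed (im y)) (embed (re z)) (embed (im z)) ⟩
    (embed (re y) B.* embed (re z) B.+ (√q B.* √q) B.* (embed (im y) B.* embed (im z))) B.+
      √q B.* (embed (re y) B.* embed (im z) B.+ embed (im y) B.* embed (re z))
      ≈⟨ B.+-cong
           (B.+-cong (B.sym (embed.*-homo _ _)) (B.trans (B.*-cong √q-square (B.sym (embed.*-homo _ _)))
                                                         (B.sym (embed.*-homo _ _))))
           (B.*-congˡ (B.+-cong (B.sym (embed.*-homo _ _)) (B.sym (embed.*-homo _ _)))) ⟩
    (embed (re y R.* re z) B.+ embed (q R.* (im y R.* im z))) B.+
      √q B.* (embed (re y R.* im z) B.+ embed (im y R.* re z))
      ≈⟨ B.+-cong (embed.+-homo _ _) (B.*-congˡ (embed.+-homo _ _)) ⟨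
    embed (re y R.* re z R.+ q R.* (im y R.* im z)) B.+ √q B.* embed (re y R.* im z R.+ im y R.* re z) ∎

  im-* : ∀ y z → im (y B.* z) R.≈ re y R.* im z R.+ im y R.* re z
  im-* y z = R.trans (im-cong (*-join y z)) (im-join _ _)

-- The pair (a , b) stands for a + b √q.
module QuadraticExtension (R : CommutativeRing c ℓ) (q : CommutativeRing.Carrier R) where
  open CommutativeRing R hiding (zero)
  open SemiringSolver commutativeSemiring

  quadraticExtension : CommutativeRing c ℓ
  quadraticExtension = commutativeRing (DirectProduct.abelianGroup +-abelianGroup +-abelianGroup)
    (λ (a , b) (a′ , b′) → a * a′ + q * (b * b′) , a * b′ + b * a′)
    (1# , 0#)
    (λ (e₁ , e₂) (e₁′ , e₂′) →
      +-cong (*-cong e₁ e₁′) (*-congˡ (*-cong e₂ e₂′)) , +-cong (*-cong e₁ e₂′) (*-cong e₂ e₁′))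
    (λ (a , b) (a′ , b′) (a″ , b″) →
      solve 7 (λ q a b a′ b′ a″ b″ →
        (a :* a′ :+ q :* (b :* b′)) :* a″ :+ q :* ((a :* b′ :+ b :* a′) :* b″) :=
        a :* (a′ :* a″ :+ q :* (b′ :* b″)) :+ q :* (b :* (a′ :* b″ :+ b′ :* a″)))
        refl q a b a′ b′ a″ b″ ,
      solve 7 (λ q a b a′ b′ a″ b″ →
        (a :* a′ :+ q :* (b :* b′)) :* b″ :+ (a :* b′ :+ b :* a′) :* a″ :=
        a :* (a′ :* b″ :+ b′ :* a″) :+ b :* (a′ :* a″ :+ q :* (b′ :* b″)))
        refl q a b a′ b′ a″ b″)
    (λ (a , b) (a′ , b′) →
      +-cong (*-comm a a′) (*-congˡ (*-comm b b′)) ,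
      trans (+-comm _ _) (+-cong (*-comm b a′) (*-comm a b′)))
    (λ (a , b) →
      trans (+-cong (*-identityˡ a) (trans (*-congˡ (zeroˡ b)) (zeroʳ q))) (+-identityʳ a) ,
      trans (+-cong (*-identityˡ b) (zeroˡ a)) (+-identityʳ b))
    (λ (a , b) (a′ , b′) (a″ , b″) →
      solve 7 (λ q a b a′ b′ a″ b″ →
        a :* (a′ :+ a″) :+ q :* (b :* (b′ :+ b″)) :=
        (a :* a′ :+ q :* (b :* b′)) :+ (a :* a″ :+ q :* (b :* b″)))
        refl q a b a′ b′ a″ b″ ,
      solve 6 (λ a b a′ b′ a″ b″ →
        a :* (b′ :+ b″) :+ b :* (a′ :+ a″) := (a :* b′ :+ b :* a′) :+ (a :* b″ :+ b :* a″))
        refl a b a′ b′ a″ b″)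

  embed : Carrier → Carrier × Carrier
  embed a = a , 0#

  √q : Carrier × Carrier
  √q = 0# , 1#

  embed-homo : IsHomomorphism R quadraticExtension embed
  embed-homo = isHomomorphism R quadraticExtension embed
    (λ e → e , refl)
    (λ a b → refl , sym (+-identityʳ 0#))
    (λ a b → solve 3 (λ a b q → a :* b := a :* b :+ q :* (con 0 :* con 0)) refl a b q ,
             solve 2 (λ a b → con 0 := a :* con 0 :+ con 0 :* b) refl a b)
    (refl , refl)

  private
    module B = CommutativeRing quadraticExtension

    join≈ : ∀ a b → (a , b) B.≈ embed a B.+ √q B.* embed b
    join≈ a b =
      solve 4 (λ o q a b → a := a :+ (con 0 :* b :+ q :* (o :* con 0))) refl 1# q a b ,
      trans (sym (*-identityˡ b)) (solve 2 (λ o b → o :* b := con 0 :+ (con 0 :* con 0 :+ o :* b)) refl 1# b)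

  isQuadraticExtension : IsQuadraticExtension R q quadraticExtension
  isQuadraticExtension = record
    { embed = embed ; embed-homo = embed-homo
    ; √q = √q
    ; √q-square = trans (+-cong (zeroˡ 0#) (trans (*-congˡ (*-identityˡ 1#)) (*-identityʳ q))) (+-identityˡ q) ,
                  trans (+-cong (zeroˡ 1#) (zeroʳ 1#)) (+-identityˡ 0#)
    ; re = proj₁ ; im = proj₂ ; re-cong = proj₁ ; im-cong = proj₂
    ; decomposition = λ (a , b) → join≈ a b
    ; re-join = λ a b → sym (proj₁ (join≈ a b))
    ; im-join = λ a b → sym (proj₂ (join≈ a b))
    }

-- Polynomial rings: evaluation, degree in one variable, integrality and anisotropy

module Evaluation (F : CommutativeRing c₁ ℓ₁) {m : ℕ} (S : CommutativeRing c₂ ℓ₂)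
  {f : CommutativeRing.Carrier F → CommutativeRing.Carrier S} (f-homo : IsHomomorphism F S f)
  (x : Vector (CommutativeRing.Carrier S) m) where

  open CommutativeRing S hiding (zero)
  open IsRingHomomorphism f-homo
  open Polynomials F m using (Polynomial; polynomialRing; const; var)
  private module P = Polynomials F m

  eval : Polynomial → Carrier
  eval (const a) = f a
  eval (var i)   = x i
  eval (p P.+ p′) = eval p + eval p′
  eval (p P.* p′) = eval p * eval p′
  eval (P.- p)    = - eval p

  eval-cong : ∀ {p p′} → p P.≈ p′ → eval p ≈ eval p′
  eval-cong P.refl                = refl
  eval-cong (P.sym e)             = sym (eval-cong e)
  eval-cong (P.trans e e′)        = trans (eval-cong e) (eval-cong e′)
  eval-cong (P.+-cong e e′)       = +-cong (eval-cong e) (eval-cong e′)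
  eval-cong (P.*-cong e e′)       = *-cong (eval-cong e) (eval-cong e′)
  eval-cong (P.neg-cong e)        = -‿cong (eval-cong e)
  eval-cong (P.+-assoc _ _ _)     = +-assoc _ _ _
  eval-cong (P.+-comm _ _)        = +-comm _ _
  eval-cong (P.+-identityˡ _)     = trans (+-congʳ 0#-homo) (+-identityˡ _)
  eval-cong (P.+-inverseˡ _)      = trans (-‿inverseˡ _) (sym 0#-homo)
  eval-cong (P.*-assoc _ _ _)     = *-assoc _ _ _
  eval-cong (P.*-comm _ _)        = *-comm _ _
  eval-cong (P.*-identityˡ _)     = trans (*-congʳ 1#-homo) (*-identityˡ _)
  eval-cong (P.distribˡ _ _ _)    = distribˡ _ _ _
  eval-cong (P.const-cong e)      = ⟦⟧-cong e
  eval-cong (P.const-+ _ _)       = +-homo _ _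
  eval-cong (P.const-* _ _)       = *-homo _ _

  eval-homo : IsHomomorphism polynomialRing S eval
  eval-homo = isHomomorphism polynomialRing S eval eval-cong (λ _ _ → refl) (λ _ _ → refl) 1#-homo

module _ (F : CommutativeRing c₁ ℓ₁) {m : ℕ} (S : CommutativeRing c₂ ℓ₂) where
  open CommutativeRing S hiding (zero)
  open Polynomials F m using (Polynomial; polynomialRing; const; var)
  private module P = Polynomials F m

  homomorphism-unique : ∀ {f g} → IsHomomorphism polynomialRing S f → IsHomomorphism polynomialRing S g →
    (∀ a → f (const a) ≈ g (const a)) → (∀ i → f (var i) ≈ g (var i)) → ∀ p → f p ≈ g p
  homomorphism-unique {f} {g} f-homo g-homo on-const on-var = go
    where
    module f = IsRingHomomorphism f-homo
    module g = IsRingHomomorphism g-homo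
    go : ∀ p → f p ≈ g p
    go (const a)  = on-const a
    go (var i)    = on-var i
    go (p P.+ p′) = trans (f.+-homo p p′) (trans (+-cong (go p) (go p′)) (sym (g.+-homo p p′)))
    go (p P.* p′) = trans (f.*-homo p p′) (trans (*-cong (go p) (go p′)) (sym (g.*-homo p p′)))
    go (P.- p)    = trans (f.-‿homo p) (trans (-‿cong (go p)) (sym (g.-‿homo p)))

module _ (F : CommutativeRing c ℓ) (m : ℕ) where
  private module P = CommutativeRing (Polynomials.polynomialRing F m)
  open Polynomials F m

  const-homo : IsHomomorphism F polynomialRing const
  const-homo = isHomomorphism F polynomialRing const const-cong const-+ const-* P.refl

-- P behaves like the polynomial ring R[x₀], with p = p(0) + x₀ Δp for every p in P.
record IsVariableAdjunction (R : CommutativeRing c₁ ℓ₁) (P : CommutativeRing c₂ ℓ₂) :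
       Set (c₁ ⊔ ℓ₁ ⊔ c₂ ⊔ ℓ₂) where
  private
    module R = CommutativeRing R
    module P = CommutativeRing P
  field
    weaken        : R.Carrier → P.Carrier
    weaken-homo   : IsHomomorphism R P weaken
    atZero        : P.Carrier → R.Carrier
    atZero-homo   : IsHomomorphism P R atZero
    atZero-weaken : ∀ a → atZero (weaken a) R.≈ a
    x₀            : P.Carrier
    atZero-x₀     : atZero x₀ R.≈ R.0#
    Δ             : P.Carrier → P.Carrier
    Δ-cong        : ∀ {p p′} → p P.≈ p′ → Δ p P.≈ Δ p′
    Δ-+           : ∀ p p′ → Δ (p P.+ p′) P.≈ Δ p P.+ Δ p′
    -- Comes from `p p′ = p(0) p′ + x₀ (Δ p) p′`, in which the constant `p(0)` passes through `Δ`.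
    Δ-*           : ∀ p p′ → Δ (p P.* p′) P.≈ weaken (atZero p) P.* Δ p′ P.+ p′ P.* Δ p
    Δ-x₀          : Δ x₀ P.≈ P.1#
    decompose     : ∀ p → p P.≈ weaken (atZero p) P.+ x₀ P.* Δ p

  private
    module weaken = IsRingHomomorphism weaken-homo
    module atZero = IsRingHomomorphism atZero-homo
  open RingProperties P.ring
  open SetoidReasoning P.setoid

  -- `Δ` undoes multiplication by `x₀`: the product rule gives `Δ (x₀ p) = p`, because `x₀` has
  -- constant term zero and `Δ x₀ = 1`.
  x₀-regular : ∀ p → x₀ P.* p P.≈ P.0# → p P.≈ P.0#
  x₀-regular p e = begin
    p                                          ≈⟨ P.*-identityʳ p ⟨
    p P.* P.1#                                 ≈⟨ P.*-congˡ Δ-x₀ ⟨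
    p P.* Δ x₀                                 ≈⟨ P.+-identityˡ _ ⟨
    P.0# P.+ p P.* Δ x₀                        ≈⟨ P.+-congʳ (P.zeroˡ (Δ p)) ⟨
    P.0# P.* Δ p P.+ p P.* Δ x₀
      ≈⟨ P.+-congʳ (P.*-congʳ (P.trans (weaken.⟦⟧-cong atZero-x₀) weaken.0#-homo)) ⟨
    weaken (atZero x₀) P.* Δ p P.+ p P.* Δ x₀  ≈⟨ Δ-* x₀ p ⟨
    Δ (x₀ P.* p)                               ≈⟨ Δ-cong e ⟩
    Δ P.0#                                     ≈⟨ x+x≈x⇒x≈0 (Δ P.0#)
                                                    (P.trans (P.sym (Δ-+ P.0# P.0#)) (Δ-cong (P.+-identityˡ P.0#))) ⟩
    P.0#                                       ∎

  Δ-weaken : ∀ a → Δ (weaken a) P.≈ P.0#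
  Δ-weaken a = x₀-regular (Δ (weaken a)) (+-identityʳ-unique (weaken a) (x₀ P.* Δ (weaken a)) (begin
    weaken a P.+ x₀ P.* Δ (weaken a)                   ≈⟨ P.+-congʳ (weaken.⟦⟧-cong (atZero-weaken a)) ⟨
    weaken (atZero (weaken a)) P.+ x₀ P.* Δ (weaken a) ≈⟨ decompose (weaken a) ⟨
    weaken a                                           ∎))

  Δ-weaken-* : ∀ a p → Δ (weaken a P.* p) P.≈ weaken a P.* Δ p
  Δ-weaken-* a p = begin
    Δ (weaken a P.* p)                                        ≈⟨ Δ-* (weaken a) p ⟩
    weaken (atZero (weaken a)) P.* Δ p P.+ p P.* Δ (weaken a)
      ≈⟨ P.+-cong (P.*-congʳ (weaken.⟦⟧-cong (atZero-weaken a)))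
                  (P.trans (P.*-congˡ (Δ-weaken a)) (P.zeroʳ p)) ⟩
    weaken a P.* Δ p P.+ P.0#                                 ≈⟨ P.+-identityʳ _ ⟩
    weaken a P.* Δ p                                          ∎

  -- A bound takes the place of the degree, which would require deciding which coefficients vanish.
  -- `Δ` lowers it by one, and at zero the element itself vanishes.
  Degree< : ℕ → P.Carrier → Set ℓ₂
  Degree< zero    p = p P.≈ P.0#
  Degree< (suc d) p = Degree< d (Δ p)

  degree<-cong : ∀ d {p p′} → p P.≈ p′ → Degree< d p → Degree< d p′
  degree<-cong zero    e = P.trans (P.sym e)
  degree<-cong (suc d) e = degree<-cong d (Δ-cong e)

  degree<-weaken-* : ∀ d a {p} → Degree< d p → Degree< d (weaken a P.* p)
  degree<-weaken-* zero    a e = P.trans (P.*-congˡ e) (P.zeroʳ (weaken a))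
  degree<-weaken-* (suc d) a {p} b =
    degree<-cong d (P.sym (Δ-weaken-* a p)) (degree<-weaken-* d a b)

  degree<-0 : ∀ d → Degree< d P.0#
  degree<-0 d = degree<-cong d (P.trans (P.*-congʳ weaken.0#-homo) (P.zeroˡ P.0#)) (zero-times d)
    where
    zero-times : ∀ d → Degree< d (weaken R.0# P.* P.0#)
    zero-times zero    = P.zeroʳ _
    zero-times (suc d) = degree<-cong d
      (P.trans (P.trans (P.*-congʳ weaken.0#-homo) (P.zeroˡ P.0#))
        (P.sym (P.trans (Δ-weaken-* R.0# P.0#) (P.trans (P.*-congʳ weaken.0#-homo) (P.zeroˡ _)))))
      (zero-times d)

  degree<-+ : ∀ d {p p′} → Degree< d p → Degree< d p′ → Degree< d (p P.+ p′)
  degree<-+ zero    e e′ = P.trans (P.+-cong e e′) (P.+-identityʳ P.0#)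
  degree<-+ (suc d) {p} {p′} b b′ = degree<-cong d (P.sym (Δ-+ p p′)) (degree<-+ d b b′)

  degree<-neg : ∀ d {p} → Degree< d p → Degree< d (P.- p)
  degree<-neg d {p} b = degree<-cong d
    (P.trans (P.*-congʳ (P.trans (weaken.-‿homo R.1#) (P.-‿cong weaken.1#-homo))) (-1*x≈-x p))
    (degree<-weaken-* d (R.- R.1#) b)

  degree<-suc : ∀ d {p} → Degree< d p → Degree< (suc d) p
  degree<-suc zero    e = P.trans (Δ-cong (P.trans e (P.sym weaken.0#-homo))) (Δ-weaken R.0#)
  degree<-suc (suc d) b = degree<-suc d b

  degree<-≤ : ∀ e {d p} → Degree< d p → Degree< (e ℕ.+ d) p
  degree<-≤ zero        b = b
  degree<-≤ (suc e) {d} b = degree<-suc (e ℕ.+ d) (degree<-≤ e b)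

  degree<-* : ∀ d e {p p′} → Degree< d p → Degree< e p′ → Degree< (d ℕ.+ e) (p P.* p′)
  degree<-* zero    e {p} {p′} b b′ =
    degree<-cong e (P.sym (P.trans (P.*-congʳ b) (P.zeroˡ p′))) (degree<-0 e)
  degree<-* (suc d) e {p} {p′} b b′ = degree<-cong (d ℕ.+ e) (P.sym (Δ-* p p′))
    (degree<-+ (d ℕ.+ e)
      -- By definition of `Degree<` at a successor, `degree<-suc e b′` is a bound on `Δ p′`.
      (degree<-≤ d (degree<-weaken-* e (atZero p) (degree<-suc e b′)))
      (degree<-cong (d ℕ.+ e) (P.*-comm (Δ p) p′) (degree<-* d e b b′)))

  module _ (bounded : ∀ p → ∃ λ d → Degree< d p) where

    weaken-atZero-0 : ∀ {p} → atZero p R.≈ R.0# → p P.≈ x₀ P.* Δ p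
    weaken-atZero-0 {p} e = P.trans (decompose p)
      (P.trans (P.+-congʳ (P.trans (weaken.⟦⟧-cong e) weaken.0#-homo)) (P.+-identityˡ _))

    -- The constant term of `p p′` is the product of the constant terms, so one of these is zero and
    -- its factor is divisible by `x₀`. Cancelling `x₀` replaces that factor by its `Δ` and lowers
    -- its bound.
    isIntegral : IsIntegral R → IsIntegral P
    isIntegral R-integral p p′ = go d d′ p p′ b b′
      where
      d = proj₁ (bounded p)
      b = proj₂ (bounded p)
      d′ = proj₁ (bounded p′)
      b′ = proj₂ (bounded p′)
      go : ∀ d d′ p p′ → Degree< d p → Degree< d′ p′ → p P.* p′ P.≈ P.0# → p P.≈ P.0# ⊎ p′ P.≈ P.0#
      go zero    d′       p p′ b b′ e = inj₁ b
      go (suc d) zero     p p′ b b′ e = inj₂ b′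
      go (suc d) (suc d′) p p′ b b′ e
        with R-integral (atZero p) (atZero p′)
               (R.trans (R.sym (atZero.*-homo p p′)) (R.trans (atZero.⟦⟧-cong e) atZero.0#-homo))
      ... | inj₁ z with go d (suc d′) (Δ p) p′ b b′ (x₀-regular _ (begin
              x₀ P.* (Δ p P.* p′)   ≈⟨ P.*-assoc _ _ _ ⟨
              (x₀ P.* Δ p) P.* p′   ≈⟨ P.*-congʳ (weaken-atZero-0 z) ⟨
              p P.* p′              ≈⟨ e ⟩
              P.0#                  ∎))
      ...   | inj₁ y = inj₁ (P.trans (weaken-atZero-0 z) (P.trans (P.*-congˡ y) (P.zeroʳ x₀)))
      ...   | inj₂ y = inj₂ y
      go (suc d) (suc d′) p p′ b b′ e | inj₂ z with go (suc d) d′ p (Δ p′) b b′ (x₀-regular _ (begin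
              x₀ P.* (p P.* Δ p′)   ≈⟨ P.*-comm _ _ ⟩
              (p P.* Δ p′) P.* x₀   ≈⟨ P.*-assoc _ _ _ ⟩
              p P.* (Δ p′ P.* x₀)   ≈⟨ P.*-congˡ (P.*-comm _ _) ⟩
              p P.* (x₀ P.* Δ p′)   ≈⟨ P.*-congˡ (weaken-atZero-0 z) ⟨
              p P.* p′              ≈⟨ e ⟩
              P.0#                  ∎))
      ...   | inj₁ y = inj₁ y
      ...   | inj₂ y = inj₂ (P.trans (weaken-atZero-0 z) (P.trans (P.*-congˡ y) (P.zeroʳ x₀)))

    jointlyBounded : ∀ {n} (v : Vector P.Carrier n) → ∃ λ d → ∀ i → Degree< d (v i)
    jointlyBounded {zero}  v = 0 , λ ()
    jointlyBounded {suc n} v with bounded (head v) | jointlyBounded (tail v)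
    ... | d , b | e , b′ = e ℕ.+ d , λ
      { zero    → degree<-≤ e b
      ; (suc i) → ≡.subst (λ k → Degree< k (v (suc i))) (ℕₚ.+-comm d e) (degree<-≤ d (b′ i)) }

    -- Descent: at `x₀ = 0` an isotropic vector becomes one over `R`, hence zero, so all coordinates
    -- are divisible by `x₀`. The quotient is again isotropic, with a smaller degree bound.
    noIsotropicVector : ∀ {n} (φ : Form R n) → HasNoIsotropicVector φ →
                        HasNoIsotropicVector {R = P} ⟨ (λ i → weaken (coeff φ i)) ⟩
    noIsotropicVector {n} φ φ-aniso v with jointlyBounded v
    ... | d , b = go d v b
      where
      φ′ : Form P n
      φ′ = ⟨ (λ i → weaken (coeff φ i)) ⟩
      open CommutativeRingProperties P using (value-cong; value-*)
      open CommutativeRingProperties R using () renaming (sum-cong-≋ to sumᴿ-cong)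
      go : ∀ d v → (∀ i → Degree< d (v i)) → value φ′ v P.≈ P.0# → ∀ i → v i P.≈ P.0#
      go zero    v b e = b
      go (suc d) v b e i = P.trans (v≈xΔv i) (P.trans (P.*-congˡ (Δv≈0 i)) (P.zeroʳ x₀))
        where
        atZero-isotropic : value φ (λ i → atZero (v i)) R.≈ R.0#
        atZero-isotropic = R.trans
          (sumᴿ-cong (λ i → R.*-congʳ (R.sym (atZero-weaken (coeff φ i)))))
          (R.trans (R.sym (Homomorphism.value-homo P R atZero-homo φ′ v))
            (R.trans (atZero.⟦⟧-cong e) atZero.0#-homo))
        v≈xΔv : ∀ i → v i P.≈ x₀ P.* Δ (v i)
        v≈xΔv i = weaken-atZero-0 (φ-aniso (λ i → atZero (v i)) atZero-isotropic i)
        Δv≈0 : ∀ i → Δ (v i) P.≈ P.0#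
        Δv≈0 = go d (λ i → Δ (v i)) b (x₀-regular _ (x₀-regular _ (begin
          x₀ P.* (x₀ P.* value φ′ (λ i → Δ (v i)))   ≈⟨ P.*-assoc x₀ x₀ _ ⟨
          (x₀ P.* x₀) P.* value φ′ (λ i → Δ (v i))   ≈⟨ value-* φ′ x₀ (λ i → Δ (v i)) ⟨
          value φ′ (λ i → x₀ P.* Δ (v i))            ≈⟨ value-cong φ′ v≈xΔv ⟨
          value φ′ v                                 ≈⟨ e ⟩
          P.0#                                       ∎)))

module AdjoinVariable (F : CommutativeRing c ℓ) (m : ℕ) where
  private
    module F = CommutativeRing F
    R = Polynomials.polynomialRing F m
    P = Polynomials.polynomialRing F (suc m)
    module R = CommutativeRing R
    module P where
      open CommutativeRing P public
      open SemiringSolver commutativeSemiring public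
    module T = Polynomials F (suc m)
  open Polynomials using (const; var)

  x₀ : P.Carrier
  x₀ = var zero

  private
    module Weakening = Evaluation F P (const-homo F (suc m)) (λ (i : Fin m) → var (suc i))
    module AtZero = Evaluation F R (const-homo F m) (const F.0# ∷ var)

  weaken : R.Carrier → P.Carrier
  weaken = Weakening.eval

  weaken-homo : IsHomomorphism R P weaken
  weaken-homo = Weakening.eval-homo

  atZero : P.Carrier → R.Carrier
  atZero = AtZero.eval

  atZero-homo : IsHomomorphism P R atZero
  atZero-homo = AtZero.eval-homo

  -- This is `(p - p(0)) / x₀`, computed from the term. The product clause treats the two factors
  -- differently, so compatibility with the ring axioms needs an argument for commutativity.
  Δ : P.Carrier → P.Carrier
  Δ (const a)         = P.0#
  Δ (var zero)        = P.1#
  Δ (var (suc i))     = P.0#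
  Δ (p T.+ p′)        = Δ p P.+ Δ p′
  Δ (p T.* p′)        = weaken (atZero p) P.* Δ p′ P.+ p′ P.* Δ p
  Δ (T.- p)           = P.- Δ p

  private
    constantTerm : P.Carrier → P.Carrier
    constantTerm p = weaken (atZero p)

    constantTerm-cong : ∀ {p p′} → p P.≈ p′ → constantTerm p P.≈ constantTerm p′
    constantTerm-cong e = Weakening.eval-cong (AtZero.eval-cong e)

  decompose : ∀ p → p P.≈ constantTerm p P.+ x₀ P.* Δ p
  decompose (const a)     = P.sym (P.trans (P.+-congˡ (P.zeroʳ x₀)) (P.+-identityʳ _))
  decompose (var zero)    = P.sym (P.trans (P.+-identityˡ _) (P.*-identityʳ x₀))
  decompose (var (suc i)) = P.sym (P.trans (P.+-congˡ (P.zeroʳ x₀)) (P.+-identityʳ _))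
  decompose (p T.+ p′)    = P.trans (P.+-cong (decompose p) (decompose p′))
    (P.solve 5 (λ x a b a′ b′ → (a P.:+ x P.:* b) P.:+ (a′ P.:+ x P.:* b′) P.:=
                                (a P.:+ a′) P.:+ x P.:* (b P.:+ b′))
      P.refl x₀ (constantTerm p) (Δ p) (constantTerm p′) (Δ p′))
  decompose (p T.* p′)    = begin
    p P.* p′
      ≈⟨ P.*-congʳ (decompose p) ⟩
    (constantTerm p P.+ x₀ P.* Δ p) P.* p′
      ≈⟨ P.solve 4 (λ x a b p′ → (a P.:+ x P.:* b) P.:* p′ P.:= a P.:* p′ P.:+ x P.:* (p′ P.:* b))
           P.refl x₀ (constantTerm p) (Δ p) p′ ⟩
    constantTerm p P.* p′ P.+ x₀ P.* (p′ P.* Δ p)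
      ≈⟨ P.+-congʳ (P.*-congˡ (decompose p′)) ⟩
    constantTerm p P.* (constantTerm p′ P.+ x₀ P.* Δ p′) P.+ x₀ P.* (p′ P.* Δ p)
      ≈⟨ P.solve 5 (λ x a a′ b′ d → a P.:* (a′ P.:+ x P.:* b′) P.:+ x P.:* d P.:=
                                    a P.:* a′ P.:+ x P.:* (a P.:* b′ P.:+ d))
           P.refl x₀ (constantTerm p) (constantTerm p′) (Δ p′) (p′ P.* Δ p) ⟩
    constantTerm p P.* constantTerm p′ P.+ x₀ P.* (constantTerm p P.* Δ p′ P.+ p′ P.* Δ p) ∎
    where open SetoidReasoning P.setoid
  decompose (T.- p)       = begin
    P.- p                                        ≈⟨ P.-‿cong (decompose p) ⟩
    P.- (constantTerm p P.+ x₀ P.* Δ p)          ≈⟨ -‿+-comm _ _ ⟨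
    P.- constantTerm p P.+ P.- (x₀ P.* Δ p)      ≈⟨ P.+-congˡ (-‿distribʳ-* x₀ (Δ p)) ⟩
    P.- constantTerm p P.+ x₀ P.* (P.- Δ p)      ∎
    where
    open RingProperties P.ring
    open SetoidReasoning P.setoid

  Δ-cong : ∀ {p p′} → p P.≈ p′ → Δ p P.≈ Δ p′
  Δ-cong T.refl                  = P.refl
  Δ-cong (T.sym e)               = P.sym (Δ-cong e)
  Δ-cong (T.trans e e′)          = P.trans (Δ-cong e) (Δ-cong e′)
  Δ-cong (T.+-cong e e′)         = P.+-cong (Δ-cong e) (Δ-cong e′)
  Δ-cong (T.*-cong e e′)         = P.+-cong
    (P.*-cong (constantTerm-cong e) (Δ-cong e′)) (P.*-cong e′ (Δ-cong e))
  Δ-cong (T.neg-cong e)          = P.-‿cong (Δ-cong e)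
  Δ-cong (T.+-assoc p q r)       = P.+-assoc _ _ _
  Δ-cong (T.+-comm p q)          = P.+-comm _ _
  Δ-cong (T.+-identityˡ p)       = P.+-identityˡ _
  Δ-cong (T.+-inverseˡ p)        = P.-‿inverseˡ _
  Δ-cong (T.*-assoc p q r)       =
    P.solve 7 (λ a a′ q r d e f →
        (a P.:* a′) P.:* f P.:+ r P.:* (a P.:* e P.:+ q P.:* d) P.:=
        a P.:* (a′ P.:* f P.:+ r P.:* e) P.:+ (q P.:* r) P.:* d)
      P.refl (constantTerm p) (constantTerm q) q r (Δ p) (Δ q) (Δ r)
  -- Expanding the undecomposed factor by `decompose` turns the clause into the symmetric
  -- `p(0) Δ q + q(0) Δ p + x₀ Δ p Δ q`.
  Δ-cong (T.*-comm p q)          = begin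
    constantTerm p P.* Δ q P.+ q P.* Δ p
      ≈⟨ P.+-congˡ (P.*-congʳ (decompose q)) ⟩
    constantTerm p P.* Δ q P.+ (constantTerm q P.+ x₀ P.* Δ q) P.* Δ p
      ≈⟨ P.solve 5 (λ x a b a′ b′ → a P.:* b′ P.:+ (a′ P.:+ x P.:* b′) P.:* b P.:=
                                    a′ P.:* b P.:+ (a P.:+ x P.:* b) P.:* b′)
           P.refl x₀ (constantTerm p) (Δ p) (constantTerm q) (Δ q) ⟩
    constantTerm q P.* Δ p P.+ (constantTerm p P.+ x₀ P.* Δ p) P.* Δ q
      ≈⟨ P.+-congˡ (P.*-congʳ (decompose p)) ⟨
    constantTerm q P.* Δ p P.+ p P.* Δ q ∎
    where open SetoidReasoning P.setoid
  Δ-cong (T.*-identityˡ p)       =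
    P.trans (P.+-cong (P.*-identityˡ _) (P.zeroʳ p)) (P.+-identityʳ _)
  Δ-cong (T.distribˡ p q r)      =
    P.solve 6 (λ a q r d e f →
        a P.:* (e P.:+ f) P.:+ (q P.:+ r) P.:* d P.:=
        (a P.:* e P.:+ q P.:* d) P.:+ (a P.:* f P.:+ r P.:* d))
      P.refl (constantTerm p) q r (Δ p) (Δ q) (Δ r)
  Δ-cong (T.const-cong e)        = P.refl
  Δ-cong (T.const-+ a b)         = P.sym (P.+-identityʳ P.0#)
  Δ-cong (T.const-* a b)         =
    P.sym (P.trans (P.+-cong (P.zeroʳ _) (P.zeroʳ _)) (P.+-identityʳ P.0#))

  atZero-weaken : ∀ a → atZero (weaken a) R.≈ a
  atZero-weaken = homomorphism-unique F R
    (Composition.isRingHomomorphism R.trans weaken-homo atZero-homo)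
    (Identity.isRingHomomorphism R.rawRing R.refl) (λ _ → R.refl) (λ _ → R.refl)

  isVariableAdjunction : IsVariableAdjunction R P
  isVariableAdjunction = record
    { weaken = weaken ; weaken-homo = weaken-homo ; atZero = atZero ; atZero-homo = atZero-homo
    ; atZero-weaken = atZero-weaken ; x₀ = x₀ ; atZero-x₀ = R.refl
    ; Δ = Δ ; Δ-cong = Δ-cong ; Δ-+ = λ _ _ → P.refl ; Δ-* = λ _ _ → P.refl ; Δ-x₀ = P.refl
    ; decompose = decompose }

  private module Adjunction = IsVariableAdjunction isVariableAdjunction
  open Adjunction using (Degree<; degree<-0; degree<-+; degree<-*; degree<-neg; degree<-≤)

  bounded : ∀ p → ∃ λ d → Degree< d p
  bounded (const a)       = 1 , P.refl
  bounded (var zero)      = 2 , P.refl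
  bounded (var (suc i))   = 1 , P.refl
  bounded (p T.+ p′) with bounded p | bounded p′
  ... | d , b | e , b′ = e ℕ.+ d , degree<-+ (e ℕ.+ d) (degree<-≤ e b)
    (≡.subst (λ k → Degree< k p′) (ℕₚ.+-comm d e) (degree<-≤ d b′))
  bounded (p T.* p′) with bounded p | bounded p′
  ... | d , b | e , b′ = d ℕ.+ e , degree<-* d e b b′
  bounded (T.- p) with bounded p
  ... | d , b = d , degree<-neg d b

module _ {F : CommutativeRing c ℓ} where
  private module F = CommutativeRing F
  open Polynomials F using (polynomialRing; const)

  private
    module NoVariables where
      module P = CommutativeRing (polynomialRing 0)
      open Evaluation F {0} F (Identity.isRingHomomorphism F.rawRing F.refl) [] public

      const-eval : ∀ p → const (eval p) P.≈ p
      const-eval = homomorphism-unique F (polynomialRing 0)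
        (Composition.isRingHomomorphism P.trans eval-homo (const-homo F 0))
        (Identity.isRingHomomorphism P.rawRing P.refl) (λ _ → P.refl) (λ ())

      const-0 : ∀ {p} → eval p F.≈ F.0# → p P.≈ P.0#
      const-0 {p} e = P.trans (P.sym (const-eval p)) (Polynomials.const-cong e)

  polynomialRing-isIntegral : IsIntegral F → ∀ m → IsIntegral (polynomialRing m)
  polynomialRing-isIntegral F-integral zero p p′ e =
    Sum.map const-0 const-0 (F-integral (eval p) (eval p′) (eval-cong e))
    where open NoVariables
  polynomialRing-isIntegral F-integral (suc m) =
    IsVariableAdjunction.isIntegral isVariableAdjunction bounded (polynomialRing-isIntegral F-integral m)
    where open AdjoinVariable F m

  polynomialRing-noIsotropicVector : ∀ {n} (φ : Form F n) → HasNoIsotropicVector φ →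
    ∀ m → HasNoIsotropicVector {R = polynomialRing m} ⟨ (λ i → const (coeff φ i)) ⟩
  polynomialRing-noIsotropicVector φ φ-aniso zero v e i =
    const-0 (φ-aniso (λ i → eval (v i)) (F.trans
      (F.sym (Homomorphism.value-homo (polynomialRing 0) F eval-homo ⟨ (λ i → const (coeff φ i)) ⟩ v))
      (eval-cong e)) i)
    where open NoVariables
  polynomialRing-noIsotropicVector φ φ-aniso (suc m) =
    IsVariableAdjunction.noIsotropicVector isVariableAdjunction bounded
      ⟨ (λ i → const (coeff φ i)) ⟩ (polynomialRing-noIsotropicVector φ φ-aniso m)
    where open AdjoinVariable F m

-- Hasse derivatives of polynomials

-- The first two Hasse derivatives with respect to xⱼ, that is, the coefficients of ε and ε²
-- in p(x₁, …, xⱼ + ε, …, xₘ).  The second one does not vanish on squares in characteristic 2.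
module HasseDerivatives (F : CommutativeRing c ℓ) (m : ℕ) (j : Fin m) where
  private
    module F = CommutativeRing F
    R = Polynomials.polynomialRing F m
    module T = Polynomials F m
  open T using (const; var)
  open CommutativeRing R hiding (zero)
  open SemiringSolver commutativeSemiring

  D₁ D₂ : Carrier → Carrier
  D₁ (const a)  = 0#
  D₁ (var i)    = const (CommutativeRingProperties.unitVector F j i)
  D₁ (p T.+ p′) = D₁ p + D₁ p′
  D₁ (p T.* p′) = p * D₁ p′ + D₁ p * p′
  D₁ (T.- p)    = - D₁ p
  D₂ (const a)  = 0#
  D₂ (var i)    = 0#
  D₂ (p T.+ p′) = D₂ p + D₂ p′
  D₂ (p T.* p′) = (p * D₂ p′ + D₂ p * p′) + D₁ p * D₁ p′
  D₂ (T.- p)    = - D₂ p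

  D₁-cong : ∀ {p p′} → p ≈ p′ → D₁ p ≈ D₁ p′
  D₁-cong T.refl              = refl
  D₁-cong (T.sym e)           = sym (D₁-cong e)
  D₁-cong (T.trans e e′)      = trans (D₁-cong e) (D₁-cong e′)
  D₁-cong (T.+-cong e e′)     = +-cong (D₁-cong e) (D₁-cong e′)
  D₁-cong (T.*-cong e e′)     = +-cong (*-cong e (D₁-cong e′)) (*-cong (D₁-cong e) e′)
  D₁-cong (T.neg-cong e)      = -‿cong (D₁-cong e)
  D₁-cong (T.+-assoc p q r)   = +-assoc _ _ _
  D₁-cong (T.+-comm p q)      = +-comm _ _
  D₁-cong (T.+-identityˡ p)   = +-identityˡ _
  D₁-cong (T.+-inverseˡ p)    = -‿inverseˡ _
  D₁-cong (T.*-assoc p q r)   =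
    solve 6 (λ p q r p₁ q₁ r₁ →
        (p :* q) :* r₁ :+ (p :* q₁ :+ p₁ :* q) :* r := p :* (q :* r₁ :+ q₁ :* r) :+ p₁ :* (q :* r))
      refl p q r (D₁ p) (D₁ q) (D₁ r)
  D₁-cong (T.*-comm p q)      =
    solve 4 (λ p q p₁ q₁ → p :* q₁ :+ p₁ :* q := q :* p₁ :+ q₁ :* p) refl p q (D₁ p) (D₁ q)
  D₁-cong (T.*-identityˡ p)   = trans (+-cong (*-identityˡ _) (zeroˡ p)) (+-identityʳ _)
  D₁-cong (T.distribˡ p q r)  =
    solve 6 (λ p q r p₁ q₁ r₁ →
        p :* (q₁ :+ r₁) :+ p₁ :* (q :+ r) := (p :* q₁ :+ p₁ :* q) :+ (p :* r₁ :+ p₁ :* r))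
      refl p q r (D₁ p) (D₁ q) (D₁ r)
  D₁-cong (T.const-cong e)    = refl
  D₁-cong (T.const-+ a b)     = sym (+-identityʳ 0#)
  D₁-cong (T.const-* a b)     = sym (trans (+-cong (zeroʳ _) (zeroˡ _)) (+-identityʳ 0#))

  D₂-cong : ∀ {p p′} → p ≈ p′ → D₂ p ≈ D₂ p′
  D₂-cong T.refl              = refl
  D₂-cong (T.sym e)           = sym (D₂-cong e)
  D₂-cong (T.trans e e′)      = trans (D₂-cong e) (D₂-cong e′)
  D₂-cong (T.+-cong e e′)     = +-cong (D₂-cong e) (D₂-cong e′)
  D₂-cong (T.*-cong e e′)     = +-cong
    (+-cong (*-cong e (D₂-cong e′)) (*-cong (D₂-cong e) e′)) (*-cong (D₁-cong e) (D₁-cong e′))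
  D₂-cong (T.neg-cong e)      = -‿cong (D₂-cong e)
  D₂-cong (T.+-assoc p q r)   = +-assoc _ _ _
  D₂-cong (T.+-comm p q)      = +-comm _ _
  D₂-cong (T.+-identityˡ p)   = +-identityˡ _
  D₂-cong (T.+-inverseˡ p)    = -‿inverseˡ _
  D₂-cong (T.*-assoc p q r)   =
    solve 9 (λ p q r p₁ q₁ r₁ p₂ q₂ r₂ →
        ((p :* q) :* r₂ :+ ((p :* q₂ :+ p₂ :* q) :+ p₁ :* q₁) :* r) :+ (p :* q₁ :+ p₁ :* q) :* r₁ :=
        (p :* ((q :* r₂ :+ q₂ :* r) :+ q₁ :* r₁) :+ p₂ :* (q :* r)) :+ p₁ :* (q :* r₁ :+ q₁ :* r))
      refl p q r (D₁ p) (D₁ q) (D₁ r) (D₂ p) (D₂ q) (D₂ r)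
  D₂-cong (T.*-comm p q)      =
    solve 6 (λ p q p₁ q₁ p₂ q₂ →
        (p :* q₂ :+ p₂ :* q) :+ p₁ :* q₁ := (q :* p₂ :+ q₂ :* p) :+ q₁ :* p₁)
      refl p q (D₁ p) (D₁ q) (D₂ p) (D₂ q)
  D₂-cong (T.*-identityˡ p)   = trans
    (+-cong (+-cong (*-identityˡ _) (zeroˡ p)) (zeroˡ _)) (trans (+-identityʳ _) (+-identityʳ _))
  D₂-cong (T.distribˡ p q r)  =
    solve 9 (λ p q r p₁ q₁ r₁ p₂ q₂ r₂ →
        (p :* (q₂ :+ r₂) :+ p₂ :* (q :+ r)) :+ p₁ :* (q₁ :+ r₁) :=
        ((p :* q₂ :+ p₂ :* q) :+ p₁ :* q₁) :+ ((p :* r₂ :+ p₂ :* r) :+ p₁ :* r₁))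
      refl p q r (D₁ p) (D₁ q) (D₁ r) (D₂ p) (D₂ q) (D₂ r)
  D₂-cong (T.const-cong e)    = refl
  D₂-cong (T.const-+ a b)     = sym (+-identityʳ 0#)
  D₂-cong (T.const-* a b)     = sym (trans
    (+-cong (+-cong (zeroʳ _) (zeroˡ _)) (zeroˡ 0#))
    (trans (+-congʳ (+-identityʳ 0#)) (+-identityʳ 0#)))

  module _ (1+1≈0 : HasCharacteristic2 R) where
    open Characteristic2 R 1+1≈0

    private
      D₁-square : ∀ a p → D₁ (const a * (p * p)) ≈ 0#
      D₁-square a p = trans
        (solve 4 (λ a p p₁ z → a :* (p :* p₁ :+ p₁ :* p) :+ con 0 :* z :=
                               a :* (p :* p₁) :+ a :* (p :* p₁))
           refl (const a) p (D₁ p) (p * p))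
        (x+x≈0 _)

      D₂-square : ∀ a p → D₂ (const a * (p * p)) ≈ const a * (D₁ p * D₁ p)
      D₂-square a p = trans
        (solve 5 (λ a p p₁ p₂ z →
            (a :* ((p :* p₂ :+ p₂ :* p) :+ p₁ :* p₁) :+ con 0 :* (p :* p)) :+ con 0 :* z :=
            a :* (p₁ :* p₁) :+ (a :* (p :* p₂) :+ a :* (p :* p₂)))
          refl (const a) p (D₁ p) (D₂ p) (p * D₁ p + D₁ p * p))
        (x+[y+y]≈x _ _)

    D₁-value : ∀ {n} (a : Vector F.Carrier n) v → D₁ (value {K = R} ⟨ (λ i → const (a i)) ⟩ v) ≈ 0#
    D₁-value {zero}  a v = refl
    D₁-value {suc n} a v =
      trans (+-cong (D₁-square (head a) (head v)) (D₁-value (tail a) (tail v))) (+-identityʳ 0#)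

    D₂-value : ∀ {n} (a : Vector F.Carrier n) v →
      D₂ (value {K = R} ⟨ (λ i → const (a i)) ⟩ v) ≈
      value {K = R} ⟨ (λ i → const (a i)) ⟩ (λ i → D₁ (v i))
    D₂-value {zero}  a v = refl
    D₂-value {suc n} a v = +-cong (D₂-square (head a) (head v)) (D₂-value (tail a) (tail v))

-- The derivation and the multipliers on the quadric

record IsotropyDerivation {R : CommutativeRing c ℓ} {n} (φ : Form R n) : Set (c ⊔ ℓ) where
  open CommutativeRing R
  field
    ∂        : Carrier → Carrier
    ∂-cong   : ∀ {x y} → x ≈ y → ∂ x ≈ ∂ y
    ∂-+      : ∀ x y → ∂ (x + y) ≈ ∂ x + ∂ y
    ∂-*      : ∀ x y → ∂ (x * y) ≈ x * ∂ y + y * ∂ x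
    -- In the application `scale` is `1 / a₁`, so that `scale * value φ (∂ ∘ v)` is the scalar `c`
    -- attached to an isotropic `v`. Its invertibility allows passing between `c` and `φ (∂ v)`; the
    -- last two fields say that `c` determines `v = 0` and multiplies the coefficients into the
    -- values.
    scale    : Carrier
    scale⁻¹  : Carrier
    inverse  : scale⁻¹ * scale ≈ 1#
    isotropic-∂-isotropic⇒0 : ∀ v → value φ v ≈ 0# → value φ (∂ ∘ v) ≈ 0# → ∀ i → v i ≈ 0#
    multiplier : ∀ v → value φ v ≈ 0# → ∀ i → Represents φ (coeff φ i * (scale * value φ (∂ ∘ v)))

-- The equation a₀ + a₁ t² + Σ aⱼ₊₂ xⱼ² = 0 is solved for t², adjoining t = √q to R.
module QuadricCone
  (R : CommutativeRing c ℓ) (1+1≈0 : HasCharacteristic2 R) (R-integral : IsIntegral R)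
  {m : ℕ} (φ : Form R (2 ℕ.+ m)) (φ-aniso : HasNoIsotropicVector φ)
  (a₁⁻¹ : CommutativeRing.Carrier R)
  (a₁⁻¹a₁≈1 : CommutativeRing._≈_ R (CommutativeRing._*_ R a₁⁻¹ (coeff φ (suc zero))) (CommutativeRing.1# R))
  (x : Vector (CommutativeRing.Carrier R) m) where

  open CommutativeRing R hiding (zero)
  open LinearAlgebra R
  open CommutativeRingProperties R
  open Characteristic2 R 1+1≈0
  open SemiringSolver commutativeSemiring

  a₀ a₁ s q : Carrier
  a₀ = coeff φ zero
  a₁ = coeff φ (suc zero)

  a₂₊ : Vector Carrier m
  a₂₊ i = coeff φ (suc (suc i))

  -- The equation of the quadric without the term `a₁ t²`; in characteristic 2 it reads `a₁ t² = s`,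
  -- with no sign.
  s = value {K = R} ⟨ a₀ ∷ a₂₊ ⟩ (1# ∷ x)
  q = a₁⁻¹ * s

  a₁q≈s : a₁ * q ≈ s
  a₁q≈s = begin
    a₁ * (a₁⁻¹ * s)   ≈⟨ solve 3 (λ a b s → a :* (b :* s) := (b :* a) :* s) refl a₁ a₁⁻¹ s ⟩
    (a₁⁻¹ * a₁) * s   ≈⟨ *-congʳ a₁⁻¹a₁≈1 ⟩
    1# * s            ≈⟨ *-identityˡ s ⟩
    s                 ∎
    where open SetoidReasoning setoid

  -- In characteristic 2 the norm `a² - q b²` of `a + b √q` is also its square.
  norm : Carrier → Carrier → Carrier
  norm a b = a * a + q * (b * b)

  -- `a₁ (a² + q b²) = a₁ a² + b² s` is the value of `φ` at `(b , a , b x)`: apart from the entry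
  -- `a`, this vector is `b` times the point `1# ∷ x` at which `s` is a value. The first two entries
  -- are `b` and `a` themselves.
  norm≈0⇒≈0 : ∀ a b → norm a b ≈ 0# → a ≈ 0# × b ≈ 0#
  norm≈0⇒≈0 a b e = vanishes (suc zero) , trans (sym (*-identityʳ b)) (vanishes zero)
    where
    open SetoidReasoning setoid
    v : Vector Carrier (2 ℕ.+ m)
    v = (b * 1#) ∷ a ∷ (λ i → b * x i)
    tailValue : Carrier
    tailValue = value {K = R} ⟨ a₂₊ ⟩ (λ i → b * x i)
    v-isotropic : value φ v ≈ 0#
    v-isotropic = begin
      a₀ * ((b * 1#) * (b * 1#)) + (a₁ * (a * a) + tailValue)
        ≈⟨ solve 3 (λ x y z → x :+ (y :+ z) := y :+ (x :+ z)) refl (a₀ * ((b * 1#) * (b * 1#))) (a₁ * (a * a)) tailValue ⟩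
      a₁ * (a * a) + (a₀ * ((b * 1#) * (b * 1#)) + tailValue)
        ≈⟨ +-congˡ (+-congˡ (sum-cong-≋ {m} (λ i → refl))) ⟩
      a₁ * (a * a) + value {K = R} ⟨ a₀ ∷ a₂₊ ⟩ (λ i → b * (1# ∷ x) i)
        ≈⟨ +-congˡ (value-* ⟨ a₀ ∷ a₂₊ ⟩ b (1# ∷ x)) ⟩
      a₁ * (a * a) + (b * b) * s
        ≈⟨ +-congˡ (*-congˡ a₁q≈s) ⟨
      a₁ * (a * a) + (b * b) * (a₁ * q)
        ≈⟨ solve 4 (λ a₁ a b q → a₁ :* (a :* a) :+ (b :* b) :* (a₁ :* q) :=
                                 a₁ :* (a :* a :+ q :* (b :* b))) refl a₁ a b q ⟩
      a₁ * norm a b   ≈⟨ *-congˡ e ⟩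
      a₁ * 0#             ≈⟨ zeroʳ a₁ ⟩
      0#                  ∎
    vanishes : ∀ i → v i ≈ 0#
    vanishes = φ-aniso v v-isotropic

  module Extension (B : CommutativeRing c₁ ℓ₁) (extension : IsQuadraticExtension R q B) where
    open IsQuadraticExtension extension
    private module B = CommutativeRing B

    extended : Form B (2 ℕ.+ m)
    extended = ⟨ embed ∘ coeff φ ⟩

    private
      module embed = IsRingHomomorphism embed-homo
      module embedᵛ = Homomorphism R B embed-homo

    characteristic2 : HasCharacteristic2 B
    characteristic2 = embedᵛ.characteristic2-homo 1+1≈0

    private
      module B₂ = Characteristic2 B characteristic2
      module Bₚ = CommutativeRingProperties B

    value-extended : ∀ v → value extended v B.≈
      embed (value φ (re ∘ v) + q * value φ (im ∘ v))
    value-extended v = begin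
      value extended v
        ≈⟨ Bₚ.value-cong extended (λ i → decomposition (v i)) ⟩
      value extended (λ i → embed (re (v i)) B.+ √q B.* embed (im (v i)))
        ≈⟨ B₂.value-+ extended (λ i → embed (re (v i))) (λ i → √q B.* embed (im (v i))) ⟩
      value extended (λ i → embed (re (v i))) B.+ value extended (λ i → √q B.* embed (im (v i)))
        ≈⟨ B.+-cong (B.sym (embedᵛ.value-homo φ (re ∘ v)))
             (B.trans (Bₚ.value-* extended √q (λ i → embed (im (v i))))
               (B.*-cong √q-square (B.sym (embedᵛ.value-homo φ (im ∘ v))))) ⟩
      embed (value φ (re ∘ v)) B.+ embed q B.* embed (value φ (im ∘ v))
        ≈⟨ B.+-congˡ (embed.*-homo q (value φ (im ∘ v))) ⟨
      embed (value φ (re ∘ v)) B.+ embed (q * value φ (im ∘ v))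
        ≈⟨ embed.+-homo (value φ (re ∘ v)) (q * value φ (im ∘ v)) ⟨
      embed (value φ (re ∘ v) + q * value φ (im ∘ v)) ∎
      where open SetoidReasoning B.setoid

    isIntegral : IsIntegral B
    isIntegral y y′ yy′≈0 = Sum.map (vanish y) (vanish y′) (R-integral (norm a b) (norm a′ b′) norm-product)
      where
      open SetoidReasoning setoid
      a  = re y
      b  = im y
      a′ = re y′
      b′ = im y′
      vanish : ∀ z → norm (re z) (im z) ≈ 0# → z B.≈ B.0#
      vanish z e = uncurry (≈0 z) (norm≈0⇒≈0 (re z) (im z) e)
      components : a * a′ + q * (b * b′) ≈ 0# × a * b′ + b * a′ ≈ 0#
      components = join-≈0 _ _ (B.trans (B.sym (*-join y y′)) yy′≈0)
      e₁ = proj₁ components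
      e₂ = proj₂ components
      norm-product : norm a b * norm a′ b′ ≈ 0#
      norm-product = begin
        norm a b * norm a′ b′
          -- The two squares in the target have cross terms amounting to four copies of
          -- `q a a′ b b′`. These sum to zero, and inserting them makes the two sides equal over any
          -- commutative semiring.
          ≈⟨ x+[y+y]≈x _ (q * (a * a′) * (b * b′) + q * (a * a′) * (b * b′)) ⟨
        norm a b * norm a′ b′ + ((q * (a * a′) * (b * b′) + q * (a * a′) * (b * b′)) +
                            (q * (a * a′) * (b * b′) + q * (a * a′) * (b * b′)))
          ≈⟨ solve 5 (λ a b a′ b′ q →
               (a :* a :+ q :* (b :* b)) :* (a′ :* a′ :+ q :* (b′ :* b′)) :+
               ((q :* (a :* a′) :* (b :* b′) :+ q :* (a :* a′) :* (b :* b′)) :+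
                (q :* (a :* a′) :* (b :* b′) :+ q :* (a :* a′) :* (b :* b′))) :=
               (a :* a′ :+ q :* (b :* b′)) :* (a :* a′ :+ q :* (b :* b′)) :+
               q :* ((a :* b′ :+ b :* a′) :* (a :* b′ :+ b :* a′))) refl a b a′ b′ q ⟩
        (a * a′ + q * (b * b′)) * (a * a′ + q * (b * b′)) +
        q * ((a * b′ + b * a′) * (a * b′ + b * a′))
          ≈⟨ +-cong (*-congʳ e₁) (*-congˡ (*-congʳ e₂)) ⟩
        0# * (a * a′ + q * (b * b′)) + q * (0# * (a * b′ + b * a′))
          ≈⟨ solve 3 (λ q u v → con 0 :* u :+ q :* (con 0 :* v) := con 0) refl q
               (a * a′ + q * (b * b′)) (a * b′ + b * a′) ⟩
        0# ∎

    ∂ : B.Carrier → B.Carrier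
    ∂ y = embed (im y)

    -- The Leibniz rule is consistent with `√q * √q = q` because `2 √q = 0` agrees with `∂ q = 0`;
    -- in the computation the term `√q (∂ y) (∂ z)` occurs twice.
    ∂-* : ∀ y z → ∂ (y B.* z) B.≈ y B.* ∂ z B.+ z B.* ∂ y
    ∂-* y z = B.sym (begin
      y B.* ∂ z B.+ z B.* ∂ y
        ≈⟨ B.+-cong (B.*-congʳ (decomposition y)) (B.*-congʳ (decomposition z)) ⟩
      (embed (re y) B.+ √q B.* ∂ y) B.* ∂ z B.+ (embed (re z) B.+ √q B.* ∂ z) B.* ∂ y
        ≈⟨ solveᴮ 5 (λ t a b a′ b′ → (a :+ᴮ t :*ᴮ b) :*ᴮ b′ :+ᴮ (a′ :+ᴮ t :*ᴮ b′) :*ᴮ b :=ᴮ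
                                     (a :*ᴮ b′ :+ᴮ b :*ᴮ a′) :+ᴮ (t :*ᴮ (b :*ᴮ b′) :+ᴮ t :*ᴮ (b :*ᴮ b′))) B.refl
             √q (embed (re y)) (∂ y) (embed (re z)) (∂ z) ⟩
      (embed (re y) B.* ∂ z B.+ ∂ y B.* embed (re z)) B.+ (√q B.* (∂ y B.* ∂ z) B.+ √q B.* (∂ y B.* ∂ z))
        ≈⟨ B₂.x+[y+y]≈x _ _ ⟩
      embed (re y) B.* ∂ z B.+ ∂ y B.* embed (re z)
        ≈⟨ B.+-cong (embed.*-homo (re y) (im z)) (embed.*-homo (im y) (re z)) ⟨
      embed (re y * im z) B.+ embed (im y * re z)
        ≈⟨ embed.+-homo (re y * im z) (im y * re z) ⟨
      embed (re y * im z + im y * re z)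
        ≈⟨ embed.⟦⟧-cong (im-* y z) ⟨
      ∂ (y B.* z) ∎)
      where
      open SetoidReasoning B.setoid
      open SemiringSolver B.commutativeSemiring
        renaming (solve to solveᴮ; _:+_ to _:+ᴮ_; _:*_ to _:*ᴮ_; _:=_ to _:=ᴮ_)

    value-∂ : ∀ v → value extended (∂ ∘ v) B.≈ embed (value φ (im ∘ v))
    value-∂ v = B.sym (embedᵛ.value-homo φ (im ∘ v))

    isotropic-∂-isotropic⇒0 : ∀ v → value extended v B.≈ B.0# → value extended (∂ ∘ v) B.≈ B.0# →
                              ∀ i → v i B.≈ B.0#
    isotropic-∂-isotropic⇒0 v e e∂ i =
      ≈0 (v i) (φ-aniso (re ∘ v) first i) (φ-aniso (im ∘ v) second i)
      where
      open SetoidReasoning setoid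
      second : value φ (im ∘ v) ≈ 0#
      second = embed-≈0 (B.trans (B.sym (value-∂ v)) e∂)
      first : value φ (re ∘ v) ≈ 0#
      first = begin
        value φ (re ∘ v)                             ≈⟨ +-identityʳ _ ⟨
        value φ (re ∘ v) + 0#                        ≈⟨ +-congˡ (trans (*-congˡ second) (zeroʳ q)) ⟨
        value φ (re ∘ v) + q * value φ (im ∘ v)   ≈⟨ embed-≈0 (B.trans (B.sym (value-extended v)) e) ⟩
        0#                                              ∎

    module _
      -- To be provided by the Hasse derivative with respect to xⱼ once `R` is a polynomial ring;
      -- the extra term `a₂₊ j * value φ w` will come from differentiating `s`.
      (differentiate : ∀ j (v w : Vector Carrier (2 ℕ.+ m)) → a₁ * value φ v ≈ s * value φ w →
        ∃₂ λ v′ w′ → a₁ * value φ v′ ≈ s * value φ w′ + a₂₊ j * value φ w) where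

      private
        represents : ∀ v w → Represents extended (embed (value φ v + q * value φ w))
        represents v w = u , B.trans (value-extended u) (embed.⟦⟧-cong
          (+-cong (value-cong φ (λ i → re-join (v i) (w i))) (*-congˡ (value-cong φ (λ i → im-join (v i) (w i))))))
          where
          u : Vector B.Carrier (2 ℕ.+ m)
          u i = embed (v i) B.+ √q B.* embed (w i)

        module _ (v w : Vector Carrier (2 ℕ.+ m)) (e : value φ v + q * value φ w ≈ 0#) where
          open SetoidReasoning setoid

          a₁φv≈sφw : a₁ * value φ v ≈ s * value φ w
          a₁φv≈sφw = begin
            a₁ * value φ v         ≈⟨ *-congˡ (x+y≈0⇒x≈y e) ⟩
            a₁ * (q * value φ w)   ≈⟨ *-assoc a₁ q _ ⟨
            (a₁ * q) * value φ w   ≈⟨ *-congʳ a₁q≈s ⟩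
            s * value φ w          ∎

          cancel-a₁ : ∀ u → a₁⁻¹ * (a₁ * u) ≈ u
          cancel-a₁ u = trans (sym (*-assoc a₁⁻¹ a₁ u)) (trans (*-congʳ a₁⁻¹a₁≈1) (*-identityˡ u))

          κ : Carrier
          κ = a₁⁻¹ * value φ w

          multiplier₂₊ : ∀ j → Represents extended (embed (a₂₊ j * κ))
          multiplier₂₊ j with differentiate j v w a₁φv≈sφw
          ... | v′ , w′ , e′ = Bₚ.represents-≈ extended (embed.⟦⟧-cong eq) (represents v′ w′)
            where
            eq : value φ v′ + q * value φ w′ ≈ a₂₊ j * κ
            eq = begin
              value φ v′ + q * value φ w′
                ≈⟨ +-congʳ (cancel-a₁ (value φ v′)) ⟨
              a₁⁻¹ * (a₁ * value φ v′) + (a₁⁻¹ * s) * value φ w′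
                ≈⟨ solve 4 (λ b u s w → b :* u :+ (b :* s) :* w := b :* (s :* w :+ u)) refl
                     a₁⁻¹ (a₁ * value φ v′) s (value φ w′) ⟩
              a₁⁻¹ * (s * value φ w′ + a₁ * value φ v′)
                ≈⟨ *-congˡ (x≈y+z⇒z≈y+x e′) ⟨
              a₁⁻¹ * (a₂₊ j * value φ w)
                ≈⟨ solve 3 (λ b a u → b :* (a :* u) := a :* (b :* u)) refl a₁⁻¹ (a₂₊ j) (value φ w) ⟩
              a₂₊ j * κ ∎

          multiplierᴿ : ∀ i → Represents extended (embed (coeff φ i * κ))
          -- The equation gives `a₀ = a₁ q + Σ a₂₊ j xⱼ²`, hence `a₀ κ = q φ(w) + Σ xⱼ² (a₂₊ j κ)`.
          -- The first summand is the value at `√q w`, the others are squares times the values just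
          -- found.
          multiplierᴿ zero = Bₚ.represents-≈ extended eq
            (B₂.represents-+ extended (represents (λ _ → 0#) w)
              (B₂.represents-sum extended (λ j → (embed (x j) B.* embed (x j)) B.* embed (a₂₊ j * κ))
                (λ j → Bₚ.represents-* extended (embed (x j)) (multiplier₂₊ j))))
            where
            eqᴿ : q * value φ w + sum (λ j → (x j * x j) * (a₂₊ j * κ)) ≈ a₀ * κ
            eqᴿ = x+y≈0⇒x≈y (begin
              (q * value φ w + sum (λ j → (x j * x j) * (a₂₊ j * κ))) + a₀ * κ
                ≈⟨ +-congʳ (+-congˡ (trans
                     (sum-cong-≋ (λ j → solve 3 (λ a x κ → (x :* x) :* (a :* κ) := (a :* (x :* x)) :* κ) refl (a₂₊ j) (x j) κ))
                     (sym (*-distribʳ-sum κ (λ j → a₂₊ j * (x j * x j)))))) ⟩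
              (q * value φ w + σ * κ) + a₀ * κ
                ≈⟨ +-congʳ (+-congʳ (solve 3 (λ b s u → (b :* s) :* u := s :* (b :* u)) refl a₁⁻¹ s (value φ w))) ⟩
              ((a₀ * (1# * 1#) + σ) * κ + σ * κ) + a₀ * κ
                ≈⟨ +-congʳ (+-congʳ (*-congʳ (+-congʳ (trans (*-congˡ (*-identityˡ 1#)) (*-identityʳ a₀))))) ⟩
              ((a₀ + σ) * κ + σ * κ) + a₀ * κ
                ≈⟨ solve 3 (λ a s κ → ((a :+ s) :* κ :+ s :* κ) :+ a :* κ := (a :+ s) :* κ :+ (a :+ s) :* κ) refl a₀ σ κ ⟩
              (a₀ + σ) * κ + (a₀ + σ) * κ
                ≈⟨ x+x≈0 _ ⟩
              0# ∎)
              where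
              σ : Carrier
              σ = value {K = R} ⟨ a₂₊ ⟩ x
            eq : embed (value φ (λ _ → 0#) + q * value φ w) B.+
                 LinearAlgebra.sum B (λ j → (embed (x j) B.* embed (x j)) B.* embed (a₂₊ j * κ)) B.≈
                 embed (a₀ * κ)
            eq = B.trans
              (B.+-cong (embed.⟦⟧-cong (trans (+-congʳ (value-0 φ)) (+-identityˡ _)))
                (B.trans
                  (Bₚ.sum-cong-≋ (λ j → B.sym (B.trans (embed.*-homo (x j * x j) (a₂₊ j * κ))
                                                       (B.*-congʳ (embed.*-homo (x j) (x j))))))
                  (B.sym (embedᵛ.sum-homo (λ j → (x j * x j) * (a₂₊ j * κ))))))
              (B.trans (B.sym (embed.+-homo (q * value φ w) (sum (λ j → (x j * x j) * (a₂₊ j * κ)))))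
                (embed.⟦⟧-cong eqᴿ))
          multiplierᴿ (suc zero) = Bₚ.represents-≈ extended (embed.⟦⟧-cong eq) (represents w (λ _ → 0#))
            where
            eq : value φ w + q * value φ (λ _ → 0#) ≈ a₁ * κ
            eq = begin
              value φ w + q * value φ (λ _ → 0#)   ≈⟨ +-congˡ (trans (*-congˡ (value-0 φ)) (zeroʳ q)) ⟩
              value φ w + 0#                       ≈⟨ +-identityʳ _ ⟩
              value φ w                            ≈⟨ cancel-a₁ (value φ w) ⟨
              a₁⁻¹ * (a₁ * value φ w)
                ≈⟨ solve 3 (λ b a u → b :* (a :* u) := a :* (b :* u)) refl a₁⁻¹ a₁ (value φ w) ⟩
              a₁ * κ                               ∎
          multiplierᴿ (suc (suc j)) = multiplier₂₊ j

      isotropyDerivation : IsotropyDerivation extended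
      isotropyDerivation = record
        { ∂ = ∂
        ; ∂-cong = λ e → embed.⟦⟧-cong (im-cong e)
        ; ∂-+ = λ y z → B.trans (embed.⟦⟧-cong (im-+ y z)) (embed.+-homo (im y) (im z))
        ; ∂-* = ∂-*
        ; scale = embed a₁⁻¹
        ; scale⁻¹ = embed a₁
        ; inverse = B.trans (B.sym (embed.*-homo a₁ a₁⁻¹))
            (B.trans (embed.⟦⟧-cong (trans (*-comm a₁ a₁⁻¹) a₁⁻¹a₁≈1)) embed.1#-homo)
        ; isotropic-∂-isotropic⇒0 = isotropic-∂-isotropic⇒0
        ; multiplier = λ v e i → Bₚ.represents-≈ extended
            (B.trans (embed.*-homo (coeff φ i) (a₁⁻¹ * value φ (im ∘ v)))
              (B.*-congˡ (B.trans (embed.*-homo a₁⁻¹ (value φ (im ∘ v)))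
                (B.*-congˡ (B.sym (value-∂ v))))))
            (multiplierᴿ (re ∘ v) (im ∘ v) (embed-≈0 (B.trans (B.sym (value-extended v)) e)) i)
        }

-- The coordinate ring as a quadratic extension of a polynomial ring

module Transport (A : CommutativeRing c₁ ℓ₁) (B : CommutativeRing c₂ ℓ₂)
  (ρ : CommutativeRing.Carrier A → CommutativeRing.Carrier B) (ρ-homo : IsHomomorphism A B ρ)
  (σ : CommutativeRing.Carrier B → CommutativeRing.Carrier A)
  (ρ-injective : ∀ {x y} → CommutativeRing._≈_ B (ρ x) (ρ y) → CommutativeRing._≈_ A x y)
  (ρσ : ∀ y → CommutativeRing._≈_ B (ρ (σ y)) y) where

  private
    module A = CommutativeRing A
    module B = CommutativeRing B
    module ρ = IsRingHomomorphism ρ-homo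
    module Bₚ = CommutativeRingProperties B

  ρ-≈0 : ∀ {x} → ρ x B.≈ B.0# → x A.≈ A.0#
  ρ-≈0 e = ρ-injective (B.trans e (B.sym ρ.0#-homo))

  isIntegral : IsIntegral B → IsIntegral A
  isIntegral B-integral x y e = Sum.map ρ-≈0 ρ-≈0
    (B-integral (ρ x) (ρ y) (B.trans (B.sym (ρ.*-homo x y)) (B.trans (ρ.⟦⟧-cong e) ρ.0#-homo)))

  module _ {n} (φ : Form A n) where
    private
      φᴮ : Form B n
      φᴮ = ⟨ (λ i → ρ (coeff φ i)) ⟩

      value-ρ : ∀ v → ρ (value φ v) B.≈ value φᴮ (λ i → ρ (v i))
      value-ρ = Homomorphism.value-homo A B ρ-homo φ

    -- The derivation is conjugated by `ρ`. Each law is checked after applying the injective `ρ`,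
    -- where `ρσ` removes `σ`; thus `σ` itself never has to be shown a homomorphism.
    isotropyDerivation : IsotropyDerivation φᴮ → IsotropyDerivation φ
    isotropyDerivation d = record
      { ∂ = ∂ᴬ
      ; ∂-cong = λ e → ρ-injective (B.trans (ρσ _) (B.trans (∂-cong (ρ.⟦⟧-cong e)) (B.sym (ρσ _))))
      ; ∂-+ = λ x y → ρ-injective (B.trans (ρσ _) (B.trans (∂-cong (ρ.+-homo x y))
          (B.trans (∂-+ _ _) (B.sym (B.trans (ρ.+-homo _ _) (B.+-cong (ρσ _) (ρσ _)))))))
      ; ∂-* = λ x y → ρ-injective (B.trans (ρσ _) (B.trans (∂-cong (ρ.*-homo x y))
          (B.trans (∂-* _ _) (B.sym (B.trans (ρ.+-homo _ _)
            (B.+-cong (B.trans (ρ.*-homo _ _) (B.*-congˡ (ρσ _)))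
                      (B.trans (ρ.*-homo _ _) (B.*-congˡ (ρσ _)))))))))
      ; scale = σ scale
      ; scale⁻¹ = σ scale⁻¹
      ; inverse = ρ-injective (B.trans (ρ.*-homo _ _)
          (B.trans (B.*-cong (ρσ _) (ρσ _)) (B.trans inverse (B.sym ρ.1#-homo))))
      ; isotropic-∂-isotropic⇒0 = λ v e e∂ i → ρ-≈0
          (isotropic-∂-isotropic⇒0 (λ i → ρ (v i)) (isotropic v e)
            (B.trans (B.sym (value-∂ v)) (B.trans (ρ.⟦⟧-cong e∂) ρ.0#-homo)) i)
      ; multiplier = multiplierᴬ
      }
      where
      open IsotropyDerivation d
      ∂ᴬ : A.Carrier → A.Carrier
      ∂ᴬ x = σ (∂ (ρ x))
      isotropic : ∀ v → value φ v A.≈ A.0# → value φᴮ (λ i → ρ (v i)) B.≈ B.0#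
      isotropic v e = B.trans (B.sym (value-ρ v)) (B.trans (ρ.⟦⟧-cong e) ρ.0#-homo)
      value-∂ : ∀ v → ρ (value φ (λ i → ∂ᴬ (v i))) B.≈ value φᴮ (λ i → ∂ (ρ (v i)))
      value-∂ v = B.trans (value-ρ (λ i → ∂ᴬ (v i))) (Bₚ.value-cong φᴮ (λ i → ρσ (∂ (ρ (v i)))))
      multiplierᴬ : ∀ v → value φ v A.≈ A.0# → ∀ i →
        Represents φ (coeff φ i A.* (σ scale A.* value φ (λ i → ∂ᴬ (v i))))
      multiplierᴬ v e i with multiplier (λ i → ρ (v i)) (isotropic v e) i
      ... | w , e′ = (λ i → σ (w i)) , ρ-injective (begin
        ρ (value φ (λ i → σ (w i)))             ≈⟨ value-ρ (λ i → σ (w i)) ⟩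
        value φᴮ (λ i → ρ (σ (w i)))            ≈⟨ Bₚ.value-cong φᴮ (λ i → ρσ (w i)) ⟩
        value φᴮ w                              ≈⟨ e′ ⟩
        ρ (coeff φ i) B.* (scale B.* value φᴮ (λ i → ∂ (ρ (v i))))
          ≈⟨ B.*-congˡ (B.trans (ρ.*-homo _ _) (B.*-cong (ρσ scale) (value-∂ v))) ⟨
        ρ (coeff φ i) B.* ρ (σ scale A.* value φ (λ i → ∂ᴬ (v i)))
          ≈⟨ ρ.*-homo _ _ ⟨
        ρ (coeff φ i A.* (σ scale A.* value φ (λ i → ∂ᴬ (v i)))) ∎)
        where open SetoidReasoning B.setoid

-- Modulo h = s + a₁ x₀², every element of P = R[x₀] is of the form a + x₀ b with a, b in R.
module Elimination (R : CommutativeRing c ℓ) (P : CommutativeRing c₁ ℓ₁) (P-characteristic2 : HasCharacteristic2 P)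
  (weaken : CommutativeRing.Carrier R → CommutativeRing.Carrier P) (weaken-homo : IsHomomorphism R P weaken)
  (x₀ h : CommutativeRing.Carrier P) (s a₁ a₁⁻¹ : CommutativeRing.Carrier R)
  (a₁⁻¹a₁≈1 : CommutativeRing._≈_ R (CommutativeRing._*_ R a₁⁻¹ a₁) (CommutativeRing.1# R))
  (h≈ : CommutativeRing._≈_ P h (CommutativeRing._+_ P (weaken s)
          (CommutativeRing._*_ P (weaken a₁) (CommutativeRing._*_ P x₀ x₀))))
  where

  private
    module R = CommutativeRing R
    module P = CommutativeRing P
    A = PrincipalQuotient.quotientRing P h
    module A = CommutativeRing A
    module weaken = IsRingHomomorphism weaken-homo

  quotient-homo : IsHomomorphism P A id
  quotient-homo = isHomomorphism P A id
    (λ {x} {y} e → P.0# , P.trans e (P.sym (P.trans (P.+-congˡ (P.zeroˡ h)) (P.+-identityʳ y))))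
    (λ _ _ → A.refl) (λ _ _ → A.refl) A.refl

  x₀-square : x₀ A.* x₀ A.≈ weaken (a₁⁻¹ R.* s)
  -- The multiple of `h` is found by dividing `h = s + a₁ x₀²` by `a₁`: `x₀² = a₁⁻¹ s + a₁⁻¹ h`.
  x₀-square = weaken a₁⁻¹ , P.sym (begin
    weaken (a₁⁻¹ R.* s) P.+ weaken a₁⁻¹ P.* h
      ≈⟨ P.+-cong (weaken.*-homo a₁⁻¹ s) (P.*-congˡ h≈) ⟩
    weaken a₁⁻¹ P.* weaken s P.+ weaken a₁⁻¹ P.* (weaken s P.+ weaken a₁ P.* (x₀ P.* x₀))
      ≈⟨ solve 4 (λ b s a y → b :* s :+ b :* (s :+ a :* y) := (b :* a) :* y :+ (b :* s :+ b :* s)) P.refl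
           (weaken a₁⁻¹) (weaken s) (weaken a₁) (x₀ P.* x₀) ⟩
    (weaken a₁⁻¹ P.* weaken a₁) P.* (x₀ P.* x₀) P.+ (weaken a₁⁻¹ P.* weaken s P.+ weaken a₁⁻¹ P.* weaken s)
      ≈⟨ x+[y+y]≈x _ _ ⟩
    (weaken a₁⁻¹ P.* weaken a₁) P.* (x₀ P.* x₀)
      ≈⟨ P.*-congʳ (P.trans (P.sym (weaken.*-homo a₁⁻¹ a₁)) (P.trans (weaken.⟦⟧-cong a₁⁻¹a₁≈1) weaken.1#-homo)) ⟩
    P.1# P.* (x₀ P.* x₀)
      ≈⟨ P.*-identityˡ _ ⟩
    x₀ P.* x₀ ∎)
    where
    open SetoidReasoning P.setoid
    open SemiringSolver P.commutativeSemiring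
    open Characteristic2 P P-characteristic2

  Reducible : P.Carrier → Set (c ⊔ c₁ ⊔ ℓ₁)
  Reducible p = ∃₂ λ a b → p A.≈ weaken a A.+ x₀ A.* weaken b

  private
    module A-weaken = IsRingHomomorphism (Composition.isRingHomomorphism A.trans weaken-homo quotient-homo)
    open SemiringSolver A.commutativeSemiring

  reducible-weaken : ∀ a → Reducible (weaken a)
  reducible-weaken a = a , R.0# ,
    A.sym (A.trans (A.+-congˡ (A.trans (A.*-congˡ A-weaken.0#-homo) (A.zeroʳ x₀))) (A.+-identityʳ _))

  reducible-x₀ : Reducible x₀
  reducible-x₀ = R.0# , R.1# ,
    A.sym (A.trans (A.+-cong A-weaken.0#-homo (A.trans (A.*-congˡ A-weaken.1#-homo) (A.*-identityʳ x₀)))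
                   (A.+-identityˡ x₀))

  reducible-+ : ∀ {p p′} → Reducible p → Reducible p′ → Reducible (p P.+ p′)
  reducible-+ {p} {p′} (a , b , e) (a′ , b′ , e′) = a R.+ a′ , b R.+ b′ , (begin
    p A.+ p′
      ≈⟨ A.+-cong e e′ ⟩
    (weaken a A.+ x₀ A.* weaken b) A.+ (weaken a′ A.+ x₀ A.* weaken b′)
      ≈⟨ solve 5 (λ x a b a′ b′ → (a :+ x :* b) :+ (a′ :+ x :* b′) := (a :+ a′) :+ x :* (b :+ b′)) A.refl
           x₀ (weaken a) (weaken b) (weaken a′) (weaken b′) ⟩
    (weaken a A.+ weaken a′) A.+ x₀ A.* (weaken b A.+ weaken b′)
      ≈⟨ A.+-cong (A-weaken.+-homo a a′) (A.*-congˡ (A-weaken.+-homo b b′)) ⟨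
    weaken (a R.+ a′) A.+ x₀ A.* weaken (b R.+ b′) ∎)
    where open SetoidReasoning A.setoid

  reducible-* : ∀ {p p′} → Reducible p → Reducible p′ → Reducible (p P.* p′)
  reducible-* {p} {p′} (a , b , e) (a′ , b′ , e′) =
    a R.* a′ R.+ (a₁⁻¹ R.* s) R.* (b R.* b′) , a R.* b′ R.+ b R.* a′ , (begin
    p A.* p′
      ≈⟨ A.*-cong e e′ ⟩
    (weaken a A.+ x₀ A.* weaken b) A.* (weaken a′ A.+ x₀ A.* weaken b′)
      ≈⟨ solve 5 (λ x a b a′ b′ → (a :+ x :* b) :* (a′ :+ x :* b′) :=
                                  (a :* a′ :+ (x :* x) :* (b :* b′)) :+ x :* (a :* b′ :+ b :* a′)) A.refl
           x₀ (weaken a) (weaken b) (weaken a′) (weaken b′) ⟩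
    (weaken a A.* weaken a′ A.+ (x₀ A.* x₀) A.* (weaken b A.* weaken b′)) A.+
      x₀ A.* (weaken a A.* weaken b′ A.+ weaken b A.* weaken a′)
      ≈⟨ A.+-cong
           (A.+-cong (A.sym (A-weaken.*-homo a a′)) (A.*-cong x₀-square (A.sym (A-weaken.*-homo b b′))))
           (A.*-congˡ (A.+-cong (A.sym (A-weaken.*-homo a b′)) (A.sym (A-weaken.*-homo b a′)))) ⟩
    (weaken (a R.* a′) A.+ weaken (a₁⁻¹ R.* s) A.* weaken (b R.* b′)) A.+
      x₀ A.* (weaken (a R.* b′) A.+ weaken (b R.* a′))
      ≈⟨ A.+-cong
           (A.trans (A-weaken.+-homo _ _) (A.+-congˡ (A-weaken.*-homo (a₁⁻¹ R.* s) (b R.* b′))))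
           (A.*-congˡ (A-weaken.+-homo _ _)) ⟨
    weaken (a R.* a′ R.+ (a₁⁻¹ R.* s) R.* (b R.* b′)) A.+ x₀ A.* weaken (a R.* b′ R.+ b R.* a′) ∎)
    where open SetoidReasoning A.setoid

  reducible-neg : ∀ {p} → Reducible p → Reducible (P.- p)
  reducible-neg {p} (a , b , e) = R.- a , R.- b , (begin
    A.- p                                          ≈⟨ A.-‿cong e ⟩
    A.- (weaken a A.+ x₀ A.* weaken b)             ≈⟨ -‿+-comm _ _ ⟨
    A.- weaken a A.+ A.- (x₀ A.* weaken b)         ≈⟨ A.+-congˡ (-‿distribʳ-* x₀ (weaken b)) ⟩
    A.- weaken a A.+ x₀ A.* (A.- weaken b)
      ≈⟨ A.+-cong (A-weaken.-‿homo a) (A.*-congˡ (A-weaken.-‿homo b)) ⟨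
    weaken (R.- a) A.+ x₀ A.* weaken (R.- b)       ∎)
    where
    open RingProperties A.ring
    open SetoidReasoning A.setoid

  module Isomorphism (reducible : ∀ p → Reducible p)
    (B : CommutativeRing c₂ ℓ₂)
    (embed : R.Carrier → CommutativeRing.Carrier B) (embed-homo : IsHomomorphism R B embed)
    (√q : CommutativeRing.Carrier B)
    (√q-square : CommutativeRing._≈_ B (CommutativeRing._*_ B √q √q) (embed (a₁⁻¹ R.* s)))
    (decomposition : ∀ y → ∃₂ λ a b →
      CommutativeRing._≈_ B y (CommutativeRing._+_ B (embed a) (CommutativeRing._*_ B √q (embed b))))
    (independent : ∀ a b →
      CommutativeRing._≈_ B (CommutativeRing._+_ B (embed a) (CommutativeRing._*_ B √q (embed b)))
                            (CommutativeRing.0# B) → a R.≈ R.0# × b R.≈ R.0#)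
    (ρ : P.Carrier → CommutativeRing.Carrier B) (ρ-homo : IsHomomorphism P B ρ)
    (ρ-weaken : ∀ a → CommutativeRing._≈_ B (ρ (weaken a)) (embed a))
    (ρ-x₀ : CommutativeRing._≈_ B (ρ x₀) √q)
    where

    private
      module B = CommutativeRing B
      module ρ = IsRingHomomorphism ρ-homo
      module embed = IsRingHomomorphism embed-homo

    private
      ρ-h : ρ h B.≈ B.0#
      ρ-h = begin
        ρ h
          ≈⟨ ρ.⟦⟧-cong h≈ ⟩
        ρ (weaken s P.+ weaken a₁ P.* (x₀ P.* x₀))
          ≈⟨ B.trans (ρ.+-homo _ _) (B.+-congˡ (B.trans (ρ.*-homo _ _) (B.*-congˡ (ρ.*-homo x₀ x₀)))) ⟩
        ρ (weaken s) B.+ ρ (weaken a₁) B.* (ρ x₀ B.* ρ x₀)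
          ≈⟨ B.+-cong (ρ-weaken s) (B.*-cong (ρ-weaken a₁) (B.trans (B.*-cong ρ-x₀ ρ-x₀) √q-square)) ⟩
        embed s B.+ embed a₁ B.* embed (a₁⁻¹ R.* s)
          ≈⟨ B.+-congˡ (B.trans (B.sym (embed.*-homo a₁ _)) (embed.⟦⟧-cong a₁q≈s)) ⟩
        embed s B.+ embed s
          ≈⟨ Characteristic2.x+x≈0 B (Homomorphism.characteristic2-homo P B ρ-homo P-characteristic2) (embed s) ⟩
        B.0# ∎
        where
        open SetoidReasoning B.setoid
        a₁q≈s : a₁ R.* (a₁⁻¹ R.* s) R.≈ s
        a₁q≈s = R.trans (R.sym (R.*-assoc a₁ a₁⁻¹ s))
          (R.trans (R.*-congʳ (R.trans (R.*-comm a₁ a₁⁻¹) a₁⁻¹a₁≈1)) (R.*-identityˡ s))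

    ρ-homoᴬ : IsHomomorphism A B ρ
    ρ-homoᴬ = isHomomorphism A B ρ
      (λ {x} {y} (r , e) → B.trans (ρ.⟦⟧-cong e)
        (B.trans (ρ.+-homo y (r P.* h))
          (B.trans (B.+-congˡ (B.trans (ρ.*-homo r h) (B.trans (B.*-congˡ ρ-h) (B.zeroʳ (ρ r)))))
            (B.+-identityʳ (ρ y)))))
      ρ.+-homo ρ.*-homo ρ.1#-homo

    private
      module ρᴬ = IsRingHomomorphism ρ-homoᴬ

      ρ-reduced : ∀ a b → ρ (weaken a P.+ x₀ P.* weaken b) B.≈ embed a B.+ √q B.* embed b
      ρ-reduced a b = B.trans (ρ.+-homo _ _)
        (B.+-cong (ρ-weaken a) (B.trans (ρ.*-homo x₀ (weaken b)) (B.*-cong ρ-x₀ (ρ-weaken b))))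

      -- Modulo `h` the element is some `a + x₀ b`, whose image is `a + √q b`; independence of `1`
      -- and `√q` forces `a` and `b` to vanish.
      ρ-kernel : ∀ {x} → ρ x B.≈ B.0# → x A.≈ A.0#
      ρ-kernel {x} e with reducible x
      ... | a , b , x≈ with independent a b (B.trans (B.sym (ρ-reduced a b)) (B.trans (B.sym (ρᴬ.⟦⟧-cong x≈)) e))
      ...   | a≈0 , b≈0 = A.trans x≈ (A.trans
        (A.+-cong (A.trans (A-weaken.⟦⟧-cong a≈0) A-weaken.0#-homo)
                  (A.trans (A.*-congˡ (A.trans (A-weaken.⟦⟧-cong b≈0) A-weaken.0#-homo)) (A.zeroʳ x₀)))
        (A.+-identityˡ A.0#))

    ρ-injective : ∀ {x y} → ρ x B.≈ ρ y → x A.≈ y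
    ρ-injective {x} {y} e = x∙y⁻¹≈ε⇒x≈y x y (ρ-kernel (B.trans (ρᴬ.+-homo x (A.- y))
      (B.trans (B.+-cong e (ρᴬ.-‿homo y)) (B.-‿inverseʳ (ρ y)))))
      where open RingProperties A.ring

    σ : B.Carrier → A.Carrier
    σ y = weaken (proj₁ (decomposition y)) P.+ x₀ P.* weaken (proj₁ (proj₂ (decomposition y)))

    ρσ : ∀ y → ρ (σ y) B.≈ y
    ρσ y = B.trans (ρ-reduced _ _) (B.sym (proj₂ (proj₂ (decomposition y))))

module CoordinateRing {F : CommutativeRing c ℓ} (F-integral : IsIntegral F)
  (1≉0 : ¬ CommutativeRing._≈_ F (CommutativeRing.1# F) (CommutativeRing.0# F))
  (1+1≈0 : HasCharacteristic2 F)
  {m : ℕ} (φ : Form F (2 ℕ.+ m)) (φ-aniso : HasNoIsotropicVector φ)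
  (a₁⁻¹ : CommutativeRing.Carrier F)
  (a₁⁻¹a₁≈1 : CommutativeRing._≈_ F (CommutativeRing._*_ F a₁⁻¹ (coeff φ (suc zero))) (CommutativeRing.1# F))
  where

  private
    module F = CommutativeRing F
    P = Polynomials.polynomialRing F (suc m)
    R = Polynomials.polynomialRing F m
    module P = CommutativeRing P
    module R = CommutativeRing R
    module A = CommutativeRing (FunctionField.coordinateRing φ)
    h = FunctionField.chartEquation φ
  open Polynomials F using (const; var)

  private
    φᴿ : Form R (2 ℕ.+ m)
    φᴿ = ⟨ (λ i → const (coeff φ i)) ⟩

    R-characteristic2 : HasCharacteristic2 R
    R-characteristic2 = Homomorphism.characteristic2-homo F R (const-homo F m) 1+1≈0

    a₁⁻¹a₁≈1ᴿ : const a₁⁻¹ R.* const (coeff φ (suc zero)) R.≈ R.1#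
    a₁⁻¹a₁≈1ᴿ = R.trans (R.sym (Polynomials.const-* a₁⁻¹ _)) (Polynomials.const-cong a₁⁻¹a₁≈1)

    open QuadricCone R R-characteristic2 (polynomialRing-isIntegral F-integral m) φᴿ
      (polynomialRing-noIsotropicVector φ φ-aniso m)
      (const a₁⁻¹) a₁⁻¹a₁≈1ᴿ var
      using (a₀; a₁; a₂₊; s; q; module Extension)

    -- `D₂` is applied to both sides. The mixed term of its product rule dies because `s` is a value
    -- of a form with constant coefficients, so that `D₁ s = 0`. Of the entries of `1# ∷ var` only
    -- xⱼ has a nonzero derivative, so that `D₂ s` is the coefficient of xⱼ².
    differentiate : ∀ j (v w : Vector R.Carrier (2 ℕ.+ m)) → a₁ R.* value φᴿ v R.≈ s R.* value φᴿ w →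
      ∃₂ λ v′ w′ → a₁ R.* value φᴿ v′ R.≈ s R.* value φᴿ w′ R.+ a₂₊ j R.* value φᴿ w
    differentiate j v w e = (λ i → D₁ (v i)) , (λ i → D₁ (w i)) , (begin
      a₁ R.* value φᴿ (λ i → D₁ (v i))
        ≈⟨ R.*-congˡ (D₂-value R-characteristic2 (coeff φ) v) ⟨
      a₁ R.* D₂ (value φᴿ v)
        -- The two zero terms are what the product rule leaves from the derivatives of the constant
        -- `a₁`.
        ≈⟨ solve 4 (λ a u w z → a :* u := (a :* u :+ con 0 :* w) :+ con 0 :* z) R.refl
             a₁ (D₂ (value φᴿ v)) (value φᴿ v) (D₁ (value φᴿ v)) ⟩
      D₂ (a₁ R.* value φᴿ v)
        ≈⟨ D₂-cong e ⟩
      (s R.* D₂ (value φᴿ w) R.+ D₂ s R.* value φᴿ w) R.+ D₁ s R.* D₁ (value φᴿ w)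
        ≈⟨ R.+-cong (R.+-cong (R.*-congˡ (D₂-value R-characteristic2 (coeff φ) w)) (R.*-congʳ D₂-s))
             (R.trans (R.*-congʳ (D₁-value R-characteristic2 a₀₂₊ (R.1# ∷ var))) (R.zeroˡ _)) ⟩
      (s R.* value φᴿ (λ i → D₁ (w i)) R.+ a₂₊ j R.* value φᴿ w) R.+ R.0#
        ≈⟨ R.+-identityʳ _ ⟩
      s R.* value φᴿ (λ i → D₁ (w i)) R.+ a₂₊ j R.* value φᴿ w ∎)
      where
      open HasseDerivatives F m j
      open SemiringSolver R.commutativeSemiring
      open SetoidReasoning R.setoid
      a₀₂₊ : Vector F.Carrier (suc m)
      a₀₂₊ = coeff φ zero ∷ (λ i → coeff φ (suc (suc i)))
      D₂-s : D₂ s R.≈ a₂₊ j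
      D₂-s = begin
        D₂ s
          ≈⟨ D₂-value R-characteristic2 a₀₂₊ (R.1# ∷ var) ⟩
        a₀ R.* (R.0# R.* R.0#) R.+ value {K = R} ⟨ a₂₊ ⟩ (λ i → const (unitVector j i))
          ≈⟨ R.+-cong (R.trans (R.*-congˡ (R.zeroˡ R.0#)) (R.zeroʳ a₀))
               (R.sym (Homomorphism.value-homo F R (const-homo F m) ψ (unitVector j))) ⟩
        R.0# R.+ const (value ψ (unitVector j))
          ≈⟨ R.+-identityˡ _ ⟩
        const (value ψ (unitVector j))
          ≈⟨ Polynomials.const-cong (value-unitVector ψ j) ⟩
        a₂₊ j ∎
        where
        open CommutativeRingProperties F
        ψ : Form F m
        ψ = ⟨ (λ i → coeff φ (suc (suc i))) ⟩

    open AdjoinVariable F m using (weaken; weaken-homo; x₀)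

    -- The chart coordinate with coefficient `a₁` is the one that plays the part of `t`; all other
    -- summands come from `R`.
    h≈ : h P.≈ weaken s P.+ const (coeff φ (suc zero)) P.* (x₀ P.* x₀)
    h≈ = P.trans (solve 3 (λ a b c → a :+ (b :+ c) := (a :+ c) :+ b) P.refl
             (const (coeff φ zero)) (const (coeff φ (suc zero)) P.* (x₀ P.* x₀))
             (value {K = P} ⟨ (λ i → const (coeff φ (suc (suc i)))) ⟩ (λ i → var (suc i))))
      (P.+-congʳ (P.sym (P.trans (Homomorphism.value-homo R P weaken-homo ⟨ a₀ ∷ a₂₊ ⟩ (R.1# ∷ var))
        (P.+-congʳ (P.trans (P.*-congˡ (P.*-identityˡ P.1#)) (P.*-identityʳ _))))))
      where open SemiringSolver P.commutativeSemiring

    P-characteristic2 : HasCharacteristic2 P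
    P-characteristic2 = Homomorphism.characteristic2-homo F P (const-homo F (suc m)) 1+1≈0

    module E = Elimination R P P-characteristic2 weaken weaken-homo x₀ h s a₁ (const a₁⁻¹)
      a₁⁻¹a₁≈1ᴿ h≈

    reducible : ∀ p → E.Reducible p
    reducible (const a)             = E.reducible-weaken (const a)
    reducible (var zero)            = E.reducible-x₀
    reducible (var (suc i))         = E.reducible-weaken (var i)
    reducible (p Polynomials.+ p′)  = E.reducible-+ (reducible p) (reducible p′)
    reducible (p Polynomials.* p′)  = E.reducible-* (reducible p) (reducible p′)
    reducible (Polynomials.- p)     = E.reducible-neg (reducible p)

  module ViaQuadraticExtension {c₂ ℓ₂} (B : CommutativeRing c₂ ℓ₂) (extension : IsQuadraticExtension R q B) where
    private
      module B = CommutativeRing B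
      open IsQuadraticExtension extension
      module X = Extension B extension
      module Reduction = Evaluation F {suc m} B
        (Composition.isRingHomomorphism B.trans (const-homo F m) embed-homo) (√q ∷ (λ i → embed (var i)))

      ρ-weaken : ∀ p → Reduction.eval (weaken p) B.≈ embed p
      ρ-weaken = homomorphism-unique F B
        (Composition.isRingHomomorphism B.trans weaken-homo Reduction.eval-homo) embed-homo
        (λ a → B.refl {embed (const a)}) (λ i → B.refl {embed (var i)})

      module I = E.Isomorphism reducible B embed embed-homo √q √q-square
        (λ y → re y , im y , decomposition y) join-≈0
        Reduction.eval Reduction.eval-homo ρ-weaken B.refl

      module T = Transport (FunctionField.coordinateRing φ) B Reduction.eval I.ρ-homoᴬ I.σ I.ρ-injective I.ρσ

    isIntegral : IsIntegral (FunctionField.coordinateRing φ)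
    isIntegral = T.isIntegral X.isIntegral

    isotropyDerivation : IsotropyDerivation {R = FunctionField.coordinateRing φ} ⟨ (λ i → const (coeff φ i)) ⟩
    isotropyDerivation = T.isotropyDerivation ⟨ (λ i → const (coeff φ i)) ⟩ (X.isotropyDerivation differentiate)

    -- An equation `1 = 0` would pass to `B`, from there to `R`, and by evaluation at the origin to
    -- `F`.
    nontrivial : ¬ (A.1# A.≈ A.0#)
    nontrivial e = 1≉0 (eval-cong (embed-≈0 (B.trans embed-1 (B.trans (ρᴬ.⟦⟧-cong e) ρᴬ.0#-homo))))
      where
      module ρᴬ = IsRingHomomorphism I.ρ-homoᴬ
      open Evaluation F F (Identity.isRingHomomorphism F.rawRing F.refl) (λ (i : Fin m) → F.0#)
      embed-1 : embed R.1# B.≈ Reduction.eval A.1#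
      embed-1 = B.refl

  coordinateRing-characteristic2 : HasCharacteristic2 (FunctionField.coordinateRing φ)
  coordinateRing-characteristic2 =
    Homomorphism.characteristic2-homo P (FunctionField.coordinateRing φ) E.quotient-homo P-characteristic2

  open QuadraticExtension R q using (quadraticExtension; isQuadraticExtension)

  coordinateRing-isIntegral : IsIntegral (FunctionField.coordinateRing φ)
  coordinateRing-isIntegral = ViaQuadraticExtension.isIntegral quadraticExtension isQuadraticExtension

  coordinateRing-1≉0 : ¬ (A.1# A.≈ A.0#)
  coordinateRing-1≉0 = ViaQuadraticExtension.nontrivial quadraticExtension isQuadraticExtension

  coordinateRing-isotropyDerivation :
    IsotropyDerivation {R = FunctionField.coordinateRing φ} ⟨ (λ i → const (coeff φ i)) ⟩
  coordinateRing-isotropyDerivation =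
    ViaQuadraticExtension.isotropyDerivation quadraticExtension isQuadraticExtension

-- Fraction fields and the clearing of denominators

module FractionField (A : CommutativeRing c ℓ) where
  open CommutativeRing A hiding (zero)
  open SemiringSolver commutativeSemiring
  open SetoidReasoning setoid
  open Fractions A
  private
    K = fractionRing
    module K = CommutativeRing K

  fromBase-homo : IsHomomorphism A K fromBase
  fromBase-homo = isHomomorphism A K fromBase
    (λ e → cross (*-congʳ e))
    (λ x y → cross (begin
      (x + y) * (1# * 1#)          ≈⟨ *-assoc _ _ _ ⟨
      (x + y) * 1# * 1#            ≈⟨ *-congʳ (distribʳ 1# x y) ⟩
      (x * 1# + y * 1#) * 1#       ∎))
    (λ x y → cross (*-congˡ (*-identityˡ 1#)))
    K.refl

  fromBase-injective : ∀ {x y} → fromBase x K.≈ fromBase y → x ≈ y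
  fromBase-injective (cross e) = trans (sym (*-identityʳ _)) (trans e (*-identityʳ _))

  fromBase-regular : ∀ {d} → Regular d → ∀ x → x K.* fromBase d K.≈ K.0# → x K.≈ K.0#
  fromBase-regular {d} d-regular (p / e ∣ _) (cross eq) = cross (trans (*-identityʳ p)
    (trans (d-regular p (begin
      d * p               ≈⟨ *-comm d p ⟩
      p * d               ≈⟨ *-identityʳ _ ⟨
      (p * d) * 1#        ≈⟨ eq ⟩
      0# * (e * 1#)       ≈⟨ zeroˡ _ ⟩
      0#                  ∎)) (sym (zeroˡ e))))

  commonDenominator : ∀ {n} (v : Vector K.Carrier n) →
    ∃₂ λ d (p : Vector Carrier n) → Regular d × (∀ i → v i K.* fromBase d K.≈ fromBase (p i))
  commonDenominator {zero}  v = 1# , [] , (λ x e → trans (sym (*-identityˡ x)) e) , λ ()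
  commonDenominator {suc n} v with commonDenominator (tail v)
  ... | d , p , r , e =
    d₀ * d , (p₀ * d) ∷ (λ i → d₀ * p i) ,
    (λ x z → r x (r₀ (d * x) (trans (sym (*-assoc d₀ d x)) z))) ,
    λ { zero    → cross
          (solve 4 (λ p₀ d₀ d o → (p₀ :* (d₀ :* d)) :* o := (p₀ :* d) :* (d₀ :* o)) refl p₀ d₀ d 1#)
      ; (suc i) → step (v (suc i)) (p i) (e i) }
    where
    p₀ = num (v zero)
    d₀ = den (v zero)
    r₀ = regular (v zero)
    step : ∀ {d₀ d} x p → x K.* fromBase d K.≈ fromBase p → x K.* fromBase (d₀ * d) K.≈ fromBase (d₀ * p)
    step {d₀} {d} (a / b ∣ _) p (cross e) = cross (begin
      (a * (d₀ * d)) * 1#   ≈⟨ solve 4 (λ a d₀ d o → (a :* (d₀ :* d)) :* o := d₀ :* ((a :* d) :* o)) refl a d₀ d 1# ⟩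
      d₀ * ((a * d) * 1#)   ≈⟨ *-congˡ e ⟩
      d₀ * (p * (b * 1#))   ≈⟨ *-assoc _ _ _ ⟨
      (d₀ * p) * (b * 1#)   ∎)

  -- Over a domain a nonzero numerator is regular, hence admissible as a denominator.
  isField : IsIntegral A → ¬ (1# ≈ 0#) → IsField K
  isField A-integral 1≉0 = record
    { 1≉0 = λ e → 1≉0 (fromBase-injective e)
    ; inverse = λ (p / d ∣ r) x≉0 →
        let p≉0 : ¬ (p ≈ 0#)
            p≉0 p≈0 = x≉0 (cross (trans (*-identityʳ p) (trans p≈0 (sym (zeroˡ d)))))
        in (d / p ∣ λ y e → Sum.[ (λ p≈0 → ⊥-elim (p≉0 p≈0)) , id ] (A-integral p y e)) ,
           cross (trans (*-identityʳ _) (trans (*-comm p d) (sym (*-identityˡ _))))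
    }

module ClearDenominators (A : CommutativeRing c₁ ℓ₁) (K : CommutativeRing c₂ ℓ₂)
  (A-characteristic2 : HasCharacteristic2 A)
  (ι : CommutativeRing.Carrier A → CommutativeRing.Carrier K) (ι-homo : IsHomomorphism A K ι)
  (ι-injective : ∀ {x y} → CommutativeRing._≈_ K (ι x) (ι y) → CommutativeRing._≈_ A x y)
  (commonDenominator : ∀ {n} (v : Vector (CommutativeRing.Carrier K) n) →
    ∃₂ λ d (p : Vector (CommutativeRing.Carrier A) n) → (∀ x → CommutativeRing._≈_ K (CommutativeRing._*_ K x (ι d)) (CommutativeRing.0# K) →
                      CommutativeRing._≈_ K x (CommutativeRing.0# K)) ×
               (∀ i → CommutativeRing._≈_ K (CommutativeRing._*_ K (v i) (ι d)) (ι (p i))))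
  {n : ℕ} (φ : Form A n) (derivation : IsotropyDerivation φ) where

  private
    module A = CommutativeRing A
    module K = CommutativeRing K
    module ι = IsRingHomomorphism ι-homo
    module ιᵛ = Homomorphism A K ι-homo
    module Aₚ = CommutativeRingProperties A
    module Kₚ = CommutativeRingProperties K
    module A₂ = Characteristic2 A A-characteristic2
    module Lᴬ = LinearAlgebra A
    module Lᴷ = LinearAlgebra K
  open IsotropyDerivation derivation

  φᴷ : Form K n
  φᴷ = ⟨ (λ i → ι (coeff φ i)) ⟩

  ι-≈0 : ∀ {x} → ι x K.≈ K.0# → x A.≈ A.0#
  ι-≈0 e = ι-injective (K.trans e (K.sym ι.0#-homo))

  -- The second summand measures how far `∂` is from being linear. It is a combination of the
  -- vectors `p j` themselves, so it is isotropic as soon as they are.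
  ∂-linearCombination : ∀ {d} (g : Vector A.Carrier d) p (i : Fin n) →
    ∂ (Lᴬ.linearCombination g p i) A.≈
    Lᴬ.linearCombination g (λ j i → ∂ (p j i)) i A.+ Lᴬ.linearCombination (λ j → ∂ (g j)) p i
  ∂-linearCombination {zero}  g p i = begin
    ∂ A.0#                    ≈⟨ x+x≈x⇒x≈0 (∂ A.0#) (A.trans (A.sym (∂-+ A.0# A.0#)) (∂-cong (A.+-identityˡ A.0#))) ⟩
    A.0#                      ≈⟨ A.+-identityˡ A.0# ⟨
    A.0# A.+ A.0#             ∎
    where
    open SetoidReasoning A.setoid
    open RingProperties A.ring
  ∂-linearCombination {suc d} g p i = begin
    ∂ (g₀ A.* p₀ A.+ rest)
      ≈⟨ A.trans (∂-+ _ _) (A.+-cong (∂-* g₀ p₀) (∂-linearCombination (tail g) (tail p) i)) ⟩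
    (g₀ A.* ∂ p₀ A.+ p₀ A.* ∂ g₀) A.+ (rest₁ A.+ rest₂)
      ≈⟨ solve 6 (λ g p ∂g ∂p u v → (g :* ∂p :+ p :* ∂g) :+ (u :+ v) := (g :* ∂p :+ u) :+ (∂g :* p :+ v))
           A.refl g₀ p₀ (∂ g₀) (∂ p₀) rest₁ rest₂ ⟩
    (g₀ A.* ∂ p₀ A.+ rest₁) A.+ (∂ g₀ A.* p₀ A.+ rest₂) ∎
    where
    open SetoidReasoning A.setoid
    open SemiringSolver A.commutativeSemiring
    g₀ = head g
    p₀ = head p i
    rest = Lᴬ.linearCombination (tail g) (tail p) i
    rest₁ = Lᴬ.linearCombination (tail g) (λ j i → ∂ (tail p j i)) i
    rest₂ = Lᴬ.linearCombination (λ j → ∂ (tail g j)) (tail p) i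

  -- With wⱼ scaled to have its coordinates in A, κⱼ is the scalar φ(∂ wⱼ) / a₁.
  multipliers : ∀ {d} (w : Vector (Vector K.Carrier n) d) → Lᴷ.LinearlyIndependent w →
    (∀ j → value φᴷ (w j) K.≈ K.0#) →
    ∃ λ (κ : Vector K.Carrier d) →
      (∀ j i → Represents φᴷ (coeff φᴷ i K.* κ j)) ×
      (∀ (f : Vector K.Carrier d) → Lᴷ.sum (λ j → (f j K.* f j) K.* κ j) K.≈ K.0# → ∀ j → f j K.≈ K.0#)
  multipliers {d} w w-independent w-isotropic = κ , represented , independent
    where
    den : Fin d → A.Carrier
    den j = proj₁ (commonDenominator (w j))
    p : Vector (Vector A.Carrier n) d
    p j = proj₁ (proj₂ (commonDenominator (w j)))
    den-regular : ∀ j x → x K.* ι (den j) K.≈ K.0# → x K.≈ K.0#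
    den-regular j = proj₁ (proj₂ (proj₂ (commonDenominator (w j))))
    w-den : ∀ j i → w j i K.* ι (den j) K.≈ ι (p j i)
    w-den j = proj₂ (proj₂ (proj₂ (commonDenominator (w j))))

    p-isotropic : ∀ j → value φ (p j) A.≈ A.0#
    p-isotropic j = ι-≈0 (begin
      ι (value φ (p j))                                  ≈⟨ ιᵛ.value-homo φ (p j) ⟩
      value φᴷ (λ i → ι (p j i))
        ≈⟨ Kₚ.value-cong φᴷ (λ i → K.trans (K.*-comm _ _) (w-den j i)) ⟨
      value φᴷ (λ i → ι (den j) K.* w j i)               ≈⟨ Kₚ.value-* φᴷ (ι (den j)) (w j) ⟩
      (ι (den j) K.* ι (den j)) K.* value φᴷ (w j)       ≈⟨ K.*-congˡ (w-isotropic j) ⟩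
      (ι (den j) K.* ι (den j)) K.* K.0#                 ≈⟨ K.zeroʳ _ ⟩
      K.0#                                               ∎)
      where open SetoidReasoning K.setoid

    κᴬ : Vector A.Carrier d
    κᴬ j = scale A.* value φ (λ i → ∂ (p j i))

    κ : Vector K.Carrier d
    κ j = ι (κᴬ j)

    represented : ∀ j i → Represents φᴷ (coeff φᴷ i K.* κ j)
    represented j i with multiplier (p j) (p-isotropic j) i
    ... | v , e = (λ i → ι (v i)) , K.trans (K.sym (ιᵛ.value-homo φ v))
      (K.trans (ι.⟦⟧-cong e) (ι.*-homo _ _))

    independent : ∀ (f : Vector K.Carrier d) → Lᴷ.sum (λ j → (f j K.* f j) K.* κ j) K.≈ K.0# → ∀ j → f j K.≈ K.0#
    -- Two denominators are cleared: `e` brings the coefficients `f` to `g` over `A`, and `den j`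
    -- brings `w j` to `p j`. The relation then has to be found for `u = Σ g j p j`.
    independent f f-relation j = e-regular (f j) (den-regular j (f j K.* ι e)
      (w-independent (λ j → (f j K.* ι e) K.* ι (den j)) w-relation j))
      where
      e : A.Carrier
      e = proj₁ (commonDenominator f)
      g : Vector A.Carrier d
      g = proj₁ (proj₂ (commonDenominator f))
      e-regular : ∀ x → x K.* ι e K.≈ K.0# → x K.≈ K.0#
      e-regular = proj₁ (proj₂ (proj₂ (commonDenominator f)))
      f-e : ∀ j → f j K.* ι e K.≈ ι (g j)
      f-e = proj₂ (proj₂ (proj₂ (commonDenominator f)))

      u : Vector A.Carrier n
      u = Lᴬ.linearCombination g p

      ∂p : Vector (Vector A.Carrier n) d
      ∂p j i = ∂ (p j i)

      κᴬ-relation : Lᴬ.sum (λ j → (g j A.* g j) A.* κᴬ j) A.≈ A.0#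
      κᴬ-relation = ι-≈0 (begin
        ι (Lᴬ.sum (λ j → (g j A.* g j) A.* κᴬ j))
          ≈⟨ ιᵛ.sum-homo (λ j → (g j A.* g j) A.* κᴬ j) ⟩
        Lᴷ.sum (λ j → ι ((g j A.* g j) A.* κᴬ j))
          ≈⟨ Kₚ.sum-cong-≋ (λ j → K.trans (ι.*-homo _ _) (K.*-congʳ (K.trans (ι.*-homo _ _)
               (K.sym (K.*-cong (f-e j) (f-e j)))))) ⟩
        Lᴷ.sum (λ j → ((f j K.* ι e) K.* (f j K.* ι e)) K.* κ j)
          ≈⟨ Kₚ.sum-cong-≋ (λ j → solve 3 (λ f e k → ((f :* e) :* (f :* e)) :* k := (e :* e) :* ((f :* f) :* k))
               K.refl (f j) (ι e) (κ j)) ⟩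
        Lᴷ.sum (λ j → (ι e K.* ι e) K.* ((f j K.* f j) K.* κ j))
          ≈⟨ Kₚ.*-distribˡ-sum (ι e K.* ι e) (λ j → (f j K.* f j) K.* κ j) ⟨
        (ι e K.* ι e) K.* Lᴷ.sum (λ j → (f j K.* f j) K.* κ j)
          ≈⟨ K.*-congˡ f-relation ⟩
        (ι e K.* ι e) K.* K.0#   ≈⟨ K.zeroʳ _ ⟩
        K.0# ∎)
        where
        open SetoidReasoning K.setoid
        open SemiringSolver K.commutativeSemiring

      value-lc-∂p : value φ (Lᴬ.linearCombination g ∂p) A.≈ A.0#
      value-lc-∂p = begin
        value φ (Lᴬ.linearCombination g ∂p)
          ≈⟨ A₂.value-linearCombination φ g ∂p ⟩
        Lᴬ.sum (λ j → (g j A.* g j) A.* value φ (∂p j))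
          ≈⟨ Aₚ.sum-cong-≋ (λ j → A.trans
               (A.sym (A.trans (A.*-congʳ inverse) (A.*-identityˡ _)))
               (solve 4 (λ t s g v → (t :* s) :* (g :* v) := t :* (g :* (s :* v))) A.refl
                 scale⁻¹ scale (g j A.* g j) (value φ (∂p j)))) ⟩
        Lᴬ.sum (λ j → scale⁻¹ A.* ((g j A.* g j) A.* κᴬ j))
          ≈⟨ Aₚ.*-distribˡ-sum scale⁻¹ (λ j → (g j A.* g j) A.* κᴬ j) ⟨
        scale⁻¹ A.* Lᴬ.sum (λ j → (g j A.* g j) A.* κᴬ j)   ≈⟨ A.*-congˡ κᴬ-relation ⟩
        scale⁻¹ A.* A.0#                                    ≈⟨ A.zeroʳ _ ⟩
        A.0#                                                ∎
        where
        open SetoidReasoning A.setoid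
        open SemiringSolver A.commutativeSemiring

      value-lc-p : ∀ (g : Vector A.Carrier d) → value φ (Lᴬ.linearCombination g p) A.≈ A.0#
      value-lc-p g = begin
        value φ (Lᴬ.linearCombination g p)                ≈⟨ A₂.value-linearCombination φ g p ⟩
        Lᴬ.sum (λ j → (g j A.* g j) A.* value φ (p j))
          ≈⟨ Aₚ.sum-cong-≋ (λ j → A.trans (A.*-congˡ (p-isotropic j)) (A.zeroʳ _)) ⟩
        Lᴬ.sum {d} (λ _ → A.0#)                           ≈⟨ Aₚ.sum-replicate-zero d ⟩
        A.0#                                              ∎
        where open SetoidReasoning A.setoid

      value-∂u : value φ (λ i → ∂ (u i)) A.≈ A.0#
      -- Of the two parts of `∂ u`, the combination of the `∂ p j` is isotropic by the given
      -- relation among the `κ j`, the combination of the `p j` by their isotropy.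
      value-∂u = A.trans (Aₚ.value-cong φ (∂-linearCombination g p))
        (A.trans (A₂.value-+ φ (Lᴬ.linearCombination g ∂p) (Lᴬ.linearCombination (λ j → ∂ (g j)) p))
          (A.trans (A.+-cong value-lc-∂p (value-lc-p (λ j → ∂ (g j)))) (A.+-identityˡ A.0#)))

      u≈0 : ∀ i → u i A.≈ A.0#
      u≈0 = isotropic-∂-isotropic⇒0 u (value-lc-p g) value-∂u

      w-relation : ∀ i → Lᴷ.linearCombination (λ j → (f j K.* ι e) K.* ι (den j)) w i K.≈ K.0#
      w-relation i = begin
        Lᴷ.sum (λ j → ((f j K.* ι e) K.* ι (den j)) K.* w j i)
          ≈⟨ Kₚ.sum-cong-≋ (λ j → K.trans (K.*-assoc _ _ _) (K.trans
               (K.*-cong (f-e j) (K.trans (K.*-comm _ _) (w-den j i))) (K.sym (ι.*-homo _ _)))) ⟩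
        Lᴷ.sum (λ j → ι (g j A.* p j i))   ≈⟨ ιᵛ.sum-homo (λ j → g j A.* p j i) ⟨
        ι (u i)                            ≈⟨ ι.⟦⟧-cong (u≈0 i) ⟩
        ι A.0#                             ≈⟨ ι.0#-homo ⟩
        K.0#                               ∎
        where open SetoidReasoning K.setoid

-- Values of tensor products

module TensorProduct (R : CommutativeRing c ℓ) where
  open CommutativeRing R hiding (zero)
  open LinearAlgebra R
  open CommutativeRingProperties R
  open SemiringSolver commutativeSemiring
  open SetoidReasoning setoid

  sum-split : ∀ m {n} (t : Vector Carrier (m ℕ.+ n)) → sum t ≈ sum (λ i → t (i ↑ˡ n)) + sum (λ j → t (m ↑ʳ j))
  sum-split zero    t = sym (+-identityˡ _)
  sum-split (suc m) t = trans (+-congˡ (sum-split m (tail t))) (sym (+-assoc _ _ _))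

  sum-combine : ∀ m {n} (t : Vector Carrier (m ℕ.* n)) → sum t ≈ sum (λ i → sum (λ j → t (combine {m} {n} i j)))
  sum-combine zero        t = refl
  sum-combine (suc m) {n} t = trans (sum-split n t) (+-congˡ (sum-combine m (λ k → t (n ↑ʳ k))))

  tensorVector : ∀ {m n} → (Fin m → Vector Carrier n) → Vector Carrier (m ℕ.* n)
  tensorVector {m} {n} u k = uncurry u (remQuot {m} n k)

  tensorVector-combine : ∀ {m n} (u : Fin m → Vector Carrier n) i j → tensorVector u (combine i j) ≡ u i j
  tensorVector-combine u i j = ≡.cong (uncurry u) (Finₚ.remQuot-combine i j)

  module _ {m n} (φ : Form R m) (ψ : Form R n) where

    value-⊗ : ∀ v → value (φ ⊗ ψ) v ≈ sum (λ i → coeff φ i * value ψ (λ j → v (combine {m} {n} i j)))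
    value-⊗ v = begin
      sum (λ k → coeff (φ ⊗ ψ) k * (v k * v k))
        ≈⟨ sum-combine m {n} (λ k → coeff (φ ⊗ ψ) k * (v k * v k)) ⟩
      sum (λ i → sum (λ j → coeff (φ ⊗ ψ) (combine {m} {n} i j) * (v (combine {m} {n} i j) * v (combine {m} {n} i j))))
        ≈⟨ sum-cong-≋ {m} (λ i → begin
             sum (λ j → coeff (φ ⊗ ψ) (combine {m} {n} i j) * (v (combine {m} {n} i j) * v (combine {m} {n} i j)))
               ≈⟨ sum-cong-≋ {n} (λ j → trans (*-congʳ (reflexive (coeff-combine i j))) (*-assoc _ _ _)) ⟩
             sum (λ j → coeff φ i * (coeff ψ j * (v (combine {m} {n} i j) * v (combine {m} {n} i j))))
               ≈⟨ *-distribˡ-sum (coeff φ i) (λ j → coeff ψ j * (v (combine {m} {n} i j) * v (combine {m} {n} i j))) ⟨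
             coeff φ i * value ψ (λ j → v (combine {m} {n} i j)) ∎) ⟩
      sum (λ i → coeff φ i * value ψ (λ j → v (combine {m} {n} i j))) ∎
      where
      coeff-combine : ∀ i j → coeff (φ ⊗ ψ) (combine {m} {n} i j) ≡ coeff φ i * coeff ψ j
      coeff-combine i j = ≡.cong (λ p → coeff φ (proj₁ p) * coeff ψ (proj₂ p)) (Finₚ.remQuot-combine {m} {n} i j)

    -- The double sum taken by columns. In a divisibility the quasi-Pfister factor stands on the
    -- left, and this order of summation exhibits the value as a combination of its values.
    value-⊗ʳ : ∀ v → value (φ ⊗ ψ) v ≈ sum (λ j → coeff ψ j * value φ (λ i → v (combine {m} {n} i j)))
    value-⊗ʳ v = begin
      value (φ ⊗ ψ) v
        ≈⟨ value-⊗ v ⟩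
      sum (λ i → coeff φ i * value ψ (λ j → v (combine {m} {n} i j)))
        ≈⟨ sum-cong-≋ {m} (λ i → *-distribˡ-sum (coeff φ i) (λ j → coeff ψ j * (v (combine {m} {n} i j) * v (combine {m} {n} i j)))) ⟩
      sum (λ i → sum (λ j → coeff φ i * (coeff ψ j * (v (combine {m} {n} i j) * v (combine {m} {n} i j)))))
        ≈⟨ ∑-comm {m} {n} (λ i j → coeff φ i * (coeff ψ j * (v (combine {m} {n} i j) * v (combine {m} {n} i j)))) ⟩
      sum (λ j → sum (λ i → coeff φ i * (coeff ψ j * (v (combine {m} {n} i j) * v (combine {m} {n} i j)))))
        ≈⟨ sum-cong-≋ {n} (λ j → trans
             (sum-cong-≋ {m} (λ i → solve 3 (λ a b z → a :* (b :* z) := b :* (a :* z)) refl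
                            (coeff φ i) (coeff ψ j) (v (combine {m} {n} i j) * v (combine {m} {n} i j))))
             (sym (*-distribˡ-sum (coeff ψ j) (λ i → coeff φ i * (v (combine {m} {n} i j) * v (combine {m} {n} i j)))))) ⟩
      sum (λ j → coeff ψ j * value φ (λ i → v (combine {m} {n} i j))) ∎

    value-tensorVector : ∀ u → value (φ ⊗ ψ) (tensorVector u) ≈ sum (λ i → coeff φ i * value ψ (u i))
    value-tensorVector u = trans (value-⊗ (tensorVector u))
      (sum-cong-≋ (λ i → *-congˡ (value-cong ψ (λ j → reflexive (tensorVector-combine u i j)))))

    value-tensorVectorʳ : ∀ u → value (φ ⊗ ψ) (tensorVector u) ≈
                          sum (λ j → coeff ψ j * value φ (λ i → u i j))
    value-tensorVectorʳ u = trans (value-⊗ʳ (tensorVector u))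
      (sum-cong-≋ (λ j → *-congˡ (value-cong φ (λ i → reflexive (tensorVector-combine u i j)))))

  combine-≈0 : ∀ {m n} (v : Vector Carrier (m ℕ.* n)) → (∀ i j → v (combine {m} i j) ≈ 0#) → ∀ k → v k ≈ 0#
  combine-≈0 {m} {n} v v≈0 k =
    ≡.subst (λ k → v k ≈ 0#) (Finₚ.combine-remQuot {m} n k) (uncurry v≈0 (remQuot {m} n k))

-- Quasi-Pfister forms, multipliers and divisibility over a field

module ClassicalField {ℓ} (em : ExcludedMiddle ℓ) (K : CommutativeRing ℓ ℓ) (K-field : IsField K)
  (1+1≈0 : HasCharacteristic2 K) where
  open CommutativeRing K hiding (zero)
  open IsField K-field
  open LinearAlgebra K
  open CommutativeRingProperties K
  open Characteristic2 K 1+1≈0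
  open TensorProduct K
  open SemiringSolver commutativeSemiring

  x*y≈0⇒y≈0 : ∀ {x y} → ¬ (x ≈ 0#) → x * y ≈ 0# → y ≈ 0#
  x*y≈0⇒y≈0 {x} {y} x≉0 e with inverse x x≉0
  ... | x⁻¹ , xx⁻¹≈1 = begin
    y               ≈⟨ *-identityˡ y ⟨
    1# * y          ≈⟨ *-congʳ xx⁻¹≈1 ⟨
    (x * x⁻¹) * y   ≈⟨ solve 3 (λ x z y → (x :* z) :* y := z :* (x :* y)) refl x x⁻¹ y ⟩
    x⁻¹ * (x * y)   ≈⟨ *-congˡ e ⟩
    x⁻¹ * 0#        ≈⟨ zeroʳ x⁻¹ ⟩
    0#              ∎
    where open SetoidReasoning setoid

  ¬¬≈ : ∀ {x y} → ¬ ¬ (x ≈ y) → x ≈ y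
  ¬¬≈ {x} {y} nn with em {x ≈ y}
  ... | yes e = e
  ... | no ne = ⊥-elim (nn ne)

  -- Gaussian elimination: a coordinate at which the first vector is nonzero is cleared in the other
  -- vectors and then dropped. Excluded middle finds the pivot; without one the first vector would
  -- be zero.
  linearlyIndependent⇒≤ : ∀ {n d} (b : Vector (Vector Carrier n) d) → LinearlyIndependent b → d ≤ n
  linearlyIndependent⇒≤ {d = zero}          b ind = z≤n
  linearlyIndependent⇒≤ {zero}  {d = suc d} b ind = ⊥-elim (1≉0 (ind (λ _ → 1#) (λ ()) zero))
  linearlyIndependent⇒≤ {suc n} {d = suc d} b ind with em {∃ λ i → ¬ (head b i ≈ 0#)}
  ... | no none = ⊥-elim (1≉0 (ind (unitVector zero) (λ k → begin
      1# * head b k + sum (λ j → 0# * tail b j k)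
        ≈⟨ +-cong (trans (*-identityˡ _) (¬¬≈ (λ b≉0 → none (k , b≉0))))
             (trans (sum-cong-≋ (λ j → zeroˡ (tail b j k))) (sum-replicate-zero d)) ⟩
      0# + 0#   ≈⟨ +-identityˡ 0# ⟩
      0#        ∎) zero))
    where open SetoidReasoning setoid
  ... | yes (i , bᵢ≉0) with inverse (head b i) bᵢ≉0
  ...   | y , bᵢy≈1 = s≤s (linearlyIndependent⇒≤ b′ b′-independent)
    where
    open SetoidReasoning setoid
    eliminated : Fin d → Vector Carrier (suc n)
    eliminated j k = tail b j k + (tail b j i * y) * head b k
    b′ : Vector (Vector Carrier n) d
    b′ j l = eliminated j (punchIn i l)
    eliminated-i : ∀ j → eliminated j i ≈ 0#
    eliminated-i j = x≈y⇒x+y≈0 (begin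
      tail b j i                       ≈⟨ *-identityʳ _ ⟨
      tail b j i * 1#                  ≈⟨ *-congˡ bᵢy≈1 ⟨
      tail b j i * (head b i * y)      ≈⟨ solve 3 (λ t h y → t :* (h :* y) := (t :* y) :* h) refl (tail b j i) (head b i) y ⟩
      (tail b j i * y) * head b i      ∎)
    b′-independent : LinearlyIndependent b′
    b′-independent f rel j = ind (t ∷ f) relation (suc j)
      where
      t : Carrier
      -- The total multiple of the pivot vector that the elimination has added.
      t = sum (λ j → f j * (tail b j i * y))
      eliminated-relation : ∀ k → sum (λ j → f j * eliminated j k) ≈ 0#
      -- At the dropped coordinate every eliminated vector vanishes; the other coordinates are
      -- covered by `rel`.
      eliminated-relation k with i Finₚ.≟ k
      ... | yes ≡.refl = trans (sum-cong-≋ (λ j → trans (*-congˡ (eliminated-i j)) (zeroʳ (f j)))) (sum-replicate-zero d)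
      ... | no i≢k = ≡.subst (λ k → sum (λ j → f j * eliminated j k) ≈ 0#)
                       (Finₚ.punchIn-punchOut i≢k) (rel (punchOut i≢k))
      relation : ∀ k → t * head b k + sum (λ j → f j * tail b j k) ≈ 0#
      relation k = begin
        t * head b k + sum (λ j → f j * tail b j k)
          ≈⟨ +-congʳ (*-distribʳ-sum (head b k) (λ j → f j * (tail b j i * y))) ⟩
        sum (λ j → (f j * (tail b j i * y)) * head b k) + sum (λ j → f j * tail b j k)
          ≈⟨ ∑-distrib-+ (λ j → (f j * (tail b j i * y)) * head b k) (λ j → f j * tail b j k) ⟨
        sum (λ j → (f j * (tail b j i * y)) * head b k + f j * tail b j k)
          ≈⟨ sum-cong-≋ (λ j → solve 4 (λ f t h u → (f :* t) :* h :+ f :* u := f :* (u :+ t :* h)) refl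
               (f j) (tail b j i * y) (head b k) (tail b j k)) ⟩
        sum (λ j → f j * eliminated j k)
          ≈⟨ eliminated-relation k ⟩
        0# ∎

  -- Anisotropic forms are classified by their values: x ↦ the unique w with ψ(w) = φ(x) is linear.
  sameValues⇒≃ : ∀ {m n} (φ : Form K m) (ψ : Form K n) → HasNoIsotropicVector φ → HasNoIsotropicVector ψ →
                 (∀ v → Represents ψ (value φ v)) → (∀ w → Represents φ (value ψ w)) → φ ≃ ψ
  sameValues⇒≃ {m} {n} φ ψ φ-aniso ψ-aniso φ⊆ψ ψ⊆φ = f , record
    { isLeftModuleMonomorphism = record
      { isLeftModuleHomomorphism = record
        { +ᴹ-isGroupHomomorphism = record
          { isMonoidHomomorphism = record
            { isMagmaHomomorphism = record
              { isRelHomomorphism = record { cong = f-cong }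
              ; homo = λ v w → ψ-injective (begin
                  value ψ (f (λ i → v i + w i))      ≈⟨ f-value _ ⟩
                  value φ (λ i → v i + w i)          ≈⟨ value-+ φ v w ⟩
                  value φ v + value φ w              ≈⟨ +-cong (f-value v) (f-value w) ⟨
                  value ψ (f v) + value ψ (f w)      ≈⟨ value-+ ψ (f v) (f w) ⟨
                  value ψ (λ i → f v i + f w i)      ∎)
              }
            ; ε-homo = f-0
            }
          ; ⁻¹-homo = λ v → ψ-injective (begin
              value ψ (f (λ i → - v i))              ≈⟨ f-value _ ⟩
              value φ (λ i → - v i)                  ≈⟨ value-cong φ (λ i → -x≈x (v i)) ⟩
              value φ v                              ≈⟨ f-value v ⟨
              value ψ (f v)                          ≈⟨ value-cong ψ (λ i → -x≈x (f v i)) ⟨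
              value ψ (λ i → - f v i)                ∎)
          }
        ; *ₗ-homo = λ x v → ψ-injective (begin
            value ψ (f (λ i → x * v i))              ≈⟨ f-value _ ⟩
            value φ (λ i → x * v i)                  ≈⟨ value-* φ x v ⟩
            (x * x) * value φ v                      ≈⟨ *-congˡ (f-value v) ⟨
            (x * x) * value ψ (f v)                  ≈⟨ value-* ψ x (f v) ⟨
            value ψ (λ i → x * f v i)                ∎)
        }
      ; injective = λ {v} {w} e → injective φ φ-aniso (begin
          value φ v       ≈⟨ f-value v ⟨
          value ψ (f v)   ≈⟨ value-cong ψ e ⟩
          value ψ (f w)   ≈⟨ f-value w ⟩
          value φ w       ∎)
      }
    ; surjective = λ w → proj₁ (ψ⊆φ w) , λ {v} v≈ → ψ-injective (begin
        value ψ (f v)             ≈⟨ f-value v ⟩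
        value φ v                 ≈⟨ value-cong φ v≈ ⟩
        value φ (proj₁ (ψ⊆φ w))   ≈⟨ proj₂ (ψ⊆φ w) ⟩
        value ψ w                 ∎)
    } , f-value
    where
    open SetoidReasoning setoid
    f : Vector Carrier m → Vector Carrier n
    f v = proj₁ (φ⊆ψ v)
    f-value : ∀ v → value ψ (f v) ≈ value φ v
    f-value v = proj₂ (φ⊆ψ v)
    injective : ∀ {k} (χ : Form K k) → HasNoIsotropicVector χ → ∀ {v w} → value χ v ≈ value χ w → v ≈ᵛ w
    injective χ χ-aniso {v} {w} e i = x+y≈0⇒x≈y
      (χ-aniso (λ i → v i + w i) (trans (value-+ χ v w) (x≈y⇒x+y≈0 e)) i)
    ψ-injective : ∀ {v w} → value ψ v ≈ value ψ w → v ≈ᵛ w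
    ψ-injective = injective ψ ψ-aniso
    f-cong : ∀ {v w} → v ≈ᵛ w → f v ≈ᵛ f w
    f-cong {v} {w} e = ψ-injective (trans (f-value v) (trans (value-cong φ e) (sym (f-value w))))
    f-0 : f (λ _ → 0#) ≈ᵛ (λ _ → 0#)
    f-0 = ψ-injective (trans (f-value _) (trans (value-0 φ) (sym (value-0 ψ))))
    -x≈x : ∀ x → - x ≈ x
    -x≈x x = x+y≈0⇒x≈y (-‿inverseˡ x)

  IsMultiplier : ∀ {n} → Form K n → Carrier → Set ℓ
  IsMultiplier φ x = ∀ y → Represents φ y → Represents φ (x * y)

  ⟪_⟫ : ∀ {s} → Vector Carrier s → Form K (2 ℕ.^ s)
  ⟪ a ⟫ = quasiPfister a

  value-⟨1,_⟩⊗ : ∀ x {n} (ψ : Form K n) v → value (⟨ 1# ∷ x ∷ [] ⟩ ⊗ ψ) v ≈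
    value ψ (λ j → v (combine {2} zero j)) + x * value ψ (λ j → v (combine {2} (suc zero) j))
  value-⟨1, x ⟩⊗ ψ v = trans (value-⊗ ⟨ 1# ∷ x ∷ [] ⟩ ψ v)
    (+-cong (*-identityˡ _) (+-identityʳ _))

  represents-⟨1,_⟩⊗ : ∀ x {n} (ψ : Form K n) {y z} → Represents ψ y → Represents ψ z →
                      Represents (⟨ 1# ∷ x ∷ [] ⟩ ⊗ ψ) (y + x * z)
  represents-⟨1, x ⟩⊗ ψ (v , e) (w , e′) = tensorVector {2} (v ∷ w ∷ []) , trans
    (value-tensorVector ⟨ 1# ∷ x ∷ [] ⟩ ψ (v ∷ w ∷ []))
    (+-cong (trans (*-identityˡ _) e) (trans (+-identityʳ _) (*-congˡ e′)))

  -- In `(x + a y) (x′ + a y′) = (x x′ + a² y y′) + a (x y′ + y x′)` the factor `a²` is a square, so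
  -- both brackets are again values of the tail.
  quasiPfister-* : ∀ {s} (a : Vector Carrier s) {x y} → Represents ⟪ a ⟫ x →
                   Represents ⟪ a ⟫ y → Represents ⟪ a ⟫ (x * y)
  quasiPfister-* {zero} a (v , e) (w , e′) = (λ i → v i * w i) , trans
    (trans (+-identityʳ _) (trans (*-identityˡ _)
      (solve 2 (λ v w → (v :* w) :* (v :* w) := (v :* v) :* (w :* w)) refl (v zero) (w zero))))
    (*-cong (trans (sym (trans (+-identityʳ _) (*-identityˡ _))) e)
            (trans (sym (trans (+-identityʳ _) (*-identityˡ _))) e′))
  quasiPfister-* {suc s} a (v , e) (w , e′) = represents-≈ ⟪ a ⟫
    (trans
      (solve 5 (λ a x y x′ y′ →
          (x :* x′ :+ (a :* a) :* (y :* y′)) :+ a :* (x :* y′ :+ y :* x′) :=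
          (x :+ a :* y) :* (x′ :+ a :* y′)) refl (head a) (value ψ v₀) (value ψ v₁) (value ψ w₀) (value ψ w₁))
      (*-cong (trans (sym (value-⟨1, head a ⟩⊗ ψ v)) e) (trans (sym (value-⟨1, head a ⟩⊗ ψ w)) e′)))
    (represents-⟨1, head a ⟩⊗ ψ
      (represents-+ ψ v₀w₀ (represents-* ψ (head a) v₁w₁))
      (represents-+ ψ v₀w₁ v₁w₀))
    where
    ψ = ⟪ tail a ⟫
    v₀ = λ j → v (combine {2} zero j)
    v₁ = λ j → v (combine {2} (suc zero) j)
    w₀ = λ j → w (combine {2} zero j)
    w₁ = λ j → w (combine {2} (suc zero) j)
    v₀w₀ = quasiPfister-* (tail a) (v₀ , refl) (w₀ , refl)
    v₀w₁ = quasiPfister-* (tail a) (v₀ , refl) (w₁ , refl)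
    v₁w₀ = quasiPfister-* (tail a) (v₁ , refl) (w₀ , refl)
    v₁w₁ = quasiPfister-* (tail a) (v₁ , refl) (w₁ , refl)

  quasiPfister-1 : ∀ {s} (a : Vector Carrier s) → Represents ⟪ a ⟫ 1#
  quasiPfister-1 {zero}  a = (λ _ → 1#) , trans (+-identityʳ _) (trans (*-identityˡ _) (*-identityˡ 1#))
  quasiPfister-1 {suc s} a = represents-≈ ⟪ a ⟫
    (trans (+-congˡ (zeroʳ (head a))) (+-identityʳ 1#))
    (represents-⟨1, head a ⟩⊗ ψ (quasiPfister-1 (tail a)) ((λ _ → 0#) , value-0 ψ))
    where ψ = ⟪ tail a ⟫

  -- Multipliers include all squares and are closed under sums and products, and the values of
  -- `⟪ a ⟫` are built in this way from squares and the `a i`.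
  quasiPfister-isMultiplier : ∀ {n} (φ : Form K n) {s} (a : Vector Carrier s) →
    (∀ i → IsMultiplier φ (a i)) → ∀ {x} → Represents ⟪ a ⟫ x → IsMultiplier φ x
  quasiPfister-isMultiplier φ {zero}  a a-mult (v , e) y y∈φ = represents-≈ φ
    (*-congʳ (trans (sym (trans (+-identityʳ _) (*-identityˡ _))) e)) (represents-* φ (v zero) y∈φ)
  quasiPfister-isMultiplier φ {suc s} a a-mult (v , e) y y∈φ = represents-≈ φ
    (trans (solve 4 (λ a u w y → u :* y :+ a :* (w :* y) := (u :+ a :* w) :* y) refl
             (head a) (value ψ v₀) (value ψ v₁) y)
      (*-congʳ (trans (sym (value-⟨1, head a ⟩⊗ ψ v)) e)))
    (represents-+ φ (tail-mult (v₀ , refl) y y∈φ) (a-mult zero _ (tail-mult (v₁ , refl) y y∈φ)))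
    where
    ψ = ⟪ tail a ⟫
    v₀ = λ j → v (combine {2} zero j)
    v₁ = λ j → v (combine {2} (suc zero) j)
    tail-mult : ∀ {x} → Represents ψ x → IsMultiplier φ x
    tail-mult = quasiPfister-isMultiplier φ (tail a) (λ i → a-mult (suc i))

  -- The values of ψ form a field, so that y = x z with y and z ≠ 0 values of ψ makes x one.
  represents-quotient : ∀ {s} (a : Vector Carrier s) → let ψ = ⟪ a ⟫ in
    ∀ {n} (χ : Form K n) → (∀ x → Represents ψ x → IsMultiplier χ x) →
    ∀ x {y z} → Represents χ y → Represents ψ z → ¬ (z ≈ 0#) → y ≈ x * z → Represents χ x
  represents-quotient a χ ψχ⊆χ x {y} {z} y∈χ z∈ψ z≉0 y≈xz with inverse z z≉0
  ... | z⁻¹ , zz⁻¹≈1 = represents-≈ χ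
    (begin
      ((z⁻¹ * z⁻¹) * z) * y
        ≈⟨ *-congˡ y≈xz ⟩
      ((z⁻¹ * z⁻¹) * z) * (x * z)
        ≈⟨ solve 3 (λ i z x → ((i :* i) :* z) :* (x :* z) := ((z :* i) :* (z :* i)) :* x) refl z⁻¹ z x ⟩
      ((z * z⁻¹) * (z * z⁻¹)) * x
        ≈⟨ *-congʳ (*-cong zz⁻¹≈1 zz⁻¹≈1) ⟩
      (1# * 1#) * x
        ≈⟨ trans (*-congʳ (*-identityˡ 1#)) (*-identityˡ x) ⟩
      x ∎)
    (ψχ⊆χ _ (represents-* ⟪ a ⟫ z⁻¹ z∈ψ) y y∈χ)
    where open SetoidReasoning setoid

  -- An isotropic pair satisfies `ψ(v₀) = x ψ(v₁)`. If `ψ(v₁)` were nonzero, `x` would be a quotient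
  -- of values of `ψ`, hence a value.
  quasiPfister-extend : ∀ {s} (a : Vector Carrier s) x → HasNoIsotropicVector ⟪ a ⟫ →
    ¬ Represents ⟪ a ⟫ x → HasNoIsotropicVector ⟪ x ∷ a ⟫
  quasiPfister-extend a x ψ-aniso x∉ψ v e = combine-≈0 {2} v λ
    { zero       → ψ-aniso v₀ (trans (sym (trans (+-congˡ (trans (*-congˡ v₁-isotropic) (zeroʳ x))) (+-identityʳ _)))
                                 (trans (sym (value-⟨1, x ⟩⊗ ψ v)) e))
    ; (suc zero) → ψ-aniso v₁ v₁-isotropic }
    where
    ψ = ⟪ a ⟫
    v₀ = λ j → v (combine {2} zero j)
    v₁ = λ j → v (combine {2} (suc zero) j)
    v₁-isotropic : value ψ v₁ ≈ 0#
    v₁-isotropic = ¬¬≈ λ ψv₁≉0 → x∉ψ (represents-quotient a ψ (λ y y∈ψ z z∈ψ → quasiPfister-* a y∈ψ z∈ψ) x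
      (v₀ , refl) (v₁ , refl) ψv₁≉0 (x+y≈0⇒x≈y (trans (sym (value-⟨1, x ⟩⊗ ψ v)) e)))

  quasiPfister-multipliers : ∀ {n} (φ : Form K n) {d} (κ : Vector Carrier d) →
    (∀ j → IsMultiplier φ (κ j)) →
    (∀ (f : Vector Carrier d) → sum (λ j → (f j * f j) * κ j) ≈ 0# → ∀ j → f j ≈ 0#) →
    ∀ s → (∀ t → t ℕ.< s → ¬ (d ≤ 2 ℕ.^ t)) →
    ∃ λ (a : Vector Carrier s) → HasNoIsotropicVector ⟪ a ⟫ × (∀ i → IsMultiplier φ (a i))
  quasiPfister-multipliers φ κ κ-mult κ-ind zero small = [] , aniso , λ ()
    where
    aniso : HasNoIsotropicVector ⟪ [] ⟫
    aniso v e zero = ¬¬≈ λ v≉0 →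
      v≉0 (x*y≈0⇒y≈0 v≉0 (trans (sym (trans (+-identityʳ _) (*-identityˡ _))) e))
  quasiPfister-multipliers φ κ κ-mult κ-ind (suc s) small
    with quasiPfister-multipliers φ κ κ-mult κ-ind s (λ t t<s → small t (ℕₚ.m<n⇒m<1+n t<s))
  ... | a , a-aniso , a-mult with em {∃ λ j → ¬ Represents ⟪ a ⟫ (κ j)}
  ...   | yes (j , κⱼ∉ψ) = κ j ∷ a , quasiPfister-extend a (κ j) a-aniso κⱼ∉ψ ,
          λ { zero → κ-mult j ; (suc i) → a-mult i }
  -- If all `κ j` were values, vectors `b j` representing them would be independent in dimension
  -- `2 ^ s`: a relation among them with coefficients `f` becomes one among the `κ j` with
  -- coefficients `f²`.
  ...   | no none = ⊥-elim (small s (ℕₚ.n<1+n s) (linearlyIndependent⇒≤ b b-independent))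
    where
    ψ = ⟪ a ⟫
    κ∈ψ : ∀ j → Represents ψ (κ j)
    κ∈ψ j with em {Represents ψ (κ j)}
    ... | yes r = r
    ... | no ¬r = ⊥-elim (none (j , ¬r))
    b : Vector (Vector Carrier (2 ℕ.^ s)) _
    b j = proj₁ (κ∈ψ j)
    b-independent : LinearlyIndependent b
    b-independent f relation = κ-ind f (begin
      sum (λ j → (f j * f j) * κ j)            ≈⟨ sum-cong-≋ (λ j → *-congˡ (proj₂ (κ∈ψ j))) ⟨
      sum (λ j → (f j * f j) * value ψ (b j))  ≈⟨ value-linearCombination ψ f b ⟨
      value ψ (linearCombination f b)          ≈⟨ value-cong ψ relation ⟩
      value ψ (λ _ → 0#)                       ≈⟨ value-0 ψ ⟩
      0#                                       ∎)
      where open SetoidReasoning setoid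

  module _ {n} (φ : Form K n) {s} (a : Vector Carrier s) (a-aniso : HasNoIsotropicVector ⟪ a ⟫)
    (a-mult : ∀ i → IsMultiplier φ (a i)) where

    private
      ψ = ⟪ a ⟫

    value-⊗-∷ : ∀ x {l} (τ : Vector Carrier l) v → value (ψ ⊗ ⟨ x ∷ τ ⟩) v ≈
      x * value ψ (λ i → v (combine i zero)) +
      value (ψ ⊗ ⟨ τ ⟩) (tensorVector {2 ℕ.^ s} (λ i j → v (combine i (suc j))))
    value-⊗-∷ x τ v = trans (value-⊗ʳ ψ ⟨ x ∷ τ ⟩ v)
      (+-congˡ (sym (value-tensorVectorʳ ψ ⟨ τ ⟩ (λ i j → v (combine i (suc j))))))

    ⊗-isMultiplier : ∀ {l} (τ : Form K l) x → Represents ψ x → IsMultiplier (ψ ⊗ τ) x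
    ⊗-isMultiplier τ x x∈ψ y (v , e) =
      tensorVector {2 ℕ.^ s} (λ i j → proj₁ (x*ψ j) i) , (begin
        value (ψ ⊗ τ) (tensorVector {2 ℕ.^ s} (λ i j → proj₁ (x*ψ j) i))
          ≈⟨ value-tensorVectorʳ ψ τ (λ i j → proj₁ (x*ψ j) i) ⟩
        sum (λ j → coeff τ j * value ψ (proj₁ (x*ψ j)))
          ≈⟨ sum-cong-≋ (λ j → trans (*-congˡ (proj₂ (x*ψ j)))
               (solve 3 (λ t x u → t :* (x :* u) := x :* (t :* u)) refl (coeff τ j) x (value ψ (λ i → v (combine i j))))) ⟩
        sum (λ j → x * (coeff τ j * value ψ (λ i → v (combine i j))))
          ≈⟨ *-distribˡ-sum x (λ j → coeff τ j * value ψ (λ i → v (combine i j))) ⟨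
        x * sum (λ j → coeff τ j * value ψ (λ i → v (combine i j)))
          ≈⟨ *-congˡ (trans (sym (value-⊗ʳ ψ τ v)) e) ⟩
        x * y ∎)
      where
      open SetoidReasoning setoid
      x*ψ : ∀ j → Represents ψ (x * value ψ (λ i → v (combine i j)))
      x*ψ j = quasiPfister-* a x∈ψ ((λ i → v (combine i j)) , refl)

    -- The values of `ψ ⊗ ⟨ τ ⟩` form a vector space over the field of values of `ψ`, so an
    -- isotropic vector with `ψ(v₀)` nonzero would make `x` a value of `ψ ⊗ ⟨ τ ⟩`.
    ⊗-extend : ∀ x {l} (τ : Vector Carrier l) → HasNoIsotropicVector (ψ ⊗ ⟨ τ ⟩) →
               ¬ Represents (ψ ⊗ ⟨ τ ⟩) x → HasNoIsotropicVector (ψ ⊗ ⟨ x ∷ τ ⟩)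
    ⊗-extend x {l} τ τ-aniso x∉ v e = combine-≈0 {2 ℕ.^ s} v λ
      { i zero    → a-aniso v₀ v₀-isotropic i
      ; i (suc j) → trans (reflexive (≡.sym (tensorVector-combine {2 ℕ.^ s} v₊ i j)))
                      (τ-aniso (tensorVector v₊) v₊-isotropic (combine i j)) }
      where
      v₀ : Vector Carrier (2 ℕ.^ s)
      v₀ i = v (combine i zero)
      v₊ : Fin (2 ℕ.^ s) → Vector Carrier l
      v₊ i j = v (combine i (suc j))
      relation : x * value ψ v₀ + value (ψ ⊗ ⟨ τ ⟩) (tensorVector v₊) ≈ 0#
      relation = trans (sym (value-⊗-∷ x τ v)) e
      v₀-isotropic : value ψ v₀ ≈ 0#
      v₀-isotropic = ¬¬≈ λ ψv₀≉0 → x∉ (represents-quotient a (ψ ⊗ ⟨ τ ⟩) (⊗-isMultiplier ⟨ τ ⟩) x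
        (tensorVector v₊ , refl) (v₀ , refl) ψv₀≉0 (sym (x+y≈0⇒x≈y relation)))
      v₊-isotropic : value (ψ ⊗ ⟨ τ ⟩) (tensorVector v₊) ≈ 0#
      v₊-isotropic = trans
        (sym (trans (+-congʳ (trans (*-congˡ v₀-isotropic) (zeroʳ x))) (+-identityˡ _))) relation

    -- Each column contributes a coefficient of `τ` times a value of `ψ`, and values of `ψ` are
    -- multipliers of `φ`.
    ⊗-represented : ∀ {l} (τ : Form K l) → (∀ j → Represents φ (coeff τ j)) →
                    ∀ v → Represents φ (value (ψ ⊗ τ) v)
    ⊗-represented τ τ⊆φ v = represents-≈ φ (sym (value-⊗ʳ ψ τ v))
      (represents-sum φ (λ j → coeff τ j * value ψ (λ i → v (combine i j))) (λ j → represents-≈ φ (*-comm _ _)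
        (quasiPfister-isMultiplier φ a a-mult ((λ i → v (combine i j)) , refl) (coeff τ j) (τ⊆φ j))))

    represents-⊗-∷ : ∀ x {l} (τ : Vector Carrier l) {y z} → Represents ψ z → Represents (ψ ⊗ ⟨ τ ⟩) y →
                     Represents (ψ ⊗ ⟨ x ∷ τ ⟩) (x * z + y)
    represents-⊗-∷ x {l} τ (w , e) (v , e′) = tensorVector {2 ℕ.^ s} u , trans
      (value-tensorVectorʳ ψ ⟨ x ∷ τ ⟩ u)
      (+-cong (*-congˡ e) (trans (sym (value-⊗ʳ ψ ⟨ τ ⟩ v)) e′))
      where
      u : Fin (2 ℕ.^ s) → Vector Carrier (suc l)
      u i = w i ∷ λ j → v (combine i j)

    -- The coefficients of τ form a maximal independent family in d over the field of values of ψ.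
    maximalAnisotropic : ∀ {k} (d : Vector Carrier k) → (∀ i → Represents φ (d i)) →
      ∃₂ λ l (τ : Vector Carrier l) → HasNoIsotropicVector (ψ ⊗ ⟨ τ ⟩) ×
        (∀ j → Represents φ (τ j)) × (∀ i → Represents (ψ ⊗ ⟨ τ ⟩) (d i))
    maximalAnisotropic {zero}  d d⊆φ =
      0 , [] , (λ v _ → combine-≈0 {2 ℕ.^ s} v (λ _ ())) , (λ ()) , (λ ())
    maximalAnisotropic {suc k} d d⊆φ with maximalAnisotropic (tail d) (λ i → d⊆φ (suc i))
    ... | l , τ , τ-aniso , τ⊆φ , d⊆τ with em {Represents (ψ ⊗ ⟨ τ ⟩) (head d)}
    ...   | yes d₀∈τ = l , τ , τ-aniso , τ⊆φ , λ { zero → d₀∈τ ; (suc i) → d⊆τ i }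
    ...   | no d₀∉τ = suc l , head d ∷ τ , ⊗-extend (head d) τ τ-aniso d₀∉τ ,
            (λ { zero → d⊆φ zero ; (suc j) → τ⊆φ j }) ,
            λ { zero    → represents-≈ (ψ ⊗ ⟨ head d ∷ τ ⟩)
                            (trans (+-identityʳ _) (*-identityʳ _))
                            (represents-⊗-∷ (head d) τ (quasiPfister-1 a) ((λ _ → 0#) , value-0 (ψ ⊗ ⟨ τ ⟩)))
              ; (suc i) → represents-≈ (ψ ⊗ ⟨ head d ∷ τ ⟩)
                            (trans (+-congʳ (zeroʳ _)) (+-identityˡ _))
                            (represents-⊗-∷ (head d) τ ((λ _ → 0#) , value-0 ψ) (d⊆τ i)) }

  multipliers⇒divisible : ∀ {k} (φ : Form K (suc k)) → HasNoIsotropicVector φ →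
    ∀ {s} (a : Vector Carrier s) → HasNoIsotropicVector ⟪ a ⟫ → (∀ i → IsMultiplier φ (a i)) →
    φ DivisibleBy ⟪ a ⟫
  multipliers⇒divisible φ φ-aniso a a-aniso a-mult
    with maximalAnisotropic φ a a-aniso a-mult (coeff φ) (represents-coeff φ)
  -- The second factor must have nonzero dimension: with `τ` empty, the first coefficient of `φ`
  -- would be zero.
  ... | zero  , τ , _ , _ , φ⊆τ = ⊥-elim (1≉0 (φ-aniso (unitVector zero)
          (trans (value-unitVector φ zero)
            (trans (sym (proj₂ (φ⊆τ zero))) (value-⊗ʳ ⟪ a ⟫ ⟨ τ ⟩ (proj₁ (φ⊆τ zero))))) zero))
  ... | suc l , τ , τ-aniso , τ⊆φ , φ⊆τ = l , ⟨ τ ⟩ , sameValues⇒≃ φ (⟪ a ⟫ ⊗ ⟨ τ ⟩) φ-aniso τ-aniso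
    (λ v → represents-≈ (⟪ a ⟫ ⊗ ⟨ τ ⟩) (*-identityʳ _)
      (represents-value φ (⟪ a ⟫ ⊗ ⟨ τ ⟩) 1#
        (λ i → represents-≈ (⟪ a ⟫ ⊗ ⟨ τ ⟩) (sym (*-identityʳ _)) (φ⊆τ i)) v))
    (⊗-represented φ a a-aniso a-mult ⟨ τ ⟩ τ⊆φ)

-- Divisibility of the first higher anisotropic kernel

field⇒integral : ∀ {c ℓ} → ExcludedMiddle (c ⊔ ℓ) → (F : CommutativeRing c ℓ) → IsField F → IsIntegral F
field⇒integral {c} {ℓ} em F F-field x y xy≈0 with em {Lift c (x ≈ 0#)}
  where open CommutativeRing F
... | yes (lift x≈0) = inj₁ x≈0
... | no x≉0 with IsField.inverse F-field x (λ x≈0 → x≉0 (lift x≈0))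
...   | x⁻¹ , xx⁻¹≈1 = inj₂ (begin
    y               ≈⟨ *-identityˡ y ⟨
    1# * y          ≈⟨ *-congʳ (trans (*-comm x⁻¹ x) xx⁻¹≈1) ⟨
    (x⁻¹ * x) * y   ≈⟨ *-assoc x⁻¹ x y ⟩
    x⁻¹ * (x * y)   ≈⟨ *-congˡ xy≈0 ⟩
    x⁻¹ * 0#        ≈⟨ zeroʳ x⁻¹ ⟩
    0#              ∎)
  where
  open CommutativeRing F hiding (zero)
  open SetoidReasoning setoid

module _ {ℓ : Level} (em : ExcludedMiddle ℓ) (K : CommutativeRing ℓ ℓ) (K-field : IsField K)
  (1+1≈0 : HasCharacteristic2 K) where
  open CommutativeRing K
  open LinearAlgebra K
  open CommutativeRingProperties K
  open Characteristic2 K 1+1≈0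
  open ClassicalField em K K-field 1+1≈0

  -- Being a multiplier depends only on the set of values, which `φ₁` shares with `φ`; so the
  -- scalars found from the isotropic vectors of `φ` act on `φ₁`. Minimality of `s` says that
  -- `2 ^ t < d` for every `t < s`.
  anisotropicPart-divisible : ∀ {n k d} (φ : Form K n) (φ₁ : Form K (suc k)) → φ₁ IsAnisotropicPartOf φ →
    (κ : Vector Carrier d) → (∀ j i → Represents φ (coeff φ i * κ j)) →
    (∀ (f : Vector Carrier d) → sum (λ j → (f j * f j) * κ j) ≈ 0# → ∀ j → f j ≈ 0#) →
    ∀ s → (∀ t → d ≤ 2 ℕ.^ t → s ≤ t) →
    ∃ λ (a : Vector Carrier s) → φ₁ DivisibleBy quasiPfister a
  anisotropicPart-divisible φ φ₁ (φ₁-anisotropic , φ₁-values) κ κ-represented κ-independent s s-least =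
    let a , a-aniso , a-isMultiplier = quasiPfister-multipliers φ₁ κ κ-isMultiplier κ-independent s
          (λ t t<s d≤2^t → ℕₚ.<⇒≱ t<s (s-least t d≤2^t))
    in a , multipliers⇒divisible φ₁ (anisotropic⇒noIsotropicVector φ₁ φ₁-anisotropic) a a-aniso a-isMultiplier
    where
    κ-isMultiplier : ∀ j → IsMultiplier φ₁ (κ j)
    κ-isMultiplier j y y∈φ₁ =
      let v , e = Equivalence.to (φ₁-values y) y∈φ₁
      in Equivalence.from (φ₁-values (κ j * y)) (represents-≈ φ (trans (*-congʳ e) (*-comm y (κ j)))
           (represents-value φ φ (κ j) (κ-represented j) v))

module _ {c ℓ : Level} (em : ExcludedMiddle (c ⊔ ℓ)) (A : CommutativeRing c (c ⊔ ℓ)) (A-integral : IsIntegral A)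
  (1≉0 : ¬ CommutativeRing._≈_ A (CommutativeRing.1# A) (CommutativeRing.0# A))
  (1+1≈0 : HasCharacteristic2 A) {n : ℕ} (φ : Form A n) (derivation : IsotropyDerivation φ) where
  open FractionField A
  -- The fraction ring and the form over it are given up to equality, which lets the theorem
  -- be applied to functionField φ without unfolding that ring in every hypothesis.
  anisotropicPart-divisible-fractionField :
    (K : CommutativeRing (c ⊔ ℓ) (c ⊔ ℓ)) (Φ : Form K n) →
    _≡_ {A = ∃ λ K → Form K n} (K , Φ) (Fractions.fractionRing A , ⟨ (λ i → Fractions.fromBase A (coeff φ i)) ⟩) →
    ∀ {i₁ k} → HasIsotropyIndex Φ i₁ →
    (φ₁ : Form K (suc k)) → φ₁ IsAnisotropicPartOf Φ →
    ∀ s → (∀ t → i₁ ≤ 2 ℕ.^ t → s ≤ t) →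
    ∃ λ (a : Vector (CommutativeRing.Carrier K) s) → φ₁ DivisibleBy quasiPfister a
  anisotropicPart-divisible-fractionField K Φ ≡.refl (w , w-isotropic , w-independent , _) φ₁ φ₁-part =
    let κ , κ-represented , κ-independent = multipliers w w-independent w-isotropic
    in anisotropicPart-divisible em K (isField A-integral 1≉0)
         (Homomorphism.characteristic2-homo A K fromBase-homo 1+1≈0) Φ φ₁ φ₁-part κ κ-represented κ-independent
    where
    denominators : ∀ {n} (v : Vector (CommutativeRing.Carrier K) n) → _
    denominators v =
      let d , p , d-regular , e = commonDenominator v in d , p , fromBase-regular d-regular , e
    open ClearDenominators A K 1+1≈0 (Fractions.fromBase A) fromBase-homo fromBase-injective
      denominators φ derivation

open import Data.Nat.Base using (_+_; _^_)

mainTheorem2 : ∀ {c ℓ : Level} → ExcludedMiddle (c ⊔ ℓ) →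
    (F : CommutativeRing c ℓ) → IsField F → HasCharacteristic2 F →
    (m : ℕ) (φ : Form F (2 + m)) → Anisotropic φ →
    (i₁ : ℕ) → HasIsotropyIndex (overFunctionField φ) i₁ →
    (k : ℕ) (φ₁ : Form (functionField φ) (suc k)) → φ₁ IsAnisotropicPartOf overFunctionField φ →
    (s : ℕ) → IsLeast (λ t → i₁ ≤ 2 ^ t) s →
    ∃ λ (a : Vector (CommutativeRing.Carrier (functionField φ)) s) → φ₁ DivisibleBy quasiPfister a
mainTheorem2 {c} {ℓ} em F F-field 1+1≈0 m φ φ-anisotropic i₁ index k φ₁ φ₁-part s (_ , s-least) =
  anisotropicPart-divisible-fractionField {c} {ℓ} em (FunctionField.coordinateRing φ)
    coordinateRing-isIntegral coordinateRing-1≉0 coordinateRing-characteristic2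
    ⟨ (λ i → Polynomials.const (coeff φ i)) ⟩ coordinateRing-isotropyDerivation
    (functionField φ) (overFunctionField φ) ≡.refl index φ₁ φ₁-part s s-least
  where
  open CommutativeRing F hiding (zero)
  open IsField F-field
  open CommutativeRingProperties F

  φ-aniso : HasNoIsotropicVector φ
  φ-aniso = anisotropic⇒noIsotropicVector φ φ-anisotropic

  a₁ : Carrier
  a₁ = coeff φ (suc zero)

  -- `a₁` is the value of `φ` at the second basis vector, hence nonzero by anisotropy.
  a₁-inverse : ∃ λ y → a₁ * y ≈ 1#
  a₁-inverse = inverse a₁ λ a₁≈0 → 1≉0
    (φ-aniso (unitVector (suc zero)) (trans (value-unitVector φ (suc zero)) a₁≈0) (suc zero))

  open CoordinateRing {F = F} (field⇒integral em F F-field) 1≉0 1+1≈0 φ φ-aniso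
    (proj₁ a₁-inverse) (trans (*-comm _ _) (proj₂ a₁-inverse))
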